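{- Let $\rho$ be a positive integer. For $n\ge1$ define $$q_n^{(\rho)}=\sum_{k=0}^{n}b_{k,n}^{(\rho)},\qquad p_n^{(\rho)}=\sum_{k=1}^{n}\Big(b_{k,n}^{(\rho)}H_k^{(3)}+\tfrac12 a_{k,n}^{(\rho)}H_k^{(2)}\Big),\qquad r_n^{(\rho)}=-\tfrac12\sum_{j\ge0}\mathcal{F}_{n,2}^{(\rho)}(j).$$ Then each of the three sequences $y_n=q_n^{(\rho)}$, $y_n=p_n^{(\rho)}$, $y_n=r_n^{(\rho)}$ satisfies, for all $n\ge1$, $$(n+2)^4\Phi_n^{(\rho)}y_{n+2}+\beta_n^{(\rho)}y_{n+1}+n^4\Phi_{n+1}^{(\rho)}y_n=0,$$ where $$\Phi_n^{(\rho)}=24n^5\rho^2-12n^5+54n^4\rho^2+39n^4\rho-33n^4+46n^3\rho^2+70n^3\rho+19n^2\rho^2+56n^2\rho+33n^2+3n\rho^2+21n\rho+24n+3\rho+5$$ and $$\begin{aligned}\beta_n^{(\rho)}=-2(n+1)\big(&408n^8\rho^2-204n^8+3162n^7\rho^2+663n^7\rho-1683n^7+10028n^6\rho^2+4433n^6\rho-4899n^6\\&+16802n^5\rho^2+12409n^5\rho-5487n^5+16070n^4\rho^2+18955n^4\rho+735n^4+8888n^3\rho^2\\&+17212n^3\rho+7366n^3+2708n^2\rho^2+9340n^2\rho+6870n^2+344n\rho^2+2776n\rho+2748n+344\rho+412\big).\end{aligned}$$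
   Context: $(z)_k=\prod_{j=0}^{k-1}(z+j)$, $(z)_0=1$. $H_k^{(r)}=\sum_{j=1}^k j^{ -r}$, $H_k=H_k^{(1)}$, $H_0=0$. $\mathcal{F}_{n,1}^{(\rho)}(z)=\dfrac{(-z)_{n-1}^2(z-n+1)(z-\rho n)}{(z+1)_{n+1}^2}$ and $\mathcal{F}_{n,2}^{(\rho)}=\frac{d}{dz}\mathcal{F}_{n,1}^{(\rho)}$. For $k=0,\dots,n$: $b_{k,n}^{(\rho)}=\binom{n+k}{k}^2\binom{n}{k}^2\frac{k+\rho n+1}{n+k}$ and $a_{k,n}^{(\rho)}=2b_{k,n}^{(\rho)}\big[2H_k-H_{n+k-1}-H_{n-k}-\frac{(\rho+1)n+2k+1}{2(k+\rho n+1)(n+k)}\big]$. -}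

module Defs where

open import Data.Nat as ℕ using (ℕ; zero; suc)
open import Data.Nat.Combinatorics using (_C_)
open import Data.Integer as ℤ using (ℤ; +_)
open import Data.Rational as ℚ using (ℚ; 0ℚ; 1ℚ; ½; _+_; _*_; _-_; -_; _÷_; _≤_; _<_; ∣_∣)
open import Data.Rational.Properties using (_≟_)
open import Data.List using (List; []; _∷_)
open import Data.Product using (∃; _×_)
open import Relation.Nullary using (yes; no)
open import Relation.Binary.PropositionalEquality using (_≡_)

ofℕ : ℕ → ℚ
ofℕ n = + n ℚ./ 1

ofℤ : ℤ → ℚ
ofℤ z = z ℚ./ 1

-- total division: x / 0 := 0 (only ever used with nonzero denominators)
_÷'_ : ℚ → ℚ → ℚ
x ÷' y with y ≟ 0ℚ
... | yes _ = 0ℚ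
... | no y≢0 = _÷_ x y {{ℚ.≢-nonZero y≢0}}

_^'_ : ℚ → ℕ → ℚ
x ^' zero = 1ℚ
x ^' suc k = x * (x ^' k)

-- Σ_{k=a}^{b} f k  (empty if b < a)
sumFromTo : ℕ → ℕ → (ℕ → ℚ) → ℚ
sumFromTo a b f = go (suc b ℕ.∸ a)
  where
  go : ℕ → ℚ
  go zero = 0ℚ
  go (suc m) = f (a ℕ.+ m) + go m

H^ : ℕ → ℕ → ℚ
H^ r k = sumFromTo 1 k (λ j → 1ℚ ÷' (ofℕ j ^' r))

H : ℕ → ℚ
H = H^ 1

b : ℕ → ℕ → ℕ → ℚ
b ρ k n = ofℕ (((n ℕ.+ k) C k) ℕ.^ 2 ℕ.* ((n C k) ℕ.^ 2))
          * (ofℕ (k ℕ.+ ρ ℕ.* n ℕ.+ 1) ÷' ofℕ (n ℕ.+ k))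

a : ℕ → ℕ → ℕ → ℚ
a ρ k n = (ofℕ 2 * b ρ k n) *
  ( ofℕ 2 * H k - H (n ℕ.+ k ℕ.∸ 1) - H (n ℕ.∸ k)
    - (ofℕ ((ρ ℕ.+ 1) ℕ.* n ℕ.+ 2 ℕ.* k ℕ.+ 1)
        ÷' ofℕ (2 ℕ.* (k ℕ.+ ρ ℕ.* n ℕ.+ 1) ℕ.* (n ℕ.+ k))) )

q : ℕ → ℕ → ℚ
q ρ n = sumFromTo 0 n (λ k → b ρ k n)

p : ℕ → ℕ → ℚ
p ρ n = sumFromTo 1 n (λ k → b ρ k n * H^ 3 k + ½ * a ρ k n * H^ 2 k)

-- Polynomials over ℚ as coefficient lists (lowest degree first),
-- with the formal derivative.

Poly : Set
Poly = List ℚ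

infixl 6 _+P_
infixl 7 _*P_

_+P_ : Poly → Poly → Poly
[] +P g = g
(x ∷ f) +P [] = x ∷ f
(x ∷ f) +P (y ∷ g) = (x + y) ∷ (f +P g)

scaleP : ℚ → Poly → Poly
scaleP c [] = []
scaleP c (x ∷ f) = (c * x) ∷ scaleP c f

_*P_ : Poly → Poly → Poly
[] *P g = []
(x ∷ f) *P g = scaleP x g +P (0ℚ ∷ (f *P g))

negP : Poly → Poly
negP = scaleP (- 1ℚ)

evalP : Poly → ℚ → ℚ
evalP [] z = 0ℚ
evalP (x ∷ f) z = x + z * evalP f z

derivP : Poly → Poly
derivP [] = []
derivP (_ ∷ f) = go 1 f
  where
  go : ℕ → Poly → Poly
  go i [] = []
  go i (y ∷ g) = (ofℕ i * y) ∷ go (suc i) g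

prodP : ℕ → (ℕ → Poly) → Poly
prodP zero f = 1ℚ ∷ []
prodP (suc m) f = prodP m f *P f m

infix 4 _//_

record RatFun : Set where
  constructor _//_
  field
    num : Poly
    den : Poly

evalR : RatFun → ℚ → ℚ
evalR (N // D) z = evalP N z ÷' evalP D z

derivR : RatFun → RatFun
derivR (N // D) = ((derivP N *P D) +P negP (N *P derivP D)) // (D *P D)

-- (-z)_{n-1} = ∏_{i=0}^{n-2} (i - z)
negPoch : ℕ → Poly
negPoch n = prodP (n ℕ.∸ 1) (λ i → ofℕ i ∷ (- 1ℚ) ∷ [])

-- (z+1)_{n+1} = ∏_{i=0}^{n} (z + 1 + i)
posPoch : ℕ → Poly
posPoch n = prodP (suc n) (λ i → ofℕ (suc i) ∷ 1ℚ ∷ [])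

F1 : ℕ → ℕ → RatFun
F1 ρ n = (negPoch n *P negPoch n *P ((ofℕ 1 - ofℕ n) ∷ 1ℚ ∷ [])
            *P ((- ofℕ (ρ ℕ.* n)) ∷ 1ℚ ∷ []))
         // (posPoch n *P posPoch n)

F2 : ℕ → ℕ → RatFun
F2 ρ n = derivR (F1 ρ n)

S : ℕ → ℕ → ℕ → ℚ
S ρ n zero = 0ℚ
S ρ n (suc M) = S ρ n M + evalR (F2 ρ n) (ofℕ M)

rPartial : ℕ → ℕ → ℕ → ℚ
rPartial ρ n M = - (½ * S ρ n M)

IsCauchy : (ℕ → ℚ) → Set
IsCauchy s = ∀ (ε : ℚ) → 0ℚ < ε → ∃ λ N → ∀ M M' → N ℕ.≤ M → N ℕ.≤ M' → ∣ s M - s M' ∣ ≤ ε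

TendsToZero : (ℕ → ℚ) → Set
TendsToZero s = ∀ (ε : ℚ) → 0ℚ < ε → ∃ λ N → ∀ M → N ℕ.≤ M → ∣ s M ∣ ≤ ε

Φ : ℕ → ℕ → ℚ
Φ ρ n = ofℤ (
  + 24 ℤ.* n' ^5 ℤ.* ρ' ^2 ℤ.- + 12 ℤ.* n' ^5 ℤ.+ + 54 ℤ.* n' ^4 ℤ.* ρ' ^2
  ℤ.+ + 39 ℤ.* n' ^4 ℤ.* ρ' ℤ.- + 33 ℤ.* n' ^4 ℤ.+ + 46 ℤ.* n' ^3 ℤ.* ρ' ^2
  ℤ.+ + 70 ℤ.* n' ^3 ℤ.* ρ' ℤ.+ + 19 ℤ.* n' ^2 ℤ.* ρ' ^2 ℤ.+ + 56 ℤ.* n' ^2 ℤ.* ρ'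
  ℤ.+ + 33 ℤ.* n' ^2 ℤ.+ + 3 ℤ.* n' ℤ.* ρ' ^2 ℤ.+ + 21 ℤ.* n' ℤ.* ρ'
  ℤ.+ + 24 ℤ.* n' ℤ.+ + 3 ℤ.* ρ' ℤ.+ + 5)
  where
  n' ρ' : ℤ
  n' = + n
  ρ' = + ρ
  _^2 _^3 _^4 _^5 : ℤ → ℤ
  x ^2 = x ℤ.^ 2
  x ^3 = x ℤ.^ 3
  x ^4 = x ℤ.^ 4
  x ^5 = x ℤ.^ 5

β : ℕ → ℕ → ℚ
β ρ n = ofℤ (ℤ.- (+ 2 ℤ.* (n' ℤ.+ + 1) ℤ.* (
  + 408 ℤ.* n' ^8 ℤ.* ρ' ^2 ℤ.- + 204 ℤ.* n' ^8 ℤ.+ + 3162 ℤ.* n' ^7 ℤ.* ρ' ^2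
  ℤ.+ + 663 ℤ.* n' ^7 ℤ.* ρ' ℤ.- + 1683 ℤ.* n' ^7 ℤ.+ + 10028 ℤ.* n' ^6 ℤ.* ρ' ^2
  ℤ.+ + 4433 ℤ.* n' ^6 ℤ.* ρ' ℤ.- + 4899 ℤ.* n' ^6
  ℤ.+ + 16802 ℤ.* n' ^5 ℤ.* ρ' ^2 ℤ.+ + 12409 ℤ.* n' ^5 ℤ.* ρ' ℤ.- + 5487 ℤ.* n' ^5
  ℤ.+ + 16070 ℤ.* n' ^4 ℤ.* ρ' ^2 ℤ.+ + 18955 ℤ.* n' ^4 ℤ.* ρ' ℤ.+ + 735 ℤ.* n' ^4
  ℤ.+ + 8888 ℤ.* n' ^3 ℤ.* ρ' ^2
  ℤ.+ + 17212 ℤ.* n' ^3 ℤ.* ρ' ℤ.+ + 7366 ℤ.* n' ^3 ℤ.+ + 2708 ℤ.* n' ^2 ℤ.* ρ' ^2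
  ℤ.+ + 9340 ℤ.* n' ^2 ℤ.* ρ' ℤ.+ + 6870 ℤ.* n' ^2 ℤ.+ + 344 ℤ.* n' ℤ.* ρ' ^2
  ℤ.+ + 2776 ℤ.* n' ℤ.* ρ' ℤ.+ + 2748 ℤ.* n' ℤ.+ + 344 ℤ.* ρ' ℤ.+ + 412)))
  where
  n' ρ' : ℤ
  n' = + n
  ρ' = + ρ
  _^2 _^3 _^4 _^5 _^6 _^7 _^8 : ℤ → ℤ
  x ^2 = x ℤ.^ 2
  x ^3 = x ℤ.^ 3
  x ^4 = x ℤ.^ 4
  x ^5 = x ℤ.^ 5
  x ^6 = x ℤ.^ 6
  x ^7 = x ℤ.^ 7
  x ^8 = x ℤ.^ 8

recLHS : ℕ → (ℕ → ℚ) → ℕ → ℚ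
recLHS ρ y n = ofℕ ((n ℕ.+ 2) ℕ.^ 4) * Φ ρ n * y (n ℕ.+ 2)
             + β ρ n * y (n ℕ.+ 1)
             + ofℕ (n ℕ.^ 4) * Φ ρ (n ℕ.+ 1) * y n

SatisfiesRec : ℕ → (ℕ → ℚ) → ℕ → Set
SatisfiesRec ρ y n = recLHS ρ y n ≡ 0ℚ

{-# OPTIONS --safe #-}

-- Put R_n = F_{n,1}. Zeilberger's algorithm gives a polynomial T of degree 4 in z such that
--   G(z) = (-z)_n² T(z) / (z+1)_{n+2}²
-- satisfies (n+1)² ((n+2)⁴ Φ_n R_{n+2} + β_n R_{n+1} + n⁴ Φ_{n+1} R_n)(z) = 2 (G(z+1) - G(z)).
-- Everything follows by evaluating this one identity at dual numbers (ε² = 0), which carry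
-- derivatives and double poles along.
--   At z = j + ε the ε-part is the corresponding identity for F_{n,2}(j). Since G(ε) = 0, it telescopes
-- to show that the partial sums of r satisfy the recurrence up to a multiple of G'(M), which tends to 0.
--   At the poles, R_n(-(k+1)+ε) = (b_k + ε a_k)/ε², so the coefficients telescope in k as well.
-- This gives the recurrence for q. For p, summation by parts leaves
-- Σ_k (g_k/(k+1)³ + h_k/(2(k+1)²)), where g_k + ε h_k is the polar part of G at -(k+1).
-- By partial fractions this is -G'(0)/2, which vanishes because (-z)_n² has a double zero at 0.

module Submission where

open import Defs
open import Data.Nat using (ℕ; _≤_)
open import Data.Product using (_×_)
open import Data.Nat as ℕ using (zero; suc; z≤n; s≤s; _!)
import Data.Nat.Properties as ℕ
open import Data.Nat.Combinatorics using (_C_; nCk≡n!/k![n-k]!; k![n∸k]!∣n!)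
open import Data.Nat.DivMod using (m/n*n≡m)
import Data.Nat.Solver
open import Data.Integer as ℤ using (ℤ; +_; -[1+_])
import Data.Integer.Properties as ℤ
open import Data.Rational as ℚ using (ℚ; mkℚ; 0ℚ; 1ℚ; ½; _+_; _*_; _-_; -_; ∣_∣)
import Data.Rational.Properties as ℚ
open import Data.Rational.Unnormalised as ℚᵘ using (mkℚᵘ; *≡*; *≤*)
import Data.Rational.Unnormalised.Properties as ℚᵘ
open import Data.Product using (_,_; proj₁; proj₂; ∃; Σ)
open import Data.Empty using (⊥-elim)
open import Data.List using (List; []; _∷_; length)
open import Data.Vec as Vec using (Vec; []; _∷_)
open import Data.Vec.N-ary using (N-ary; _$ⁿ_; Eq; curryⁿ; curryⁿ-cong)
open import Data.Fin using (zero; suc)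
open import Data.Maybe using (Maybe; just; nothing)
open import Level using (0ℓ)
open import Relation.Nullary using (yes; no)
open import Relation.Binary.Definitions using (tri<; tri≈; tri>)
open import Relation.Binary.PropositionalEquality hiding (J)
open import Algebra.Bundles using (CommutativeRing)
open import Algebra.Solver.Ring.AlmostCommutativeRing using (fromCommutativeRing; _-Raw-AlmostCommutative⟶_)
import Algebra.Solver.Ring as RingSolver

-- One polynomial identity serves both evaluations because, with s = (-z)_{n-1}/(z+1)_{n+3}, each of
-- R_{n+2}, R_{n+1}, R_n, G(z) and G(z+1) is s² times a polynomial. Without s² there remains an
-- identity over ℤ in z, n and ρ, valid in every commutative ring and after multiplication by any
-- s². At an ordinary point s is the quotient itself; at a pole, where that quotient is not a dual
-- number, s is up to sign ε times the quotient. The degrees leave no slack. Numerator and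
-- denominator of G both have degree at most 2n+4, so G need not vanish at infinity and its partial
-- fraction expansion may contain a constant. This is why the residue relation is read off from the
-- derivative at 0, which does not see the constant, and why G is merely bounded while the
-- derivative is O(1/M). The limit r need not lie in ℚ. It is therefore handled through its rational
-- partial sums: they are Cauchy, and the left-hand side of the recurrence formed from them tends to
-- 0.

module NS = Data.Nat.Solver.+-*-Solver

-- Integers in ℚ, and ring solvers with integer coefficients

ofℤ-+ : ∀ x y → ofℤ (x ℤ.+ y) ≡ ofℤ x + ofℤ y
-- Normalisation divides by a gcd that is stuck on variables, so the computation takes place among
-- unnormalised fractions with denominator 1.
ofℤ-+ x y = ℚ.toℚᵘ-injective (begin
  ℚ.toℚᵘ (ofℤ (x ℤ.+ y))               ≈⟨ ℚ.toℚᵘ-fromℚᵘ (mkℚᵘ (x ℤ.+ y) 0) ⟩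
  mkℚᵘ (x ℤ.+ y) 0                      ≈⟨ *≡* (cong (ℤ._* + 1) (sym (cong₂ ℤ._+_ (ℤ.*-identityʳ x) (ℤ.*-identityʳ y)))) ⟩
  mkℚᵘ x 0 ℚᵘ.+ mkℚᵘ y 0                ≈⟨ ℚᵘ.+-cong (ℚ.toℚᵘ-fromℚᵘ (mkℚᵘ x 0)) (ℚ.toℚᵘ-fromℚᵘ (mkℚᵘ y 0)) ⟨
  ℚ.toℚᵘ (ofℤ x) ℚᵘ.+ ℚ.toℚᵘ (ofℤ y)    ≈⟨ ℚ.toℚᵘ-homo-+ (ofℤ x) (ofℤ y) ⟨
  ℚ.toℚᵘ (ofℤ x + ofℤ y)                ∎)
  where open import Relation.Binary.Reasoning.Setoid ℚᵘ.≃-setoid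

ofℤ-* : ∀ x y → ofℤ (x ℤ.* y) ≡ ofℤ x * ofℤ y
ofℤ-* x y = ℚ.toℚᵘ-injective (begin
  ℚ.toℚᵘ (ofℤ (x ℤ.* y))               ≈⟨ ℚ.toℚᵘ-fromℚᵘ (mkℚᵘ (x ℤ.* y) 0) ⟩
  mkℚᵘ x 0 ℚᵘ.* mkℚᵘ y 0                ≈⟨ ℚᵘ.*-cong (ℚ.toℚᵘ-fromℚᵘ (mkℚᵘ x 0)) (ℚ.toℚᵘ-fromℚᵘ (mkℚᵘ y 0)) ⟨
  ℚ.toℚᵘ (ofℤ x) ℚᵘ.* ℚ.toℚᵘ (ofℤ y)    ≈⟨ ℚ.toℚᵘ-homo-* (ofℤ x) (ofℤ y) ⟨
  ℚ.toℚᵘ (ofℤ x * ofℤ y)                ∎)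
  where open import Relation.Binary.Reasoning.Setoid ℚᵘ.≃-setoid

open ≡-Reasoning

ofℤ-neg : ∀ x → ofℤ (ℤ.- x) ≡ - ofℤ x
ofℤ-neg (+ zero)   = refl
ofℤ-neg (+ suc n)  = refl
ofℤ-neg -[1+ n ]   = sym (⁻¹-involutive (ofℤ (+ suc n)))
  where open import Algebra.Properties.Group ℚ.+-0-group using (⁻¹-involutive)

ofℕ-+ : ∀ m n → ofℕ (m ℕ.+ n) ≡ ofℕ m + ofℕ n
ofℕ-+ m n = ofℤ-+ (+ m) (+ n)

ofℕ-* : ∀ m n → ofℕ (m ℕ.* n) ≡ ofℕ m * ofℕ n
ofℕ-* m n = trans (cong ofℤ (ℤ.pos-* m n)) (ofℤ-* (+ m) (+ n))

-- With integer coefficients, coefficients are compared by computation in ℤ, for ℚ and for the dual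
-- numbers alike; equality in R itself is never decided.
module ℤSolver (R : CommutativeRing 0ℓ 0ℓ)
               (morphism : ℤ.+-*-rawRing -Raw-AlmostCommutative⟶ fromCommutativeRing R) where
  open CommutativeRing R using (_≈_; reflexive)
  open _-Raw-AlmostCommutative⟶_ morphism using () renaming (⟦_⟧ to embed)

  embed-≟ : ∀ x y → Maybe (embed x ≈ embed y)
  embed-≟ x y with x ℤ.≟ y
  ... | yes x≡y = just (reflexive (cong embed x≡y))
  ... | no  _   = nothing

  open RingSolver ℤ.+-*-rawRing (fromCommutativeRing R) morphism embed-≟ public hiding (solve)

  -- Comparing closed normal forms means that no operation of R is ever unfolded.
  prove-by-normalising : ∀ {n} (xs : Env n) (s t : Polynomial n) →
                         normalise s ≡ normalise t → ⟦ s ⟧ xs ≈ ⟦ t ⟧ xs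
  prove-by-normalising xs s t eq = prove xs s t (reflexive (cong (λ p → ⟦ p ⟧N xs) eq))

  close : ∀ {A : Set} n → N-ary n (Polynomial n) A → A
  close n f = f $ⁿ Vec.map var (Vec.allFin n)

  solve : ∀ n (f : N-ary n (Polynomial n) (Polynomial n × Polynomial n)) →
          normalise (proj₁ (close n f)) ≡ normalise (proj₂ (close n f)) →
          Eq n _≈_ (curryⁿ ⟦ proj₁ (close n f) ⟧) (curryⁿ ⟦ proj₂ (close n f) ⟧)
  solve n f eq = curryⁿ-cong _≈_ ⟦ proj₁ (close n f) ⟧ ⟦ proj₂ (close n f) ⟧
    (λ xs → prove-by-normalising xs (proj₁ (close n f)) (proj₂ (close n f)) eq)

ℤ⟶ℚ : ℤ.+-*-rawRing -Raw-AlmostCommutative⟶ fromCommutativeRing ℚ.+-*-commutativeRing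
ℤ⟶ℚ = record
  { ⟦_⟧ = ofℤ ; +-homo = ofℤ-+ ; *-homo = ofℤ-* ; -‿homo = ofℤ-neg ; 0-homo = refl ; 1-homo = refl }

module ℚS = ℤSolver ℚ.+-*-commutativeRing ℤ⟶ℚ

open ℚS using () renaming
  (solve to ℚsolve; con to #; _:+_ to _:+′_; _:*_ to _:*′_; _:-_ to _:-′_; :-_ to :-′_; _:=_ to _:=′_)

-- Dual numbers

infix 5 _+ε_

record Dual : Set where
  constructor _+ε_
  field
    re im : ℚ

open Dual public

infixl 6 _⊕_ _⊝_
infixl 7 _⊗_
infix  8 ⊖_

const : ℚ → Dual
const c = c +ε 0ℚ

0D 1D ε : Dual
0D = const 0ℚ
1D = const 1ℚ
ε  = 0ℚ +ε 1ℚ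

opaque
  -- Opaque, so that dual expressions stay atomic in large goals instead of expanding into pairs of
  -- rationals; only blocks that unfold `_⊕_` see the components.
  _⊕_ _⊗_ : Dual → Dual → Dual
  x ⊕ y = re x + re y +ε im x + im y
  x ⊗ y = re x * re y +ε re x * im y + im x * re y

  ⊖_ : Dual → Dual
  ⊖ x = - re x +ε - im x

  re-⊕ : ∀ x y → re (x ⊕ y) ≡ re x + re y
  re-⊕ x y = refl

  im-⊕ : ∀ x y → im (x ⊕ y) ≡ im x + im y
  im-⊕ x y = refl

  re-⊗ : ∀ x y → re (x ⊗ y) ≡ re x * re y
  re-⊗ x y = refl

  im-⊗ : ∀ x y → im (x ⊗ y) ≡ re x * im y + im x * re y
  im-⊗ x y = refl

  im-⊖ : ∀ x → im (⊖ x) ≡ - im x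
  im-⊖ x = refl

_⊝_ : Dual → Dual → Dual
x ⊝ y = x ⊕ ⊖ y

opaque
  unfolding _⊕_

  ⊕-assoc : ∀ x y z → (x ⊕ y) ⊕ z ≡ x ⊕ (y ⊕ z)
  ⊕-assoc x y z = cong₂ _+ε_ (ℚ.+-assoc (re x) (re y) (re z)) (ℚ.+-assoc (im x) (im y) (im z))

  ⊕-comm : ∀ x y → x ⊕ y ≡ y ⊕ x
  ⊕-comm x y = cong₂ _+ε_ (ℚ.+-comm (re x) (re y)) (ℚ.+-comm (im x) (im y))

  ⊕-identityˡ : ∀ x → 0D ⊕ x ≡ x
  ⊕-identityˡ x = cong₂ _+ε_ (ℚ.+-identityˡ (re x)) (ℚ.+-identityˡ (im x))

  ⊖-inverseˡ : ∀ x → ⊖ x ⊕ x ≡ 0D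
  ⊖-inverseˡ x = cong₂ _+ε_ (ℚ.+-inverseˡ (re x)) (ℚ.+-inverseˡ (im x))

  ⊗-assoc : ∀ x y z → (x ⊗ y) ⊗ z ≡ x ⊗ (y ⊗ z)
  ⊗-assoc (a +ε a′) (b +ε b′) (c +ε c′) = cong₂ _+ε_
    (ℚ.*-assoc a b c)
    (ℚsolve 6 (λ a a′ b b′ c c′ → a :*′ b :*′ c′ :+′ (a :*′ b′ :+′ a′ :*′ b) :*′ c
                :=′ a :*′ (b :*′ c′ :+′ b′ :*′ c) :+′ a′ :*′ (b :*′ c)) refl a a′ b b′ c c′)

  ⊗-comm : ∀ x y → x ⊗ y ≡ y ⊗ x
  ⊗-comm (a +ε a′) (b +ε b′) = cong₂ _+ε_ (ℚ.*-comm a b)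
    (ℚsolve 4 (λ a a′ b b′ → a :*′ b′ :+′ a′ :*′ b :=′ b :*′ a′ :+′ b′ :*′ a) refl a a′ b b′)

  ⊗-identityˡ : ∀ x → 1D ⊗ x ≡ x
  ⊗-identityˡ (a +ε a′) = cong₂ _+ε_ (ℚ.*-identityˡ a)
    (ℚsolve 2 (λ a a′ → # (+ 1) :*′ a′ :+′ # (+ 0) :*′ a :=′ a′) refl a a′)

  ⊗-distribˡ-⊕ : ∀ x y z → x ⊗ (y ⊕ z) ≡ x ⊗ y ⊕ x ⊗ z
  ⊗-distribˡ-⊕ (a +ε a′) (b +ε b′) (c +ε c′) = cong₂ _+ε_
    (ℚ.*-distribˡ-+ a b c)
    (ℚsolve 6 (λ a a′ b b′ c c′ → a :*′ (b′ :+′ c′) :+′ a′ :*′ (b :+′ c)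
                :=′ a :*′ b′ :+′ a′ :*′ b :+′ (a :*′ c′ :+′ a′ :*′ c)) refl a a′ b b′ c c′)

  const-⊕ : ∀ x y → const (x + y) ≡ const x ⊕ const y
  const-⊕ x y = refl

  const-⊖ : ∀ x → const (- x) ≡ ⊖ const x
  const-⊖ x = refl

  const-⊗ : ∀ x y → const (x * y) ≡ const x ⊗ const y
  const-⊗ x y = cong (x * y +ε_)
    (ℚsolve 2 (λ x y → # (+ 0) :=′ x :*′ # (+ 0) :+′ # (+ 0) :*′ y) refl x y)

dualRing : CommutativeRing _ _
dualRing = record
  { Carrier = Dual ; _≈_ = _≡_ ; _+_ = _⊕_ ; _*_ = _⊗_ ; -_ = ⊖_ ; 0# = 0D ; 1# = 1D
  ; isCommutativeRing = record
    { isRing = record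
      { +-isAbelianGroup = record
        { isGroup = record
          { isMonoid = record
            { isSemigroup = record
              { isMagma = record { isEquivalence = isEquivalence ; ∙-cong = cong₂ _⊕_ }
              ; assoc = ⊕-assoc
              }
            ; identity = ⊕-identityˡ , (λ x → trans (⊕-comm x 0D) (⊕-identityˡ x))
            }
          ; inverse = ⊖-inverseˡ , (λ x → trans (⊕-comm x (⊖ x)) (⊖-inverseˡ x))
          ; ⁻¹-cong = cong ⊖_
          }
        ; comm = ⊕-comm
        }
      ; *-cong = cong₂ _⊗_
      ; *-assoc = ⊗-assoc
      ; *-identity = ⊗-identityˡ , (λ x → trans (⊗-comm x 1D) (⊗-identityˡ x))
      ; distrib = ⊗-distribˡ-⊕
                , (λ x y z → trans (⊗-comm (y ⊕ z) x)
                     (trans (⊗-distribˡ-⊕ x y z) (cong₂ _⊕_ (⊗-comm x y) (⊗-comm x z))))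
      }
    ; *-comm = ⊗-comm
    }
  }

ι : ℤ → Dual
ι x = const (ofℤ x)

ι-+ : ∀ x y → ι (x ℤ.+ y) ≡ ι x ⊕ ι y
ι-+ x y = trans (cong const (ofℤ-+ x y)) (const-⊕ (ofℤ x) (ofℤ y))

ι-* : ∀ x y → ι (x ℤ.* y) ≡ ι x ⊗ ι y
ι-* x y = trans (cong const (ofℤ-* x y)) (const-⊗ (ofℤ x) (ofℤ y))

ι-neg : ∀ x → ι (ℤ.- x) ≡ ⊖ ι x
ι-neg x = trans (cong const (ofℤ-neg x)) (const-⊖ (ofℤ x))

ℤ⟶Dual : ℤ.+-*-rawRing -Raw-AlmostCommutative⟶ fromCommutativeRing dualRing
ℤ⟶Dual = record
  { ⟦_⟧ = ι ; +-homo = ι-+ ; *-homo = ι-* ; -‿homo = ι-neg ; 0-homo = refl ; 1-homo = refl }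

module DS = ℤSolver dualRing ℤ⟶Dual
open DS

-- The telescoping identity

Term : Set
Term = Polynomial 3

𝐳 𝐧 𝐫 : Term
𝐳 = var zero
𝐧 = var (suc zero)
𝐫 = var (suc (suc zero))

lit : ℕ → Term
lit k = con (+ k)

neg : ℕ → ℤ
neg k = ℤ.- + k

-- T = t₀ + t₁ z + ⋯ + t₄ z⁴, where the i-th row of tⱼ lists the coefficients of nⁱ, nⁱρ, nⁱρ², nⁱρ³.
-- T solves Gosper's equation for the left-hand side of the recurrence; the coefficients were found by
-- linear algebra for small n, ρ and interpolation.
t₀ : List (List ℤ)
t₀ =
    []
  ∷ (+ 34 ∷ + 378 ∷ + 292 ∷ [])
  ∷ (+ 319 ∷ + 4079 ∷ + 3590 ∷ + 292 ∷ [])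
  ∷ (+ 1273 ∷ + 19103 ∷ + 19788 ∷ + 3504 ∷ [])
  ∷ (+ 2823 ∷ + 50489 ∷ + 64707 ∷ + 18869 ∷ [])
  ∷ (+ 3807 ∷ + 80787 ∷ + 139917 ∷ + 60403 ∷ [])
  ∷ (+ 2970 ∷ + 73688 ∷ + 210888 ∷ + 128284 ∷ [])
  ∷ (+ 1200 ∷ + 20402 ∷ + 226158 ∷ + 189308 ∷ [])
  ∷ (+ 192 ∷ neg 35950 ∷ + 172309 ∷ + 197001 ∷ [])
  ∷ (+ 0 ∷ neg 51780 ∷ + 91279 ∷ + 143891 ∷ [])
  ∷ (+ 0 ∷ neg 33288 ∷ + 31986 ∷ + 72080 ∷ [])
  ∷ (+ 0 ∷ neg 12036 ∷ + 6664 ∷ + 23548 ∷ [])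
  ∷ (+ 0 ∷ neg 2352 ∷ + 624 ∷ + 4512 ∷ [])
  ∷ (+ 0 ∷ neg 192 ∷ + 0 ∷ + 384 ∷ []) ∷ []

t₁ : List (List ℤ)
t₁ =
    (neg 34 ∷ neg 378 ∷ neg 292 ∷ [])
  ∷ (neg 604 ∷ neg 4480 ∷ neg 3728 ∷ neg 292 ∷ [])
  ∷ (neg 4094 ∷ neg 23322 ∷ neg 21514 ∷ neg 3642 ∷ [])
  ∷ (neg 14716 ∷ neg 70036 ∷ neg 74428 ∷ neg 20332 ∷ [])
  ∷ (neg 31284 ∷ neg 133486 ∷ neg 172596 ∷ neg 67252 ∷ [])
  ∷ (neg 38950 ∷ neg 165352 ∷ neg 284074 ∷ neg 147036 ∷ [])
  ∷ (neg 22734 ∷ neg 129133 ∷ neg 340329 ∷ neg 221280 ∷ [])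
  ∷ (+ 8611 ∷ neg 54576 ∷ neg 299265 ∷ neg 231786 ∷ [])
  ∷ (+ 27618 ∷ neg 835 ∷ neg 191823 ∷ neg 168166 ∷ [])
  ∷ (+ 23037 ∷ + 12970 ∷ neg 87105 ∷ neg 82666 ∷ [])
  ∷ (+ 9834 ∷ + 7376 ∷ neg 26390 ∷ neg 26188 ∷ [])
  ∷ (+ 2160 ∷ + 1872 ∷ neg 4752 ∷ neg 4800 ∷ [])
  ∷ (+ 192 ∷ + 192 ∷ neg 384 ∷ neg 384 ∷ []) ∷ []

t₂ : List (List ℤ)
t₂ =
    (+ 285 ∷ + 401 ∷ + 138 ∷ [])
  ∷ (+ 2983 ∷ + 4193 ∷ + 1594 ∷ + 138 ∷ [])
  ∷ (+ 13320 ∷ + 19458 ∷ + 8463 ∷ + 1331 ∷ [])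
  ∷ (+ 32630 ∷ + 53276 ∷ + 27607 ∷ + 5485 ∷ [])
  ∷ (+ 45532 ∷ + 96232 ∷ + 62019 ∷ + 12593 ∷ [])
  ∷ (+ 29958 ∷ + 122358 ∷ + 99961 ∷ + 15935 ∷ [])
  ∷ (neg 8758 ∷ + 112533 ∷ + 117415 ∷ + 8966 ∷ [])
  ∷ (neg 33999 ∷ + 73485 ∷ + 98446 ∷ neg 2218 ∷ [])
  ∷ (neg 28209 ∷ + 32384 ∷ + 56099 ∷ neg 6930 ∷ [])
  ∷ (neg 11502 ∷ + 8992 ∷ + 20306 ∷ neg 4676 ∷ [])
  ∷ (neg 2352 ∷ + 1416 ∷ + 4200 ∷ neg 1488 ∷ [])
  ∷ (neg 192 ∷ + 96 ∷ + 384 ∷ neg 192 ∷ []) ∷ []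

t₃ : List (List ℤ)
t₃ =
    (neg 162 ∷ + 26 ∷ + 132 ∷ [])
  ∷ (neg 1338 ∷ + 138 ∷ + 1236 ∷ + 132 ∷ [])
  ∷ (neg 4384 ∷ neg 42 ∷ + 4934 ∷ + 1342 ∷ [])
  ∷ (neg 6854 ∷ neg 2030 ∷ + 11026 ∷ + 5950 ∷ [])
  ∷ (neg 3652 ∷ neg 6771 ∷ + 15331 ∷ + 15192 ∷ [])
  ∷ (+ 3745 ∷ neg 10488 ∷ + 14303 ∷ + 23920 ∷ [])
  ∷ (+ 5790 ∷ neg 8751 ∷ + 10961 ∷ + 24054 ∷ [])
  ∷ (+ 1629 ∷ neg 4438 ∷ + 8127 ∷ + 15766 ∷ [])
  ∷ (neg 1002 ∷ neg 1744 ∷ + 4678 ∷ + 6668 ∷ [])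
  ∷ (neg 648 ∷ neg 576 ∷ + 1512 ∷ + 1680 ∷ [])
  ∷ (neg 96 ∷ neg 96 ∷ + 192 ∷ + 192 ∷ []) ∷ []

t₄ : List (List ℤ)
t₄ =
    (neg 89 ∷ neg 49 ∷ + 22 ∷ [])
  ∷ (neg 769 ∷ neg 535 ∷ + 138 ∷ + 22 ∷ [])
  ∷ (neg 2698 ∷ neg 2538 ∷ + 141 ∷ + 209 ∷ [])
  ∷ (neg 4772 ∷ neg 6856 ∷ neg 1121 ∷ + 845 ∷ [])
  ∷ (neg 3790 ∷ neg 11519 ∷ neg 4762 ∷ + 1899 ∷ [])
  ∷ (+ 591 ∷ neg 12119 ∷ neg 8863 ∷ + 2439 ∷ [])
  ∷ (+ 3543 ∷ neg 7628 ∷ neg 9107 ∷ + 1750 ∷ [])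
  ∷ (+ 2670 ∷ neg 2588 ∷ neg 5258 ∷ + 648 ∷ [])
  ∷ (+ 840 ∷ neg 360 ∷ neg 1584 ∷ + 96 ∷ [])
  ∷ (+ 96 ∷ + 0 ∷ neg 192 ∷ []) ∷ []

hornerᵣ : List ℤ → Term
hornerᵣ [] = lit 0
hornerᵣ (x ∷ xs) = con x :+ 𝐫 :* hornerᵣ xs

hornerₙ : List (List ℤ) → Term
hornerₙ [] = lit 0
hornerₙ (x ∷ xs) = hornerᵣ x :+ 𝐧 :* hornerₙ xs

cert : Term → Term
cert z = hornerₙ t₀ :+ z :* (hornerₙ t₁ :+ z :* (hornerₙ t₂ :+ z :* (hornerₙ t₃ :+ z :* hornerₙ t₄)))

Φᵗ : Term → Term
Φᵗ n = lit 24 :* n :^ 5 :* 𝐫 :^ 2 :- lit 12 :* n :^ 5 :+ lit 54 :* n :^ 4 :* 𝐫 :^ 2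
  :+ lit 39 :* n :^ 4 :* 𝐫 :- lit 33 :* n :^ 4 :+ lit 46 :* n :^ 3 :* 𝐫 :^ 2
  :+ lit 70 :* n :^ 3 :* 𝐫 :+ lit 19 :* n :^ 2 :* 𝐫 :^ 2 :+ lit 56 :* n :^ 2 :* 𝐫
  :+ lit 33 :* n :^ 2 :+ lit 3 :* n :* 𝐫 :^ 2 :+ lit 21 :* n :* 𝐫
  :+ lit 24 :* n :+ lit 3 :* 𝐫 :+ lit 5

βᵗ : Term → Term
βᵗ n = :- (lit 2 :* (n :+ lit 1) :* (
  lit 408 :* n :^ 8 :* 𝐫 :^ 2 :- lit 204 :* n :^ 8 :+ lit 3162 :* n :^ 7 :* 𝐫 :^ 2
  :+ lit 663 :* n :^ 7 :* 𝐫 :- lit 1683 :* n :^ 7 :+ lit 10028 :* n :^ 6 :* 𝐫 :^ 2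
  :+ lit 4433 :* n :^ 6 :* 𝐫 :- lit 4899 :* n :^ 6
  :+ lit 16802 :* n :^ 5 :* 𝐫 :^ 2 :+ lit 12409 :* n :^ 5 :* 𝐫 :- lit 5487 :* n :^ 5
  :+ lit 16070 :* n :^ 4 :* 𝐫 :^ 2 :+ lit 18955 :* n :^ 4 :* 𝐫 :+ lit 735 :* n :^ 4
  :+ lit 8888 :* n :^ 3 :* 𝐫 :^ 2
  :+ lit 17212 :* n :^ 3 :* 𝐫 :+ lit 7366 :* n :^ 3 :+ lit 2708 :* n :^ 2 :* 𝐫 :^ 2
  :+ lit 9340 :* n :^ 2 :* 𝐫 :+ lit 6870 :* n :^ 2 :+ lit 344 :* n :* 𝐫 :^ 2
  :+ lit 2776 :* n :* 𝐫 :+ lit 2748 :* n :+ lit 344 :* 𝐫 :+ lit 412))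

-- The telescoping identity divided by s², where s = (-z)_{n-1}/(z+1)_{n+3}. For example
-- (-z)_{n+1}/(z+1)_{n+3} = s(n-1-z)(n-z). The factor s(n-1-z)(z+n+3) occurs both in R_{n+1} and in
-- G(z), and G(z+1) contributes s(z+1)² up to a sign that the square removes.
lhsᵗ rhsᵗ : Term
lhsᵗ = (𝐧 :+ lit 1) :* (𝐧 :+ lit 1) :*
  ( (𝐧 :+ lit 2) :^ 4 :* Φᵗ 𝐧 :* ((𝐧 :- lit 1 :- 𝐳) :* (𝐧 :- 𝐳)) :^ 2 :* ((𝐳 :- 𝐧 :- lit 1) :* (𝐳 :- 𝐫 :* (𝐧 :+ lit 2)))
  :+ βᵗ 𝐧 :* ((𝐧 :- lit 1 :- 𝐳) :* (𝐳 :+ 𝐧 :+ lit 3)) :^ 2 :* ((𝐳 :- 𝐧) :* (𝐳 :- 𝐫 :* (𝐧 :+ lit 1)))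
  :+ 𝐧 :^ 4 :* Φᵗ (𝐧 :+ lit 1) :* ((𝐳 :+ 𝐧 :+ lit 2) :* (𝐳 :+ 𝐧 :+ lit 3)) :^ 2 :* ((𝐳 :- 𝐧 :+ lit 1) :* (𝐳 :- 𝐫 :* 𝐧)))
rhsᵗ = lit 2 :* ((𝐳 :+ lit 1) :^ 4 :* cert (𝐳 :+ lit 1) :- ((𝐧 :- lit 1 :- 𝐳) :* (𝐳 :+ 𝐧 :+ lit 3)) :^ 2 :* cert 𝐳)

certificate : normalise lhsᵗ ≡ normalise rhsᵗ
certificate = refl

evalℤ : Term → Vec ℤ 3 → ℤ
evalℤ (op [+] s t) xs = evalℤ s xs ℤ.+ evalℤ t xs
evalℤ (op [*] s t) xs = evalℤ s xs ℤ.* evalℤ t xs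
evalℤ (con x)      xs = x
evalℤ (var i)      xs = Vec.lookup xs i
evalℤ (t :^ k)     xs = evalℤ t xs ℤ.^ k
evalℤ (:- t)       xs = ℤ.- evalℤ t xs

-- On `Φᵗ` and `βᵗ` the function `evalℤ` unfolds to the integer expressions inside `Φ` and `β`, so
-- this homomorphism property is all that is needed to find them again in the evaluated certificate.
ι-evalℤ : ∀ t x y z → ι (evalℤ t (x ∷ y ∷ z ∷ [])) ≡ ⟦ t ⟧ (ι x ∷ ι y ∷ ι z ∷ [])
ι-evalℤ (op [+] s t) x y z = trans (ι-+ (evalℤ s _) (evalℤ t _)) (cong₂ _⊕_ (ι-evalℤ s x y z) (ι-evalℤ t x y z))
ι-evalℤ (op [*] s t) x y z = trans (ι-* (evalℤ s _) (evalℤ t _)) (cong₂ _⊗_ (ι-evalℤ s x y z) (ι-evalℤ t x y z))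
ι-evalℤ (con c)      x y z = refl
ι-evalℤ (var zero)   x y z = refl
ι-evalℤ (var (suc zero)) x y z = refl
ι-evalℤ (var (suc (suc zero))) x y z = refl
ι-evalℤ (t :^ zero)  x y z = refl
ι-evalℤ (t :^ suc k) x y z = trans (ι-* (evalℤ t _) (evalℤ (t :^ k) _)) (cong₂ _⊗_ (ι-evalℤ t x y z) (ι-evalℤ (t :^ k) x y z))
ι-evalℤ (:- t)       x y z = trans (ι-neg (evalℤ t _)) (cong ⊖_ (ι-evalℤ t x y z))

const-Φ : ∀ ρ n z → const (Φ ρ n) ≡ ⟦ Φᵗ 𝐧 ⟧ (z ∷ ι (+ n) ∷ ι (+ ρ) ∷ [])
const-Φ ρ n z = ι-evalℤ (Φᵗ 𝐧) (+ 0) (+ n) (+ ρ)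

const-Φ⁺ : ∀ ρ n z → const (Φ ρ (n ℕ.+ 1)) ≡ ⟦ Φᵗ (𝐧 :+ lit 1) ⟧ (z ∷ ι (+ n) ∷ ι (+ ρ) ∷ [])
const-Φ⁺ ρ n z = ι-evalℤ (Φᵗ (𝐧 :+ lit 1)) (+ 0) (+ n) (+ ρ)

const-β : ∀ ρ n z → const (β ρ n) ≡ ⟦ βᵗ 𝐧 ⟧ (z ∷ ι (+ n) ∷ ι (+ ρ) ∷ [])
const-β ρ n z = ι-evalℤ (βᵗ 𝐧) (+ 0) (+ n) (+ ρ)

evalD : Poly → Dual → Dual
evalD []      z = 0D
evalD (x ∷ f) z = const x ⊕ z ⊗ evalD f z

-- hornerₙ t does not involve z, whose value here is irrelevant.
coeffT : List (List ℤ) → ℕ → ℕ → ℚ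
coeffT t ρ n = ofℤ (evalℤ (hornerₙ t) (+ 0 ∷ + n ∷ + ρ ∷ []))

const-coeffT : ∀ t ρ n z → const (coeffT t ρ n) ≡ ⟦ hornerₙ t ⟧ (z ∷ ι (+ n) ∷ ι (+ ρ) ∷ [])
const-coeffT t ρ n z = trans (ι-evalℤ (hornerₙ t) (+ 0) (+ n) (+ ρ)) (indepₙ t)
  where
  indepᵣ : ∀ xs → ⟦ hornerᵣ xs ⟧ (ι (+ 0) ∷ ι (+ n) ∷ ι (+ ρ) ∷ []) ≡ ⟦ hornerᵣ xs ⟧ (z ∷ ι (+ n) ∷ ι (+ ρ) ∷ [])
  indepᵣ []       = refl
  indepᵣ (x ∷ xs) = cong (λ y → ι x ⊕ ι (+ ρ) ⊗ y) (indepᵣ xs)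
  indepₙ : ∀ xs → ⟦ hornerₙ xs ⟧ (ι (+ 0) ∷ ι (+ n) ∷ ι (+ ρ) ∷ []) ≡ ⟦ hornerₙ xs ⟧ (z ∷ ι (+ n) ∷ ι (+ ρ) ∷ [])
  indepₙ []       = refl
  indepₙ (x ∷ xs) = cong₂ (λ y w → y ⊕ ι (+ n) ⊗ w) (indepᵣ x) (indepₙ xs)

-- The certificate treats T as a polynomial in z, n and ρ, whereas partial fractions and growth
-- estimates need it as a coefficient list in z alone. This reconciles the two readings.
horner-const : ∀ (t₀ t₁ t₂ t₃ t₄ : List (List ℤ)) ρ n z t →
  let xs = z ∷ ι (+ n) ∷ ι (+ ρ) ∷ [] ; κ = λ u → coeffT u ρ n in
  evalD (κ t₀ ∷ κ t₁ ∷ κ t₂ ∷ κ t₃ ∷ κ t₄ ∷ []) (⟦ t ⟧ xs)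
  ≡ ⟦ hornerₙ t₀ :+ t :* (hornerₙ t₁ :+ t :* (hornerₙ t₂ :+ t :* (hornerₙ t₃ :+ t :* hornerₙ t₄))) ⟧ xs
horner-const t₀ t₁ t₂ t₃ t₄ ρ n z t =
  step t₀ (step t₁ (step t₂ (step t₃ (trans
    (solve 2 (λ e w → e :+ w :* con (+ 0) := e) refl (const (coeffT t₄ ρ n)) (⟦ t ⟧ _))
    (const-coeffT t₄ ρ n z)))))
  where
  step : ∀ u {x y} → x ≡ y → const (coeffT u ρ n) ⊕ ⟦ t ⟧ _ ⊗ x ≡ ⟦ hornerₙ u ⟧ _ ⊕ ⟦ t ⟧ _ ⊗ y
  step u = cong₂ (λ a x → a ⊕ ⟦ t ⟧ _ ⊗ x) (const-coeffT u ρ n z)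

T : ℕ → ℕ → Poly
T ρ n = coeffT t₀ ρ n ∷ coeffT t₁ ρ n ∷ coeffT t₂ ρ n ∷ coeffT t₃ ρ n ∷ coeffT t₄ ρ n ∷ []

ι-pow : ∀ m k → ι (+ (m ℕ.^ k)) ≡ ⟦ con (+ m) :^ k ⟧ []
ι-pow m zero    = refl
ι-pow m (suc k) = trans (cong ι (ℤ.pos-* m (m ℕ.^ k)))
  (trans (ι-* (+ m) (+ (m ℕ.^ k))) (cong (ι (+ m) ⊗_) (ι-pow m k)))

lin : ℕ → ℕ → Dual → Dual
lin ρ m z = (z ⊕ const (ofℕ 1 - ofℕ m)) ⊗ (z ⊕ const (- ofℕ (ρ ℕ.* m)))

-- For τ = (-z)_{m-1}/(z+1)_{m+1} this is F_{m,1}(z). With τ left free, the same expression also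
-- yields polar parts, where τ is ε times that quotient up to sign.
kern : ℕ → ℕ → Dual → Dual → Dual
kern ρ m z τ = τ ⊗ τ ⊗ lin ρ m z

lin-ι : ∀ ρ m z {M} → ι (+ m) ≡ M → lin ρ m z ≡ (z ⊕ (1D ⊝ M)) ⊗ (z ⊝ ι (+ ρ) ⊗ M)
lin-ι ρ m z refl = cong₂ (λ x y → (z ⊕ x) ⊗ (z ⊕ y))
  (trans (const-⊕ 1ℚ (- ofℕ m)) (cong (1D ⊕_) (const-⊖ (ofℕ m))))
  (trans (const-⊖ (ofℕ (ρ ℕ.* m))) (cong ⊖_ (trans (cong ι (ℤ.pos-* ρ m)) (ι-* (+ ρ) (+ m)))))

identity : ∀ (z N R : Dual) → ⟦ lhsᵗ ⟧ (z ∷ N ∷ R ∷ []) ≡ ⟦ rhsᵗ ⟧ (z ∷ N ∷ R ∷ [])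
identity z N R = prove-by-normalising (z ∷ N ∷ R ∷ []) lhsᵗ rhsᵗ certificate

-- The last hypothesis has the shape in which the solver evaluates `lhsᵗ` and `rhsᵗ`, powers ending
-- in `1D`. Coefficients, linear factors and values of T are variables here, so the large
-- polynomials are not normalised a second time when s² is distributed.
scale-identity : ∀ z N s {A₂ A₁ A₀ L₂ L₁ L₀ T₁ T₀ a₂ φ₂ a₁ a₀ φ₀ l₂ l₁ l₀ θ₁ θ₀ : Dual} →
  A₂ ≡ a₂ ⊗ φ₂ → A₁ ≡ a₁ → A₀ ≡ a₀ ⊗ φ₀ → L₂ ≡ l₂ → L₁ ≡ l₁ → L₀ ≡ l₀ → T₁ ≡ θ₁ → T₀ ≡ θ₀ →
  (let sq = λ x → x ⊗ (x ⊗ 1D) in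
   (N ⊕ 1D) ⊗ (N ⊕ 1D) ⊗
     ( a₂ ⊗ φ₂ ⊗ sq ((N ⊝ 1D ⊝ z) ⊗ (N ⊝ z)) ⊗ l₂
     ⊕ a₁ ⊗ sq ((N ⊝ 1D ⊝ z) ⊗ (z ⊕ N ⊕ ι (+ 3))) ⊗ l₁
     ⊕ a₀ ⊗ φ₀ ⊗ sq ((z ⊕ N ⊕ ι (+ 2)) ⊗ (z ⊕ N ⊕ ι (+ 3))) ⊗ l₀)
   ≡ ι (+ 2) ⊗ ((z ⊕ 1D) ⊗ ((z ⊕ 1D) ⊗ ((z ⊕ 1D) ⊗ ((z ⊕ 1D) ⊗ 1D))) ⊗ θ₁
              ⊝ sq ((N ⊝ 1D ⊝ z) ⊗ (z ⊕ N ⊕ ι (+ 3))) ⊗ θ₀)) →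
  (let sq = λ x → x ⊗ x in
   (N ⊕ 1D) ⊗ (N ⊕ 1D) ⊗
     ( A₂ ⊗ (sq (s ⊗ ((N ⊝ 1D ⊝ z) ⊗ (N ⊝ z))) ⊗ L₂)
     ⊕ A₁ ⊗ (sq (s ⊗ ((N ⊝ 1D ⊝ z) ⊗ (z ⊕ N ⊕ ι (+ 3)))) ⊗ L₁)
     ⊕ A₀ ⊗ (sq (s ⊗ ((z ⊕ N ⊕ ι (+ 2)) ⊗ (z ⊕ N ⊕ ι (+ 3)))) ⊗ L₀))
   ≡ ι (+ 2) ⊗ (sq (s ⊗ ((z ⊕ 1D) ⊗ (z ⊕ 1D))) ⊗ T₁
              ⊝ sq (s ⊗ ((N ⊝ 1D ⊝ z) ⊗ (z ⊕ N ⊕ ι (+ 3)))) ⊗ T₀))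
scale-identity z N s {θ₁ = T₁} {T₀} refl refl refl refl refl refl refl refl eq =
  trans (collect ((N ⊕ 1D) ⊗ (N ⊕ 1D)) _ _ _ _ _ _ _ _ _)
  (trans (cong (s ⊗ s ⊗_) eq)
   (solve 5 (λ s z u T₁ T₀ →
    s :* s :* (con (+ 2) :* (z :^ 4 :* T₁ :- u :^ 2 :* T₀))
    := con (+ 2) :* ((s :* (z :* z)) :* (s :* (z :* z)) :* T₁ :- (s :* u) :* (s :* u) :* T₀)) refl
    s (z ⊕ 1D) ((N ⊝ 1D ⊝ z) ⊗ (z ⊕ N ⊕ ι (+ 3))) T₁ T₀))
  where
  summand : ∀ A u l → A ⊗ ((s ⊗ u) ⊗ (s ⊗ u) ⊗ l) ≡ s ⊗ s ⊗ (A ⊗ (u ⊗ (u ⊗ 1D)) ⊗ l)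
  summand = solve 4 (λ s A u l → A :* ((s :* u) :* (s :* u) :* l) := s :* s :* (A :* u :^ 2 :* l)) refl s
  collect : ∀ K A u l A′ u′ l′ A″ u″ l″ →
    K ⊗ (A ⊗ ((s ⊗ u) ⊗ (s ⊗ u) ⊗ l) ⊕ A′ ⊗ ((s ⊗ u′) ⊗ (s ⊗ u′) ⊗ l′) ⊕ A″ ⊗ ((s ⊗ u″) ⊗ (s ⊗ u″) ⊗ l″))
    ≡ s ⊗ s ⊗ (K ⊗ (A ⊗ (u ⊗ (u ⊗ 1D)) ⊗ l ⊕ A′ ⊗ (u′ ⊗ (u′ ⊗ 1D)) ⊗ l′ ⊕ A″ ⊗ (u″ ⊗ (u″ ⊗ 1D)) ⊗ l″))
  collect K A u l A′ u′ l′ A″ u″ l″ =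
    trans (cong (K ⊗_) (cong₂ _⊕_ (cong₂ _⊕_ (summand A u l) (summand A′ u′ l′)) (summand A″ u″ l″)))
      (solve 5 (λ K s x y w → K :* (s :* x :+ s :* y :+ s :* w) := s :* (K :* (x :+ y :+ w))) refl K (s ⊗ s) _ _ _)

-- The freedom of s is the point: it is a genuine quotient at M + ε and a renormalised one at the
-- poles, and no division by ε is ever required.
telescope : ∀ ρ n z s → let N = ι (+ n) in
  (N ⊕ 1D) ⊗ (N ⊕ 1D) ⊗
    ( const (ofℕ ((n ℕ.+ 2) ℕ.^ 4) * Φ ρ n) ⊗ kern ρ (n ℕ.+ 2) z (s ⊗ ((N ⊝ 1D ⊝ z) ⊗ (N ⊝ z)))
    ⊕ const (β ρ n) ⊗ kern ρ (n ℕ.+ 1) z (s ⊗ ((N ⊝ 1D ⊝ z) ⊗ (z ⊕ N ⊕ ι (+ 3))))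
    ⊕ const (ofℕ (n ℕ.^ 4) * Φ ρ (n ℕ.+ 1)) ⊗ kern ρ n z (s ⊗ ((z ⊕ N ⊕ ι (+ 2)) ⊗ (z ⊕ N ⊕ ι (+ 3)))))
  ≡ ι (+ 2) ⊗
    ( (s ⊗ ((z ⊕ 1D) ⊗ (z ⊕ 1D))) ⊗ (s ⊗ ((z ⊕ 1D) ⊗ (z ⊕ 1D))) ⊗ evalD (T ρ n) (z ⊕ 1D)
    ⊝ (s ⊗ ((N ⊝ 1D ⊝ z) ⊗ (z ⊕ N ⊕ ι (+ 3)))) ⊗ (s ⊗ ((N ⊝ 1D ⊝ z) ⊗ (z ⊕ N ⊕ ι (+ 3)))) ⊗ evalD (T ρ n) z)
telescope ρ n z s = scale-identity z (ι (+ n)) s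
  (trans (const-⊗ (ofℕ ((n ℕ.+ 2) ℕ.^ 4)) (Φ ρ n))
    (cong₂ _⊗_ (trans (ι-pow (n ℕ.+ 2) 4) (cong (λ x → x ⊗ (x ⊗ (x ⊗ (x ⊗ 1D)))) (ι-+ (+ n) (+ 2)))) (const-Φ ρ n z)))
  (const-β ρ n z)
  (trans (const-⊗ (ofℕ (n ℕ.^ 4)) (Φ ρ (n ℕ.+ 1))) (cong₂ _⊗_ (ι-pow n 4) (const-Φ⁺ ρ n z)))
  (lin-ι′ (n ℕ.+ 2) (ι-+ (+ n) (+ 2)) (solve 3 (λ z N R →
     (z :+ (con (+ 1) :- (N :+ con (+ 2)))) :* (z :- R :* (N :+ con (+ 2)))
     := (z :- N :- con (+ 1)) :* (z :- R :* (N :+ con (+ 2)))) refl z (ι (+ n)) (ι (+ ρ))))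
  (lin-ι′ (n ℕ.+ 1) (ι-+ (+ n) (+ 1)) (solve 3 (λ z N R →
     (z :+ (con (+ 1) :- (N :+ con (+ 1)))) :* (z :- R :* (N :+ con (+ 1)))
     := (z :- N) :* (z :- R :* (N :+ con (+ 1)))) refl z (ι (+ n)) (ι (+ ρ))))
  (lin-ι′ n refl (solve 3 (λ z N R →
     (z :+ (con (+ 1) :- N)) :* (z :- R :* N)
     := (z :- N :+ con (+ 1)) :* (z :- R :* N)) refl z (ι (+ n)) (ι (+ ρ))))
  (horner-const t₀ t₁ t₂ t₃ t₄ ρ n z (𝐳 :+ lit 1))
  (horner-const t₀ t₁ t₂ t₃ t₄ ρ n z 𝐳)
  (identity z (ι (+ n)) (ι (+ ρ)))
  where
  lin-ι′ : ∀ m {M x} → ι (+ m) ≡ M → (z ⊕ (1D ⊝ M)) ⊗ (z ⊝ ι (+ ρ) ⊗ M) ≡ x → lin ρ m z ≡ x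
  lin-ι′ m e f = trans (lin-ι ρ m z e) f

-- Division and cancellation in ℚ and in the dual numbers

÷'-*-cancel : ∀ x {y} → y ≢ 0ℚ → (x ÷' y) * y ≡ x
÷'-*-cancel x {y} y≢0 with y ℚ.≟ 0ℚ
... | yes y≡0 = ⊥-elim (y≢0 y≡0)
... | no  y≢0′ = trans (ℚ.*-assoc x _ y) (trans (cong (x *_) (ℚ.*-inverseˡ y {{ℚ.≢-nonZero y≢0′}})) (ℚ.*-identityʳ x))

*-cancelʳ-≢0 : ∀ {x y z} → z ≢ 0ℚ → x * z ≡ y * z → x ≡ y
*-cancelʳ-≢0 {x} {y} {z} z≢0 eq = begin
  x                     ≡⟨ undo x ⟨
  x * z * (1ℚ ÷' z)     ≡⟨ cong (_* (1ℚ ÷' z)) eq ⟩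
  y * z * (1ℚ ÷' z)     ≡⟨ undo y ⟩
  y                     ∎
  where
  undo : ∀ w → w * z * (1ℚ ÷' z) ≡ w
  undo w = trans (ℚsolve 3 (λ w z i → w :*′ z :*′ i :=′ w :*′ (i :*′ z)) refl w z (1ℚ ÷' z))
    (trans (cong (w *_) (÷'-*-cancel 1ℚ z≢0)) (ℚ.*-identityʳ w))

÷'-unique : ∀ {x y w} → y ≢ 0ℚ → w * y ≡ x → x ÷' y ≡ w
÷'-unique {x} y≢0 eq = *-cancelʳ-≢0 y≢0 (trans (÷'-*-cancel x y≢0) (sym eq))

*-≢0 : ∀ {x y} → x ≢ 0ℚ → y ≢ 0ℚ → x * y ≢ 0ℚ
*-≢0 {x} {y} x≢0 y≢0 xy≡0 = x≢0 (*-cancelʳ-≢0 y≢0 (trans xy≡0 (sym (ℚ.*-zeroˡ y))))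

ofℕ-suc≢0 : ∀ n → ofℕ (suc n) ≢ 0ℚ
ofℕ-suc≢0 n eq with ℚ.normalize-injective-≃ (suc n) 0 1 1 eq
... | ()

inv : Dual → Dual
inv x = (1ℚ ÷' re x) +ε - (im x * ((1ℚ ÷' re x) * (1ℚ ÷' re x)))

opaque
  unfolding _⊕_

  inverse-formula : ∀ x y i → x * i ≡ 1ℚ → (x +ε y) ⊗ (i +ε - (y * (i * i))) ≡ 1D
  inverse-formula x y i xi≡1 = cong₂ _+ε_ xi≡1
    (trans (ℚsolve 3 (λ x y i → x :*′ (:-′ (y :*′ (i :*′ i))) :+′ y :*′ i
                :=′ y :*′ i :*′ (# (+ 1) :-′ x :*′ i)) refl x y i)
      (trans (cong (λ w → y * i * (1ℚ - w)) xi≡1) (ℚ.*-zeroʳ (y * i))))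

  ε²≡0 : ε ⊗ ε ≡ 0D
  ε²≡0 = refl

  im-ε⊗ : ∀ x → im (ε ⊗ x) ≡ re x
  im-ε⊗ x = ℚsolve 2 (λ a b → # (+ 0) :*′ b :+′ # (+ 1) :*′ a :=′ a) refl (re x) (im x)

⊗-inv : ∀ {x} → re x ≢ 0ℚ → x ⊗ inv x ≡ 1D
⊗-inv {x} x≢0 = inverse-formula (re x) (im x) (1ℚ ÷' re x)
  (trans (ℚ.*-comm (re x) (1ℚ ÷' re x)) (÷'-*-cancel 1ℚ x≢0))

re-⊗-≢0 : ∀ {x y} → re x ≢ 0ℚ → re y ≢ 0ℚ → re (x ⊗ y) ≢ 0ℚ
re-⊗-≢0 {x} {y} x≢0 y≢0 eq = *-≢0 x≢0 y≢0 (trans (sym (re-⊗ x y)) eq)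

⊗-cancelˡ : ∀ {x y z} → re x ≢ 0ℚ → x ⊗ y ≡ x ⊗ z → y ≡ z
⊗-cancelˡ {x} {y} {z} x≢0 eq = trans (sym (undo y)) (trans (cong (inv x ⊗_) eq) (undo z))
  where
  undo : ∀ w → inv x ⊗ (x ⊗ w) ≡ w
  undo w = trans (solve 3 (λ i x w → i :* (x :* w) := x :* i :* w) refl (inv x) x w)
    (trans (cong (_⊗ w) (⊗-inv x≢0)) (solve 1 (λ w → con (+ 1) :* w := w) refl w))

⊗-zeroʳ : ∀ x → x ⊗ 0D ≡ 0D
⊗-zeroʳ = solve 1 (λ x → x :* con (+ 0) := con (+ 0)) refl

⊗-zeroˡ : ∀ x → 0D ⊗ x ≡ 0D
⊗-zeroˡ = solve 1 (λ x → con (+ 0) :* x := con (+ 0)) refl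

⊕-identityʳ : ∀ x → x ⊕ 0D ≡ x
⊕-identityʳ = solve 1 (λ x → x :+ con (+ 0) := x) refl

prodD : ℕ → (ℕ → Dual) → Dual
prodD zero    f = 1D
prodD (suc m) f = prodD m f ⊗ f m

prodD-suc : ∀ m f → prodD (suc m) f ≡ f 0 ⊗ prodD m (λ i → f (suc i))
prodD-suc zero    f = solve 1 (λ x → con (+ 1) :* x := x :* con (+ 1)) refl (f 0)
prodD-suc (suc m) f = trans (cong (_⊗ f (suc m)) (prodD-suc m f))
  (solve 3 (λ a b c → a :* b :* c := a :* (b :* c)) refl (f 0) (prodD m (λ i → f (suc i))) (f (suc m)))

prodD-cong : ∀ m {f g} → (∀ i → f i ≡ g i) → prodD m f ≡ prodD m g
prodD-cong zero    eq = refl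
prodD-cong (suc m) eq = cong₂ _⊗_ (prodD-cong m eq) (eq m)

prodD-≢0 : ∀ m {f} → (∀ i → re (f i) ≢ 0ℚ) → re (prodD m f) ≢ 0ℚ
prodD-≢0 zero    nz ()
prodD-≢0 (suc m) nz = re-⊗-≢0 (prodD-≢0 m nz) (nz m)

sumD : ℕ → (ℕ → Dual) → Dual
sumD zero    f = 0D
sumD (suc m) f = f m ⊕ sumD m f

sumD-zero : ∀ m f → (∀ i → i ℕ.< m → f i ≡ 0D) → sumD m f ≡ 0D
sumD-zero zero    f eq = refl
sumD-zero (suc m) f eq = trans (cong₂ _⊕_ (eq m ℕ.≤-refl) (sumD-zero m f (λ i i<m → eq i (ℕ.m<n⇒m<1+n i<m)))) (⊕-identityʳ 0D)

sumD-single : ∀ m l f → l ℕ.< m → (∀ i → i ℕ.< m → i ≢ l → f i ≡ 0D) → sumD m f ≡ f l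
sumD-single (suc m) l f l<1+m eq with l ℕ.≟ m
... | yes refl = trans (cong (f m ⊕_) (sumD-zero m f (λ i i<m → eq i (ℕ.m<n⇒m<1+n i<m) (ℕ.<⇒≢ i<m)))) (⊕-identityʳ (f m))
... | no  l≢m  = trans (cong₂ _⊕_ (eq m ℕ.≤-refl (λ m≡l → l≢m (sym m≡l)))
      (sumD-single m l f (ℕ.≤∧≢⇒< (ℕ.≤-pred l<1+m) l≢m) (λ i i<m → eq i (ℕ.m<n⇒m<1+n i<m))))
    (solve 1 (λ x → con (+ 0) :+ x := x) refl (f l))

-- Polynomials at dual numbers

re-evalD : ∀ f z → re (evalD f z) ≡ evalP f (re z)
re-evalD []      z = refl
re-evalD (x ∷ f) z = trans (re-⊕ (const x) _) (cong (λ v → x + v) (trans (re-⊗ z _) (cong (re z *_) (re-evalD f z))))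

evalD-+P : ∀ f g z → evalD (f +P g) z ≡ evalD f z ⊕ evalD g z
evalD-+P []      g       z = sym (solve 1 (λ x → con (+ 0) :+ x := x) refl (evalD g z))
evalD-+P (x ∷ f) []      z = sym (⊕-identityʳ (evalD (x ∷ f) z))
evalD-+P (x ∷ f) (y ∷ g) z = trans (cong₂ (λ u v → u ⊕ z ⊗ v) (const-⊕ x y) (evalD-+P f g z))
  (solve 5 (λ x y z a b → x :+ y :+ z :* (a :+ b) := x :+ z :* a :+ (y :+ z :* b)) refl
    (const x) (const y) z (evalD f z) (evalD g z))

evalD-scaleP : ∀ c f z → evalD (scaleP c f) z ≡ const c ⊗ evalD f z
evalD-scaleP c []      z = sym (⊗-zeroʳ (const c))
evalD-scaleP c (x ∷ f) z = trans (cong₂ (λ u v → u ⊕ z ⊗ v) (const-⊗ c x) (evalD-scaleP c f z))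
  (solve 4 (λ c x z a → c :* x :+ z :* (c :* a) := c :* (x :+ z :* a)) refl (const c) (const x) z (evalD f z))

evalD-*P : ∀ f g z → evalD (f *P g) z ≡ evalD f z ⊗ evalD g z
evalD-*P []      g z = sym (⊗-zeroˡ (evalD g z))
evalD-*P (x ∷ f) g z = trans (evalD-+P (scaleP x g) (0ℚ ∷ (f *P g)) z)
  (trans (cong₂ (λ u v → u ⊕ (0D ⊕ z ⊗ v)) (evalD-scaleP x g z) (evalD-*P f g z))
   (solve 4 (λ x z a b → x :* b :+ (con (+ 0) :+ z :* (a :* b)) := (x :+ z :* a) :* b) refl
     (const x) z (evalD f z) (evalD g z)))

evalD-prodP : ∀ m f z → evalD (prodP m f) z ≡ prodD m (λ i → evalD (f i) z)
evalD-prodP zero    f z = solve 1 (λ z → con (+ 1) :+ z :* con (+ 0) := con (+ 1)) refl z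
evalD-prodP (suc m) f z = trans (evalD-*P (prodP m f) (f m) z) (cong (_⊗ evalD (f m) z) (evalD-prodP m f z))

length-scaleP : ∀ c f → length (scaleP c f) ≡ length f
length-scaleP c []      = refl
length-scaleP c (x ∷ f) = cong suc (length-scaleP c f)

length-+P : ∀ f g {d} → length f ℕ.≤ d → length g ℕ.≤ d → length (f +P g) ℕ.≤ d
length-+P []      g       p       q       = q
length-+P (x ∷ f) []      p       q       = p
length-+P (x ∷ f) (y ∷ g) (s≤s p) (s≤s q) = s≤s (length-+P f g p q)

-- polynomial functions of degree < d
Deg : ℕ → (Dual → Dual) → Set
Deg d F = Σ Poly λ f → length f ℕ.≤ d × (∀ z → F z ≡ evalD f z)

deg-const : ∀ x → Deg 1 (λ _ → const x)
deg-const x = x ∷ [] , s≤s z≤n , solve 2 (λ x z → x := x :+ z :* con (+ 0)) refl (const x)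

deg-⊕ : ∀ {d F G} → Deg d F → Deg d G → Deg d (λ z → F z ⊕ G z)
deg-⊕ (f , f≤d , F≡f) (g , g≤d , G≡g) =
  f +P g , length-+P f g f≤d g≤d , λ z → trans (cong₂ _⊕_ (F≡f z) (G≡g z)) (sym (evalD-+P f g z))

deg-linear : ∀ {d F} x y → Deg d F → Deg (suc d) (λ z → (const x ⊕ const y ⊗ z) ⊗ F z)
deg-linear {d} x y (f , f≤d , F≡f) = scaleP x f +P (0ℚ ∷ scaleP y f)
  , length-+P (scaleP x f) _ (ℕ.m≤n⇒m≤1+n (subst (ℕ._≤ d) (sym (length-scaleP x f)) f≤d))
      (s≤s (subst (ℕ._≤ d) (sym (length-scaleP y f)) f≤d))
  , λ z → trans (cong ((const x ⊕ const y ⊗ z) ⊗_) (F≡f z))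
     (sym (trans (evalD-+P (scaleP x f) (0ℚ ∷ scaleP y f) z)
       (trans (cong₂ (λ u v → u ⊕ (0D ⊕ z ⊗ v)) (evalD-scaleP x f z) (evalD-scaleP y f z))
        (solve 4 (λ x y z a → x :* a :+ (con (+ 0) :+ z :* (y :* a)) := (x :+ y :* z) :* a) refl
          (const x) (const y) z (evalD f z)))))

deg-cong : ∀ {d F G} → (∀ z → G z ≡ F z) → Deg d F → Deg d G
deg-cong eq (f , f≤d , F≡f) = f , f≤d , λ z → trans (eq z) (F≡f z)

deg-mono : ∀ {d e F} → d ℕ.≤ e → Deg d F → Deg e F
deg-mono d≤e (f , f≤d , F≡f) = f , ℕ.≤-trans f≤d d≤e , F≡f

deg-sum : ∀ {d} m (F : ℕ → Dual → Dual) → (∀ i → i ℕ.< m → Deg d (F i)) → Deg d (λ z → sumD m (λ i → F i z))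
deg-sum zero    F p = [] , z≤n , λ z → refl
deg-sum (suc m) F p = deg-⊕ (p m ℕ.≤-refl) (deg-sum m F (λ i i<m → p i (ℕ.m<n⇒m<1+n i<m)))

deg-prod : ∀ {d G} m (x y : ℕ → ℚ) → Deg d G → Deg (m ℕ.+ d) (λ z → prodD m (λ i → const (x i) ⊕ const (y i) ⊗ z) ⊗ G z)
deg-prod zero    x y p = deg-cong (λ z → solve 1 (λ a → con (+ 1) :* a := a) refl _) p
deg-prod (suc m) x y p = deg-cong
  (λ z → solve 3 (λ a b c → a :* b :* c := b :* (a :* c)) refl (prodD m _) _ _)
  (deg-linear (x m) (y m) (deg-prod m x y p))

-- Synthetic division by z - x: the coefficients of the quotient are the values at x of the
-- successive tails of f.
divP : ℚ → Poly → Poly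
divP x []          = []
divP x (a ∷ [])    = []
divP x (a ∷ b ∷ f) = evalP (b ∷ f) x ∷ divP x (b ∷ f)

length-divP : ∀ x f → length (divP x f) ≡ ℕ.pred (length f)
length-divP x []          = refl
length-divP x (a ∷ [])    = refl
length-divP x (a ∷ b ∷ f) = cong suc (length-divP x (b ∷ f))

evalD-divP : ∀ x f z → evalD f z ≡ const (evalP f x) ⊕ (z ⊝ const x) ⊗ evalD (divP x f) z
evalD-divP x []       z = solve 2 (λ x z → con (+ 0) := con (+ 0) :+ (z :- x) :* con (+ 0)) refl (const x) z
evalD-divP x (a ∷ []) z =
  trans (solve 3 (λ a x z → a :+ z :* con (+ 0) := a :+ x :* con (+ 0) :+ (z :- x) :* con (+ 0)) refl (const a) (const x) z)
    (cong (_⊕ (z ⊝ const x) ⊗ 0D) (sym (trans (const-⊕ a (x * 0ℚ)) (cong (const a ⊕_) (const-⊗ x 0ℚ)))))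
evalD-divP x (a ∷ f@(b ∷ _)) z =
  trans (cong (λ u → const a ⊕ z ⊗ u) (evalD-divP x f z))
  (trans (solve 5 (λ a x z v q → a :+ z :* (v :+ (z :- x) :* q) := a :+ x :* v :+ (z :- x) :* (v :+ z :* q)) refl
      (const a) (const x) z (const (evalP f x)) (evalD (divP x f) z))
    (cong (_⊕ (z ⊝ const x) ⊗ (const (evalP f x) ⊕ z ⊗ evalD (divP x f) z))
      (sym (trans (const-⊕ a (x * evalP f x)) (cong (const a ⊕_) (const-⊗ x (evalP f x)))))))

factor : ∀ x f → evalP f x ≡ 0ℚ → ∀ z → evalD f z ≡ (z ⊝ const x) ⊗ evalD (divP x f) z
factor x f root z = trans (evalD-divP x f z)
  (trans (cong (λ v → const v ⊕ (z ⊝ const x) ⊗ evalD (divP x f) z) root)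
    (solve 1 (λ u → con (+ 0) :+ u := u) refl ((z ⊝ const x) ⊗ evalD (divP x f) z)))

opaque
  unfolding _⊕_
  ⊝-const : ∀ x → (x +ε 1ℚ) ⊝ const x ≡ ε
  ⊝-const x = cong (_+ε 1ℚ) (ℚ.+-inverseʳ x)

-- At `x +ε 1ℚ` the factor z - x equals ε, so the ε-part of the first factorisation is the value of
-- the quotient at x. It vanishes, and the quotient can be divided once more.
factor² : ∀ x f → evalD f (x +ε 1ℚ) ≡ 0D →
  ∀ z → evalD f z ≡ (z ⊝ const x) ⊗ (z ⊝ const x) ⊗ evalD (divP x (divP x f)) z
factor² x f root z = trans (factor x f fx≡0 z)
  (trans (cong ((z ⊝ const x) ⊗_) (factor x (divP x f) qx≡0 z))
    (solve 2 (λ u v → u :* (u :* v) := u :* u :* v) refl (z ⊝ const x) (evalD (divP x (divP x f)) z)))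
  where
  fx≡0 : evalP f x ≡ 0ℚ
  fx≡0 = trans (sym (re-evalD f (x +ε 1ℚ))) (cong re root)
  qx≡0 : evalP (divP x f) x ≡ 0ℚ
  qx≡0 = begin
    evalP (divP x f) x                       ≡⟨ re-evalD (divP x f) (x +ε 1ℚ) ⟨
    re (evalD (divP x f) (x +ε 1ℚ))          ≡⟨ im-ε⊗ _ ⟨
    im (ε ⊗ evalD (divP x f) (x +ε 1ℚ))      ≡⟨ cong (λ u → im (u ⊗ evalD (divP x f) (x +ε 1ℚ))) (⊝-const x) ⟨
    im (((x +ε 1ℚ) ⊝ const x) ⊗ evalD (divP x f) (x +ε 1ℚ)) ≡⟨ cong im (factor x f fx≡0 (x +ε 1ℚ)) ⟨
    im (evalD f (x +ε 1ℚ))                   ≡⟨ cong im root ⟩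
    0ℚ ∎

-- Partial fractions

ofℕ-injective : ∀ {m n} → ofℕ m ≡ ofℕ n → m ≡ n
ofℕ-injective {m} {n} eq = trans (sym (ℕ.*-identityʳ m)) (trans (ℚ.normalize-injective-≃ m n 1 1 eq) (ℕ.*-identityʳ n))

node : ℕ → Dual
node k = - ofℕ (suc k) +ε 1ℚ

opaque
  unfolding _⊕_

  node-separated : ∀ {i j} → i ≢ j → re (node i ⊝ const (- ofℕ (suc j))) ≢ 0ℚ
  node-separated {i} {j} i≢j eq = i≢j (ℕ.suc-injective (ofℕ-injective
    (trans (ℚsolve 2 (λ x y → x :=′ y :-′ (:-′ x :-′ :-′ y) :-′ y :+′ y) refl (ofℕ (suc i)) (ofℕ (suc j)))
     (trans (cong (λ w → ofℕ (suc j) - w - ofℕ (suc j) + ofℕ (suc j)) eq)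
       (ℚsolve 1 (λ y → y :-′ # (+ 0) :-′ y :+′ y :=′ y) refl (ofℕ (suc j)))))))

⊝-const-neg : ∀ z x → z ⊝ const (- x) ≡ z ⊕ const x
⊝-const-neg z x = trans (cong (z ⊝_) (const-⊖ x)) (solve 2 (λ z x → z :- :- x := z :+ x) refl z (const x))

rising : ℕ → Dual → Dual
rising m z = prodD m (λ i → z ⊕ ι (+ suc i))

-- Each double root removes two degrees, and at every other node the removed factor is invertible,
-- so the other double roots pass to the quotient. The length bound admits degree 2m, which leaves a
-- constant e instead of 0: exactly the room that the numerator of G requires.
double-roots : ∀ m f → length f ℕ.≤ suc (m ℕ.+ m) → (∀ i → i ℕ.< m → evalD f (node i) ≡ 0D) →
  ∃ λ e → ∀ z → evalD f z ≡ const e ⊗ (rising m z ⊗ rising m z)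
double-roots zero [] _ _ = 0ℚ , λ z → sym (⊗-zeroˡ (1D ⊗ 1D))
double-roots zero (x ∷ []) _ _ = x ,
  solve 2 (λ x z → x :+ z :* con (+ 0) := x :* (con (+ 1) :* con (+ 1))) refl (const x)
double-roots zero (x ∷ y ∷ f) (s≤s ()) _
double-roots (suc m) f f≤ roots = proj₁ ih , λ z → begin
    evalD f z                                     ≡⟨ f≡g z ⟩
    (z ⊝ const x) ⊗ (z ⊝ const x) ⊗ evalD g z     ≡⟨ cong₂ (λ u v → u ⊗ u ⊗ v) (⊝-const-neg z (ofℕ (suc m))) (proj₂ ih z) ⟩
    y z ⊗ y z ⊗ (const (proj₁ ih) ⊗ (rising m z ⊗ rising m z))
      ≡⟨ solve 3 (λ y e r → y :* y :* (e :* (r :* r)) := e :* (r :* y :* (r :* y))) refl (y z) (const (proj₁ ih)) (rising m z) ⟩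
    const (proj₁ ih) ⊗ (rising m z ⊗ y z ⊗ (rising m z ⊗ y z)) ∎
  where
  x = - ofℕ (suc m)
  g = divP x (divP x f)
  y = λ z → z ⊕ ι (+ suc m)
  f≡g = factor² x f (roots m ℕ.≤-refl)
  g≤ : length g ℕ.≤ suc (m ℕ.+ m)
  g≤ = subst (ℕ._≤ suc (m ℕ.+ m)) (sym (trans (length-divP x (divP x f)) (cong ℕ.pred (length-divP x f))))
    (ℕ.pred-mono-≤ (ℕ.pred-mono-≤ (subst (length f ℕ.≤_) (cong (λ k → suc (suc k)) (ℕ.+-suc m m)) f≤)))
  g-roots : ∀ i → i ℕ.< m → evalD g (node i) ≡ 0D
  g-roots i i<m = ⊗-cancelˡ (re-⊗-≢0 u≢0 u≢0)
    (trans (sym (f≡g (node i))) (trans (roots i (ℕ.m<n⇒m<1+n i<m)) (sym (⊗-zeroʳ (u ⊗ u)))))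
    where
    u = node i ⊝ const x
    u≢0 = node-separated {i} {m} (ℕ.<⇒≢ i<m)
  ih = double-roots m g g≤ g-roots

prodD-+ : ∀ k m f → prodD (k ℕ.+ m) f ≡ prodD k f ⊗ prodD m (λ i → f (k ℕ.+ i))
prodD-+ k zero    f = trans (cong (λ j → prodD j f) (ℕ.+-identityʳ k)) (solve 1 (λ x → x := x :* con (+ 1)) refl (prodD k f))
prodD-+ k (suc m) f = trans (cong (λ j → prodD j f) (ℕ.+-suc k m))
  (trans (cong (_⊗ f (k ℕ.+ m)) (prodD-+ k m f))
    (solve 3 (λ a b c → a :* b :* c := a :* (b :* c)) refl (prodD k f) (prodD m (λ i → f (k ℕ.+ i))) (f (k ℕ.+ m))))

prodD-⊖² : ∀ m {f g} → (∀ i → g i ≡ ⊖ f i) → prodD m g ⊗ prodD m g ≡ prodD m f ⊗ prodD m f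
prodD-⊖² zero    eq = refl
prodD-⊖² (suc m) {f} {g} eq = begin
  prodD m g ⊗ g m ⊗ (prodD m g ⊗ g m)    ≡⟨ solve 2 (λ a b → a :* b :* (a :* b) := a :* a :* (b :* b)) refl (prodD m g) (g m) ⟩
  prodD m g ⊗ prodD m g ⊗ (g m ⊗ g m)    ≡⟨ cong₂ (λ u v → u ⊗ (v ⊗ v)) (prodD-⊖² m eq) (eq m) ⟩
  prodD m f ⊗ prodD m f ⊗ (⊖ f m ⊗ ⊖ f m) ≡⟨ solve 2 (λ a b → a :* a :* (:- b :* :- b) := a :* b :* (a :* b)) refl (prodD m f) (f m) ⟩
  prodD m f ⊗ f m ⊗ (prodD m f ⊗ f m)    ∎

prodD-ε : ∀ m l f x → l ℕ.< m → f l ≡ ε ⊗ x → ∃ λ y → prodD m f ≡ ε ⊗ y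
prodD-ε (suc m) l f x l<1+m eq with l ℕ.≟ m
... | yes refl = prodD m f ⊗ x , trans (cong (prodD m f ⊗_) eq)
                   (solve 3 (λ a e x → a :* (e :* x) := e :* (a :* x)) refl (prodD m f) ε x)
... | no  l≢m with prodD-ε m l f x (ℕ.≤∧≢⇒< (ℕ.≤-pred l<1+m) l≢m) eq
...   | y , eq′ = y ⊗ f m , trans (cong (_⊗ f m) eq′)
                   (solve 3 (λ e y a → e :* y :* a := e :* (y :* a)) refl ε y (f m))

ε²-vanishes : ∀ {x} y → x ≡ ε ⊗ y → x ⊗ x ≡ 0D
ε²-vanishes y refl = trans (solve 2 (λ e y → e :* y :* (e :* y) := e :* e :* (y :* y)) refl ε y)
  (trans (cong (_⊗ (y ⊗ y)) ε²≡0) (⊗-zeroˡ (y ⊗ y)))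

-- Up to sign, cofactor M k z is the product of the z + i + 1 over all i < M other than k;
-- the sign makes its value at node k a product of terms of the form i ± ε with i > 0.
cofactor : ℕ → ℕ → Dual → Dual
cofactor M k z = prodD k (λ i → const (- ofℕ (suc i)) ⊕ const (- 1ℚ) ⊗ z)
               ⊗ prodD (M ℕ.∸ suc k) (λ i → const (ofℕ (suc (suc k ℕ.+ i))) ⊕ const 1ℚ ⊗ z)

below-factor : ∀ y z → const (- y) ⊕ const (- 1ℚ) ⊗ z ≡ ⊖ (z ⊕ const y)
below-factor y z = trans (cong₂ (λ u v → u ⊕ v ⊗ z) (const-⊖ y) (const-⊖ 1ℚ))
  (solve 2 (λ y z → :- y :+ :- con (+ 1) :* z := :- (z :+ y)) refl (const y) z)

above-factor : ∀ y z → const y ⊕ const 1ℚ ⊗ z ≡ z ⊕ const y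
above-factor y z = solve 2 (λ y z → y :+ con (+ 1) :* z := z :+ y) refl (const y) z

opaque
  unfolding _⊕_
  node-form : ∀ k → node k ≡ ⊖ ι (+ suc k) ⊕ ε
  node-form k = cong (_+ε 1ℚ) (sym (ℚ.+-identityʳ (- ofℕ (suc k))))

  dual-form : ∀ g → const (re g) ⊕ const (im g) ⊗ ε ≡ g
  dual-form g = cong₂ _+ε_
    (ℚsolve 2 (λ a b → a :+′ b :*′ # (+ 0) :=′ a) refl (re g) (im g))
    (ℚsolve 1 (λ b → # (+ 0) :+′ (b :*′ # (+ 1) :+′ # (+ 0) :*′ # (+ 0)) :=′ b) refl (im g))

node-⊕ : ∀ k → node k ⊕ ι (+ suc k) ≡ ε
node-⊕ k = trans (cong (_⊕ ι (+ suc k)) (node-form k)) (solve 2 (λ y e → :- y :+ e :+ y := e) refl (ι (+ suc k)) ε)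

-- For l ≠ k the factor of index l is present and equals ε or -ε at `node l`, so the square contains
-- ε².
cofactor-off-node : ∀ {M k l} → k ℕ.< M → l ℕ.< M → k ≢ l → cofactor M k (node l) ⊗ cofactor M k (node l) ≡ 0D
cofactor-off-node {M} {k} {l} k<M l<M k≢l with ℕ.<-cmp l k
... | tri< l<k _ _ = ε²-vanishes (y ⊗ B) (trans (cong (_⊗ B) eq) (solve 3 (λ e y b → e :* y :* b := e :* (y :* b)) refl ε y B))
  where
  B = prodD (M ℕ.∸ suc k) (λ i → const (ofℕ (suc (suc k ℕ.+ i))) ⊕ const 1ℚ ⊗ node l)
  A-ε = prodD-ε k l (λ i → const (- ofℕ (suc i)) ⊕ const (- 1ℚ) ⊗ node l) (⊖ 1D) l<k
    (trans (below-factor (ofℕ (suc l)) (node l))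
     (trans (cong ⊖_ (node-⊕ l)) (solve 1 (λ e → :- e := e :* :- con (+ 1)) refl ε)))
  y = proj₁ A-ε
  eq = proj₂ A-ε
... | tri≈ _ l≡k _ = ⊥-elim (k≢l (sym l≡k))
... | tri> _ _ k<l = ε²-vanishes (A ⊗ y) (trans (cong (A ⊗_) eq) (solve 3 (λ e y a → a :* (e :* y) := e :* (a :* y)) refl ε y A))
  where
  A = prodD k (λ i → const (- ofℕ (suc i)) ⊕ const (- 1ℚ) ⊗ node l)
  l-k = l ℕ.∸ suc k
  B-ε = prodD-ε (M ℕ.∸ suc k) l-k (λ i → const (ofℕ (suc (suc k ℕ.+ i))) ⊕ const 1ℚ ⊗ node l) 1D
    (ℕ.∸-monoˡ-< l<M k<l)
    (trans (above-factor (ofℕ (suc (suc k ℕ.+ l-k))) (node l))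
     (trans (cong (λ i → node l ⊕ ι (+ suc i)) (ℕ.m+[n∸m]≡n k<l))
      (trans (node-⊕ l) (solve 1 (λ e → e := e :* con (+ 1)) refl ε))))
  y = proj₁ B-ε
  eq = proj₂ B-ε

cofactor-rising : ∀ {M k} → k ℕ.< M → ∀ z → let y = z ⊕ ι (+ suc k) in
  cofactor M k z ⊗ cofactor M k z ⊗ (y ⊗ y) ≡ rising M z ⊗ rising M z
cofactor-rising {M} {k} k<M z = begin
  (A ⊗ B) ⊗ (A ⊗ B) ⊗ (y ⊗ y)        ≡⟨ solve 3 (λ a b y → a :* b :* (a :* b) :* (y :* y) := a :* a :* (b :* b :* (y :* y))) refl A B y ⟩
  A ⊗ A ⊗ (B ⊗ B ⊗ (y ⊗ y))          ≡⟨ cong₂ (λ u v → u ⊗ (v ⊗ v ⊗ (y ⊗ y)))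
                                          (prodD-⊖² k (λ i → below-factor (ofℕ (suc i)) z))
                                          (prodD-cong j (λ i → above-factor (ofℕ (suc (suc k ℕ.+ i))) z)) ⟩
  A′ ⊗ A′ ⊗ (B′ ⊗ B′ ⊗ (y ⊗ y))      ≡⟨ solve 3 (λ a b y → a :* a :* (b :* b :* (y :* y)) := a :* y :* b :* (a :* y :* b)) refl A′ B′ y ⟩
  (A′ ⊗ y ⊗ B′) ⊗ (A′ ⊗ y ⊗ B′)      ≡⟨ cong (λ u → u ⊗ u) (prodD-+ (suc k) j (λ i → z ⊕ ι (+ suc i))) ⟨
  rising (suc k ℕ.+ j) z ⊗ rising (suc k ℕ.+ j) z ≡⟨ cong (λ m → rising m z ⊗ rising m z) (ℕ.m+[n∸m]≡n k<M) ⟩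
  rising M z ⊗ rising M z            ∎
  where
  j = M ℕ.∸ suc k
  y = z ⊕ ι (+ suc k)
  A = prodD k (λ i → const (- ofℕ (suc i)) ⊕ const (- 1ℚ) ⊗ z)
  B = prodD j (λ i → const (ofℕ (suc (suc k ℕ.+ i))) ⊕ const 1ℚ ⊗ z)
  A′ = prodD k (λ i → z ⊕ ι (+ suc i))
  B′ = prodD j (λ i → z ⊕ ι (+ suc (suc k ℕ.+ i)))

deg-cofactor² : ∀ {M k} → k ℕ.< M → ∀ x y →
  Deg (M ℕ.+ M) (λ z → (const x ⊕ const y ⊗ z) ⊗ (cofactor M k z ⊗ cofactor M k z))
deg-cofactor² {M} {k} k<M x y = deg-mono (ℕ.≤-reflexive degree)
  (deg-cong (λ z → solve 3 (λ l a b → l :* (a :* b :* (a :* b)) := l :* (a :* (b :* (a :* (b :* con (+ 1)))))) refl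
              (const x ⊕ const y ⊗ z) (prodD k _) (prodD j _))
    (deg-linear x y (deg-prod k a₀ a₁ (deg-prod j b₀ b₁ (deg-prod k a₀ a₁ (deg-prod j b₀ b₁ (deg-const 1ℚ)))))))
  where
  j = M ℕ.∸ suc k
  a₀ a₁ b₀ b₁ : ℕ → ℚ
  a₀ i = - ofℕ (suc i)
  a₁ i = - 1ℚ
  b₀ i = ofℕ (suc (suc k ℕ.+ i))
  b₁ i = 1ℚ
  degree : suc (k ℕ.+ (j ℕ.+ (k ℕ.+ (j ℕ.+ 1)))) ≡ M ℕ.+ M
  degree = trans (NS.solve 2 (λ k j → NS.con 1 NS.:+ (k NS.:+ (j NS.:+ (k NS.:+ (j NS.:+ NS.con 1))))
      NS.:= NS.con 1 NS.:+ k NS.:+ j NS.:+ (NS.con 1 NS.:+ k NS.:+ j)) refl k j)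
    (cong (λ m → m ℕ.+ m) (ℕ.m+[n∸m]≡n k<M))

Σ< : ℕ → (ℕ → ℚ) → ℚ
Σ< zero    f = 0ℚ
Σ< (suc m) f = f m + Σ< m f

im-sumD : ∀ m f → im (sumD m f) ≡ Σ< m (λ i → im (f i))
im-sumD zero    f = refl
im-sumD (suc m) f = trans (im-⊕ (f m) (sumD m f)) (cong (λ w → im (f m) + w) (im-sumD m f))

sumD-⊗ : ∀ m x f → sumD m (λ i → x ⊗ f i) ≡ x ⊗ sumD m f
sumD-⊗ zero    x f = sym (⊗-zeroʳ x)
sumD-⊗ (suc m) x f = trans (cong (x ⊗ f m ⊕_) (sumD-⊗ m x f))
  (solve 3 (λ x a b → x :* a :+ x :* b := x :* (a :+ b)) refl x (f m) (sumD m f))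

sumD-cong : ∀ m {f g} → (∀ i → i ℕ.< m → f i ≡ g i) → sumD m f ≡ sumD m g
sumD-cong zero    eq = refl
sumD-cong (suc m) eq = cong₂ _⊕_ (eq m ℕ.≤-refl) (sumD-cong m (λ i i<m → eq i (ℕ.m<n⇒m<1+n i<m)))

opaque
  unfolding _⊕_
  -- This is the derivative at 0 of α/(z+y)² + β/(z+y), with i = 1/y; the numerator is the one over
  -- the common denominator (z+y)².
  im-pole : ∀ (α β y i : ℚ) → i * y ≡ 1ℚ →
    im ((const (α + β * y) ⊕ const β ⊗ ε) ⊗ ((i +ε - (1ℚ * (i * i))) ⊗ (i +ε - (1ℚ * (i * i)))))
    ≡ - (α * (ofℕ 2 * (i * i * i)) + β * (i * i))
  im-pole α β y i iy≡1 = trans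
    (ℚsolve 4 (λ α β y i → let ii = :-′ (# (+ 1) :*′ (i :*′ i)) in
      (α :+′ β :*′ y :+′ β :*′ # (+ 0)) :*′ (i :*′ ii :+′ ii :*′ i)
        :+′ (# (+ 0) :+′ (β :*′ # (+ 1) :+′ # (+ 0) :*′ # (+ 0))) :*′ (i :*′ i)
      :=′ :-′ (α :*′ (# (+ 2) :*′ (i :*′ i :*′ i))
        :+′ β :*′ (i :*′ i) :*′ (# (+ 2) :*′ (i :*′ y) :-′ # (+ 1)))) refl α β y i)
    (trans (cong (λ w → - (α * (ofℕ 2 * (i * i * i)) + β * (i * i) * (ofℕ 2 * w - 1ℚ))) iy≡1)
      (cong (λ w → - (α * (ofℕ 2 * (i * i * i)) + w)) (ℚ.*-identityʳ (β * (i * i)))))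

  ε⊕ι : ∀ k → ε ⊕ ι (+ k) ≡ ofℕ k +ε 1ℚ
  ε⊕ι k = cong (_+ε 1ℚ) (ℚ.+-identityˡ (ofℕ k))

Σ<-neg : ∀ m f → Σ< m (λ i → - f i) ≡ - Σ< m f
Σ<-neg zero    f = refl
Σ<-neg (suc m) f = trans (cong (λ w → - f m + w) (Σ<-neg m f)) (sym (ℚ.neg-distrib-+ (f m) (Σ< m f)))

Σ<-cong : ∀ m {f g} → (∀ i → i ℕ.< m → f i ≡ g i) → Σ< m f ≡ Σ< m g
Σ<-cong zero    eq = refl
Σ<-cong (suc m) eq = cong₂ _+_ (eq m ℕ.≤-refl) (Σ<-cong m (λ i i<m → eq i (ℕ.m<n⇒m<1+n i<m)))

-- Write g_k + ε h_k for `g k`. Then F minus the Hermite interpolant built from g_k + h_k(z+k+1) has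
-- double zeros at all M nodes, hence F/(z+1)_M² is a constant e plus the sum of g_k/(z+k+1)² +
-- h_k/(z+k+1). The value at ε of the left side is 0, and its ε-part gives the claim, because e
-- contributes none.
residue-sum : ∀ M F (g : ℕ → Dual) → Deg (suc (M ℕ.+ M)) F → F ε ≡ 0D →
  (∀ k → k ℕ.< M → F (node k) ≡ cofactor M k (node k) ⊗ cofactor M k (node k) ⊗ g k) →
  Σ< M (λ k → let i = 1ℚ ÷' ofℕ (suc k) in re (g k) * (ofℕ 2 * (i * i * i)) + im (g k) * (i * i)) ≡ 0ℚ
residue-sum M F g degF Fε≡0 F-node = begin
  Σ< M t                      ≡⟨ ⁻¹-involutive (Σ< M t) ⟨
  - (- Σ< M t)                ≡⟨ cong -_ (Σ<-neg M t) ⟨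
  - Σ< M (λ k → - t k)        ≡⟨ cong -_ (Σ<-cong M (λ k _ → im-term k)) ⟨
  - Σ< M (λ k → im (term k))  ≡⟨ cong -_ (im-sumD M term) ⟨
  - im (sumD M term)          ≡⟨ cong (λ w → - im w) sum≡const ⟩
  - im (const (- e))          ≡⟨⟩
  0ℚ                          ∎
  where
  open import Algebra.Properties.Group ℚ.+-0-group using (⁻¹-involutive)
  i : ℕ → ℚ
  i k = 1ℚ ÷' ofℕ (suc k)
  t : ℕ → ℚ
  t k = re (g k) * (ofℕ 2 * (i k * i k * i k)) + im (g k) * (i k * i k)
  -- Chosen so that `lin-part k z` is g_k + h_k(z+k+1), which becomes g_k + ε h_k at `node k`.
  l₀ : ℕ → ℚ
  l₀ k = re (g k) + im (g k) * ofℕ (suc k)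
  lin-part : ℕ → Dual → Dual
  lin-part k z = const (l₀ k) ⊕ const (im (g k)) ⊗ z
  W : ℕ → Dual → Dual
  W k z = cofactor M k z ⊗ cofactor M k z
  interpolant : Dual → Dual
  interpolant z = sumD M (λ k → lin-part k z ⊗ W k z)
  difference : Deg (suc (M ℕ.+ M)) (λ z → F z ⊕ sumD M (λ k → (const (- l₀ k) ⊕ const (- im (g k)) ⊗ z) ⊗ W k z))
  difference = deg-⊕ degF (deg-mono (ℕ.n≤1+n (M ℕ.+ M)) (deg-sum M _ (λ k k<M → deg-cofactor² k<M (- l₀ k) (- im (g k)))))
  f = proj₁ difference
  f-eval : ∀ z → evalD f z ≡ F z ⊝ interpolant z
  f-eval z = trans (sym (proj₂ (proj₂ difference) z)) (cong (F z ⊕_)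
    (trans (sumD-cong M (λ k _ → trans (cong₂ (λ u v → (u ⊕ v ⊗ z) ⊗ W k z) (const-⊖ (l₀ k)) (const-⊖ (im (g k))))
        (solve 4 (λ a b z c → (:- a :+ :- b :* z) :* c := :- con (+ 1) :* ((a :+ b :* z) :* c)) refl
          (const (l₀ k)) (const (im (g k))) z (W k z))))
     (trans (sumD-⊗ M (⊖ 1D) (λ k → lin-part k z ⊗ W k z))
       (solve 1 (λ x → :- con (+ 1) :* x := :- x) refl (interpolant z)))))
  lin-part-⊕ : ∀ k z → lin-part k z ≡ const (re (g k)) ⊕ const (im (g k)) ⊗ (z ⊕ ι (+ suc k))
  lin-part-⊕ k z = trans (cong (_⊕ const (im (g k)) ⊗ z)
      (trans (const-⊕ (re (g k)) (im (g k) * ofℕ (suc k))) (cong (const (re (g k)) ⊕_) (const-⊗ (im (g k)) (ofℕ (suc k))))))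
    (solve 4 (λ a b y z → a :+ b :* y :+ b :* z := a :+ b :* (z :+ y)) refl (const (re (g k))) (const (im (g k))) (ι (+ suc k)) z)
  roots : ∀ l → l ℕ.< M → evalD f (node l) ≡ 0D
  roots l l<M = trans (f-eval (node l)) (trans (cong₂ _⊝_ (F-node l l<M) (begin
    interpolant (node l)
      ≡⟨ sumD-single M l (λ k → lin-part k (node l) ⊗ W k (node l)) l<M
           (λ k k<M k≢l → trans (cong (lin-part k (node l) ⊗_) (cofactor-off-node k<M l<M k≢l)) (⊗-zeroʳ (lin-part k (node l)))) ⟩
    lin-part l (node l) ⊗ W l (node l)
      ≡⟨ cong (_⊗ W l (node l)) (trans (lin-part-⊕ l (node l))
           (trans (cong (λ u → const (re (g l)) ⊕ const (im (g l)) ⊗ u) (node-⊕ l)) (dual-form (g l)))) ⟩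
    g l ⊗ W l (node l) ∎))
    (solve 2 (λ c g → c :* g :- g :* c := con (+ 0)) refl (W l (node l)) (g l)))
  e-spec = double-roots M f (proj₁ (proj₂ difference)) roots
  e = proj₁ e-spec
  R = rising M ε
  y : ℕ → Dual
  y k = ε ⊕ ι (+ suc k)
  y≢0 : ∀ k → re (y k) ≢ 0ℚ
  y≢0 k eq = ofℕ-suc≢0 k (trans (sym (cong re (ε⊕ι (suc k)))) eq)
  R≢0 : re R ≢ 0ℚ
  R≢0 = prodD-≢0 M y≢0
  term : ℕ → Dual
  term k = lin-part k ε ⊗ (inv (y k) ⊗ inv (y k))
  W-ε : ∀ k → k ℕ.< M → W k ε ≡ R ⊗ R ⊗ (inv (y k) ⊗ inv (y k))
  W-ε k k<M = begin
    W k ε                                           ≡⟨ solve 1 (λ c → c := c :* (con (+ 1) :* con (+ 1))) refl (W k ε) ⟩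
    W k ε ⊗ (1D ⊗ 1D)                               ≡⟨ cong (λ u → W k ε ⊗ (u ⊗ u)) (⊗-inv (y≢0 k)) ⟨
    W k ε ⊗ (y k ⊗ inv (y k) ⊗ (y k ⊗ inv (y k)))   ≡⟨ solve 3 (λ c y i → c :* (y :* i :* (y :* i)) := c :* (y :* y) :* (i :* i)) refl (W k ε) (y k) (inv (y k)) ⟩
    W k ε ⊗ (y k ⊗ y k) ⊗ (inv (y k) ⊗ inv (y k))   ≡⟨ cong (_⊗ (inv (y k) ⊗ inv (y k))) (cofactor-rising k<M ε) ⟩
    R ⊗ R ⊗ (inv (y k) ⊗ inv (y k))                 ∎
  interpolant-ε : interpolant ε ≡ R ⊗ R ⊗ sumD M term
  interpolant-ε = trans (sumD-cong M (λ k k<M → trans (cong (lin-part k ε ⊗_) (W-ε k k<M))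
      (solve 3 (λ l r i → l :* (r :* i) := r :* (l :* i)) refl (lin-part k ε) (R ⊗ R) (inv (y k) ⊗ inv (y k)))))
    (sumD-⊗ M (R ⊗ R) term)
  sum≡const : sumD M term ≡ const (- e)
  sum≡const = ⊗-cancelˡ (re-⊗-≢0 R≢0 R≢0) (begin
    R ⊗ R ⊗ sumD M term         ≡⟨ interpolant-ε ⟨
    interpolant ε               ≡⟨ solve 2 (λ f i → i := f :- (f :- i)) refl (F ε) (interpolant ε) ⟩
    F ε ⊝ (F ε ⊝ interpolant ε) ≡⟨ cong₂ _⊝_ Fε≡0 (trans (sym (f-eval ε)) (proj₂ e-spec ε)) ⟩
    0D ⊝ const e ⊗ (R ⊗ R)      ≡⟨ solve 2 (λ e r → con (+ 0) :- e :* (r :* r) := r :* r :* :- e) refl (const e) R ⟩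
    R ⊗ R ⊗ ⊖ const e           ≡⟨ cong (R ⊗ R ⊗_) (const-⊖ e) ⟨
    R ⊗ R ⊗ const (- e)         ∎)
  im-term : ∀ k → im (term k) ≡ - t k
  im-term k = trans (cong (λ u → im (lin-part k ε ⊗ (inv u ⊗ inv u))) (ε⊕ι (suc k)))
    (im-pole (re (g k)) (im (g k)) (ofℕ (suc k)) (i k) (÷'-*-cancel 1ℚ (ofℕ-suc≢0 k)))

-- Telescoping at the poles

-- Deformed factorials. At z = -(k+1)+ε the factors of (-z)_n have the form i - ε, and those of
-- (z+1)_n, apart from the factor ε itself, the form i + ε or -(i - ε), with i > 0.
fac⁻ fac⁺ : ℕ → Dual
fac⁻ m = prodD m (λ i → ι (+ suc i) ⊝ ε)
fac⁺ m = prodD m (λ i → ι (+ suc i) ⊕ ε)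

opaque
  unfolding _⊕_
  re-⊝ε : ∀ k → re (ι (+ suc k) ⊝ ε) ≢ 0ℚ
  re-⊝ε k eq = ofℕ-suc≢0 k (trans (sym (ℚ.+-identityʳ (ofℕ (suc k)))) eq)

  re-⊕ε : ∀ k → re (ι (+ suc k) ⊕ ε) ≢ 0ℚ
  re-⊕ε k eq = ofℕ-suc≢0 k (trans (sym (ℚ.+-identityʳ (ofℕ (suc k)))) eq)

fac⁻≢0 : ∀ m → re (fac⁻ m) ≢ 0ℚ
fac⁻≢0 m = prodD-≢0 m re-⊝ε

fac⁺≢0 : ∀ m → re (fac⁺ m) ≢ 0ℚ
fac⁺≢0 m = prodD-≢0 m re-⊕ε

inv-cancel : ∀ {x y} → re x ≢ 0ℚ → re y ≢ 0ℚ → inv (x ⊗ y) ⊗ y ≡ inv x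
inv-cancel {x} {y} x≢0 y≢0 = ⊗-cancelˡ x≢0 (begin
  x ⊗ (inv (x ⊗ y) ⊗ y)    ≡⟨ solve 3 (λ x y i → x :* (i :* y) := x :* y :* i) refl x y (inv (x ⊗ y)) ⟩
  x ⊗ y ⊗ inv (x ⊗ y)      ≡⟨ ⊗-inv (re-⊗-≢0 x≢0 y≢0) ⟩
  1D                       ≡⟨ ⊗-inv x≢0 ⟨
  x ⊗ inv x                ∎)

-- For a = m+k-1 and j = m-k this is, up to the sign (-1)^k, ε times (-z)_{m-1}/(z+1)_{m+1} at z =
-- -(k+1)+ε. One `fac⁻ k` completes the numerator to a full factorial; the other comes from the
-- factors of the denominator before the pole.
weight : ℕ → ℕ → ℕ → Dual
weight a k j = fac⁻ a ⊗ (inv (fac⁻ k) ⊗ inv (fac⁻ k)) ⊗ inv (fac⁺ j)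

weight-suc : ∀ a k j → weight a k j ⊗ (ι (+ suc a) ⊝ ε) ≡ weight (suc a) k j
weight-suc a k j = solve 4 (λ f u i j → f :* i :* j :* u := f :* u :* i :* j) refl
  (fac⁻ a) (ι (+ suc a) ⊝ ε) (inv (fac⁻ k) ⊗ inv (fac⁻ k)) (inv (fac⁺ j))

weight-pred : ∀ a k j → weight a k (suc j) ⊗ (ι (+ suc j) ⊕ ε) ≡ weight a k j
weight-pred a k j = trans (solve 3 (λ x i u → x :* i :* u := x :* (i :* u)) refl
    (fac⁻ a ⊗ (inv (fac⁻ k) ⊗ inv (fac⁻ k))) (inv (fac⁺ (suc j))) (ι (+ suc j) ⊕ ε))
  (cong (fac⁻ a ⊗ (inv (fac⁻ k) ⊗ inv (fac⁻ k)) ⊗_) (inv-cancel (fac⁺≢0 j) (re-⊕ε j)))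

-- `node k` is -(k+1-ε), so its square removes the last factor from both copies of `fac⁻ (suc k)`.
-- This is what identifies G(z+1) at one node with G(z) at the preceding one.
weight-node : ∀ a k j → weight a (suc k) j ⊗ (node k ⊗ node k) ≡ weight a k j
weight-node a k j = begin
  weight a (suc k) j ⊗ (node k ⊗ node k)
    ≡⟨ cong (λ u → weight a (suc k) j ⊗ (u ⊗ u)) (trans (node-form k) (solve 2 (λ y e → :- y :+ e := :- (y :- e)) refl (ι (+ suc k)) ε)) ⟩
  weight a (suc k) j ⊗ (⊖ u ⊗ ⊖ u)
    ≡⟨ solve 4 (λ f i u j → f :* (i :* i) :* j :* (:- u :* :- u) := f :* (i :* u :* (i :* u)) :* j) refl (fac⁻ a) (inv (fac⁻ (suc k))) u (inv (fac⁺ j)) ⟩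
  fac⁻ a ⊗ (inv (fac⁻ (suc k)) ⊗ u ⊗ (inv (fac⁻ (suc k)) ⊗ u)) ⊗ inv (fac⁺ j)
    ≡⟨ cong (λ v → fac⁻ a ⊗ (v ⊗ v) ⊗ inv (fac⁺ j)) (inv-cancel (fac⁻≢0 k) (re-⊝ε k)) ⟩
  weight a k j ∎
  where u = ι (+ suc k) ⊝ ε

node-suc : ∀ k → node (suc k) ⊕ 1D ≡ node k
node-suc k = trans (cong (_⊕ 1D) (trans (node-form (suc k)) (cong (λ u → ⊖ u ⊕ ε) (ι-+ (+ 1) (+ suc k)))))
  (trans (solve 2 (λ y e → :- (con (+ 1) :+ y) :+ e :+ con (+ 1) := :- y :+ e) refl (ι (+ suc k)) ε) (sym (node-form k)))

node-shift : ∀ k n c d → suc k ℕ.+ d ≡ n ℕ.+ c → node k ⊕ ι (+ n) ⊕ ι (+ c) ≡ ι (+ d) ⊕ ε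
node-shift k n c d eq = begin
  node k ⊕ ι (+ n) ⊕ ι (+ c)                 ≡⟨ solve 3 (λ z n c → z :+ n :+ c := z :+ (n :+ c)) refl (node k) (ι (+ n)) (ι (+ c)) ⟩
  node k ⊕ (ι (+ n) ⊕ ι (+ c))               ≡⟨ cong₂ _⊕_ (node-form k) (trans (sym (ι-+ (+ n) (+ c))) (trans (cong (λ m → ι (+ m)) (sym eq)) (ι-+ (+ suc k) (+ d)))) ⟩
  ⊖ ι (+ suc k) ⊕ ε ⊕ (ι (+ suc k) ⊕ ι (+ d)) ≡⟨ solve 3 (λ y e d → :- y :+ e :+ (y :+ d) := d :+ e) refl (ι (+ suc k)) ε (ι (+ d)) ⟩
  ι (+ d) ⊕ ε ∎

node-reflect : ∀ k n → ι (+ n) ⊝ node k ≡ ι (+ suc (n ℕ.+ k)) ⊝ ε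
node-reflect k n = trans (cong (ι (+ n) ⊝_) (node-form k))
  (trans (solve 3 (λ n y e → n :- (:- y :+ e) := n :+ y :- e) refl (ι (+ n)) (ι (+ suc k)) ε)
    (cong (_⊝ ε) (trans (sym (ι-+ (+ n) (+ suc k))) (cong (λ m → ι (+ m)) (ℕ.+-suc n k)))))

node-reflect′ : ∀ k n → ι (+ suc n) ⊝ 1D ⊝ node k ≡ ι (+ suc (n ℕ.+ k)) ⊝ ε
node-reflect′ k n = trans (cong (_⊝ node k) (trans (cong (_⊝ 1D) (ι-+ (+ 1) (+ n)))
    (solve 1 (λ n → con (+ 1) :+ n :- con (+ 1) := n) refl (ι (+ n)))))
  (node-reflect k n)

-- b + ε a, the polar part of F_{m,1} at z = -(k+1)
term : ℕ → ℕ → ℕ → Dual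
term ρ m k = kern ρ m (node k) (weight (m ℕ.+ k ℕ.∸ 1) k (m ℕ.∸ k))

suc-∸ : ∀ {k n} → k ℕ.≤ n → suc n ℕ.∸ k ≡ suc (n ℕ.∸ k)
suc-∸ k≤n = ℕ.+-∸-assoc 1 k≤n

module Recurrence (ρ n′ : ℕ) where

  n : ℕ
  n = suc n′

  N : Dual
  N = ι (+ n)

  -- `s k` renormalises (-z)_{n-1}/(z+1)_{n+3} at the node; the products are those of `telescope`,
  -- and so become the weights for m = n, n+1 and n+2.
  s s₀ s₁ s₂ : ℕ → Dual
  s k  = weight (n′ ℕ.+ k) k (suc (suc n) ℕ.∸ k)
  s₂ k = s k ⊗ ((N ⊝ 1D ⊝ node k) ⊗ (N ⊝ node k))
  s₁ k = s k ⊗ ((N ⊝ 1D ⊝ node k) ⊗ (node k ⊕ N ⊕ ι (+ 3)))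
  s₀ k = s k ⊗ ((node k ⊕ N ⊕ ι (+ 2)) ⊗ (node k ⊕ N ⊕ ι (+ 3)))

  shift₃ : ∀ {k} → k ℕ.≤ suc (suc n) → node k ⊕ N ⊕ ι (+ 3) ≡ ι (+ (suc (suc n) ℕ.∸ k)) ⊕ ε
  shift₃ {k} k≤ = node-shift k n 3 _ (trans (cong suc (ℕ.m+[n∸m]≡n k≤)) (ℕ.+-comm 3 n))

  shift₂ : ∀ {k} → k ℕ.≤ suc n → node k ⊕ N ⊕ ι (+ 2) ≡ ι (+ (suc n ℕ.∸ k)) ⊕ ε
  shift₂ {k} k≤ = node-shift k n 2 _ (trans (cong suc (ℕ.m+[n∸m]≡n k≤)) (ℕ.+-comm 2 n))

  s₂≡ : ∀ {k} → k ℕ.≤ suc (suc n) → s₂ k ≡ weight (suc (suc n) ℕ.+ k ℕ.∸ 1) k (suc (suc n) ℕ.∸ k)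
  s₂≡ {k} k≤ = begin
    s₂ k ≡⟨ cong₂ (λ u v → s k ⊗ (u ⊗ v)) (node-reflect′ k n′) (node-reflect k n) ⟩
    s k ⊗ ((ι (+ suc (n′ ℕ.+ k)) ⊝ ε) ⊗ (ι (+ suc (n ℕ.+ k)) ⊝ ε))
      ≡⟨ solve 3 (λ s u v → s :* (u :* v) := s :* u :* v) refl (s k) _ _ ⟩
    s k ⊗ (ι (+ suc (n′ ℕ.+ k)) ⊝ ε) ⊗ (ι (+ suc (n ℕ.+ k)) ⊝ ε)
      ≡⟨ cong (_⊗ (ι (+ suc (n ℕ.+ k)) ⊝ ε)) (weight-suc (n′ ℕ.+ k) k j) ⟩
    weight (n ℕ.+ k) k j ⊗ (ι (+ suc (n ℕ.+ k)) ⊝ ε) ≡⟨ weight-suc (n ℕ.+ k) k j ⟩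
    weight (suc (n ℕ.+ k)) k j ∎
    where j = suc (suc n) ℕ.∸ k

  s₁≡ : ∀ {k} → k ℕ.≤ suc n → s₁ k ≡ weight (n ℕ.+ k) k (suc n ℕ.∸ k)
  s₁≡ {k} k≤ = begin
    s₁ k ≡⟨ cong₂ (λ u v → s k ⊗ (u ⊗ v)) (node-reflect′ k n′) (shift₃ (ℕ.m≤n⇒m≤1+n k≤)) ⟩
    s k ⊗ (u ⊗ (ι (+ (suc (suc n) ℕ.∸ k)) ⊕ ε))
      ≡⟨ cong (λ i → weight (n′ ℕ.+ k) k i ⊗ (u ⊗ (ι (+ i) ⊕ ε))) (suc-∸ k≤) ⟩
    weight (n′ ℕ.+ k) k (suc j) ⊗ (u ⊗ (ι (+ suc j) ⊕ ε))
      ≡⟨ solve 3 (λ s u v → s :* (u :* v) := s :* u :* v) refl (weight (n′ ℕ.+ k) k (suc j)) u (ι (+ suc j) ⊕ ε) ⟩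
    weight (n′ ℕ.+ k) k (suc j) ⊗ u ⊗ (ι (+ suc j) ⊕ ε)
      ≡⟨ cong (_⊗ (ι (+ suc j) ⊕ ε)) (weight-suc (n′ ℕ.+ k) k (suc j)) ⟩
    weight (n ℕ.+ k) k (suc j) ⊗ (ι (+ suc j) ⊕ ε) ≡⟨ weight-pred (n ℕ.+ k) k j ⟩
    weight (n ℕ.+ k) k j ∎
    where
    j = suc n ℕ.∸ k
    u = ι (+ suc (n′ ℕ.+ k)) ⊝ ε

  s₀≡ : ∀ {k} → k ℕ.≤ n → s₀ k ≡ weight (n ℕ.+ k ℕ.∸ 1) k (n ℕ.∸ k)
  s₀≡ {k} k≤ = begin
    s₀ k ≡⟨ cong₂ (λ u v → s k ⊗ (u ⊗ v)) (shift₂ (ℕ.m≤n⇒m≤1+n k≤)) (shift₃ (ℕ.m≤n⇒m≤1+n (ℕ.m≤n⇒m≤1+n k≤))) ⟩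
    s k ⊗ ((ι (+ (suc n ℕ.∸ k)) ⊕ ε) ⊗ (ι (+ (suc (suc n) ℕ.∸ k)) ⊕ ε))
      ≡⟨ cong₂ (λ h i → weight (n′ ℕ.+ k) k i ⊗ ((ι (+ h) ⊕ ε) ⊗ (ι (+ i) ⊕ ε)))
           (suc-∸ k≤) (trans (suc-∸ (ℕ.m≤n⇒m≤1+n k≤)) (cong suc (suc-∸ k≤))) ⟩
    weight (n′ ℕ.+ k) k (suc (suc j)) ⊗ ((ι (+ suc j) ⊕ ε) ⊗ (ι (+ suc (suc j)) ⊕ ε))
      ≡⟨ solve 3 (λ s u v → s :* (u :* v) := s :* v :* u) refl (weight (n′ ℕ.+ k) k (suc (suc j))) (ι (+ suc j) ⊕ ε) (ι (+ suc (suc j)) ⊕ ε) ⟩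
    weight (n′ ℕ.+ k) k (suc (suc j)) ⊗ (ι (+ suc (suc j)) ⊕ ε) ⊗ (ι (+ suc j) ⊕ ε)
      ≡⟨ cong (_⊗ (ι (+ suc j) ⊕ ε)) (weight-pred (n′ ℕ.+ k) k (suc j)) ⟩
    weight (n′ ℕ.+ k) k (suc j) ⊗ (ι (+ suc j) ⊕ ε) ≡⟨ weight-pred (n′ ℕ.+ k) k j ⟩
    weight (n′ ℕ.+ k) k j ∎
    where j = n ℕ.∸ k

  ε-factor : ∀ k c → k ≡ n ℕ.+ c → node k ⊕ N ⊕ ι (+ suc c) ≡ ε
  ε-factor k c refl = trans (node-shift k n (suc c) 0 (trans (ℕ.+-identityʳ (suc k)) (sym (ℕ.+-suc n c))))
    (solve 1 (λ e → con (+ 0) :+ e := e) refl ε)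

  -- F_{n,1} has no pole at -(n+2): there z+n+2 turns into ε. By this and the next two facts all
  -- three sums may run over the common range k ≤ n+2.
  s₀-vanishes₁ : s₀ (suc n) ⊗ s₀ (suc n) ≡ 0D
  s₀-vanishes₁ = ε²-vanishes (s k ⊗ v) (trans (cong (λ u → s k ⊗ (u ⊗ v)) (ε-factor k 1 (ℕ.+-comm 1 n)))
      (solve 3 (λ s e v → s :* (e :* v) := e :* (s :* v)) refl (s k) ε v))
    where
    k = suc n
    v = node k ⊕ N ⊕ ι (+ 3)

  s₀-vanishes₂ : s₀ (suc (suc n)) ⊗ s₀ (suc (suc n)) ≡ 0D
  s₀-vanishes₂ = ε²-vanishes (s k ⊗ v) (trans (cong (λ u → s k ⊗ (v ⊗ u)) (ε-factor k 2 (ℕ.+-comm 2 n)))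
      (solve 3 (λ s e v → s :* (v :* e) := e :* (s :* v)) refl (s k) ε v))
    where
    k = suc (suc n)
    v = node k ⊕ N ⊕ ι (+ 2)

  s₁-vanishes : s₁ (suc (suc n)) ⊗ s₁ (suc (suc n)) ≡ 0D
  s₁-vanishes = ε²-vanishes (s k ⊗ v) (trans (cong (λ u → s k ⊗ (v ⊗ u)) (ε-factor k 2 (ℕ.+-comm 2 n)))
      (solve 3 (λ s e v → s :* (v :* e) := e :* (s :* v)) refl (s k) ε v))
    where
    k = suc (suc n)
    v = N ⊝ 1D ⊝ node k

  -- Polar parts at -(k+1) of G(z) and of G(z+1). The poles of G lie among -1, ..., -(n+2), so `g`
  -- vanishes at k = n+2 and `g′` at k = 0; these are the boundary terms of the summation by parts.
  g g′ : ℕ → Dual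
  g  k = s₁ k ⊗ s₁ k ⊗ evalD (T ρ n) (node k)
  g′ k = (s k ⊗ ((node k ⊕ 1D) ⊗ (node k ⊕ 1D))) ⊗ (s k ⊗ ((node k ⊕ 1D) ⊗ (node k ⊕ 1D)))
         ⊗ evalD (T ρ n) (node k ⊕ 1D)

  g-end : g (suc (suc n)) ≡ 0D
  g-end = trans (cong (_⊗ evalD (T ρ n) (node (suc (suc n)))) s₁-vanishes) (⊗-zeroˡ _)

  g′-start : g′ 0 ≡ 0D
  g′-start = trans (cong (_⊗ evalD (T ρ n) (node 0 ⊕ 1D)) (ε²-vanishes (s 0 ⊗ ε)
      (trans (cong (λ u → s 0 ⊗ (u ⊗ u)) (node-⊕ 0)) (solve 2 (λ s e → s :* (e :* e) := e :* (s :* e)) refl (s 0) ε))))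
    (⊗-zeroˡ _)

  g′-suc : ∀ {k} → k ℕ.≤ suc n → g′ (suc k) ≡ g k
  g′-suc {k} k≤ = trans (cong (λ z → (s (suc k) ⊗ (z ⊗ z)) ⊗ (s (suc k) ⊗ (z ⊗ z)) ⊗ evalD (T ρ n) z) (node-suc k))
    (cong (λ u → u ⊗ u ⊗ evalD (T ρ n) (node k)) (begin
      s (suc k) ⊗ (node k ⊗ node k)         ≡⟨ weight-node (n′ ℕ.+ suc k) k (suc n ℕ.∸ k) ⟩
      weight (n′ ℕ.+ suc k) k (suc n ℕ.∸ k) ≡⟨ cong (λ a → weight a k (suc n ℕ.∸ k)) (ℕ.+-suc n′ k) ⟩
      weight (n ℕ.+ k) k (suc n ℕ.∸ k)      ≡⟨ s₁≡ k≤ ⟨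
      s₁ k                                  ∎))

-- Summation by parts over the poles

Σ<-suc : ∀ m f → Σ< (suc m) f ≡ Σ< m (λ i → f (suc i)) + f 0
Σ<-suc zero    f = ℚ.+-comm (f 0) 0ℚ
Σ<-suc (suc m) f = trans (cong (λ w → f (suc m) + w) (Σ<-suc m f)) (sym (ℚ.+-assoc (f (suc m)) _ (f 0)))

Σ<-+ : ∀ m f g → Σ< m (λ i → f i + g i) ≡ Σ< m f + Σ< m g
Σ<-+ zero    f g = refl
Σ<-+ (suc m) f g = trans (cong (λ w → f m + g m + w) (Σ<-+ m f g))
  (ℚsolve 4 (λ a b x y → a :+′ b :+′ (x :+′ y) :=′ a :+′ x :+′ (b :+′ y)) refl (f m) (g m) (Σ< m f) (Σ< m g))

Σ<-* : ∀ m c f → Σ< m (λ i → c * f i) ≡ c * Σ< m f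
Σ<-* zero    c f = sym (ℚ.*-zeroʳ c)
Σ<-* (suc m) c f = trans (cong (λ w → c * f m + w) (Σ<-* m c f)) (sym (ℚ.*-distribˡ-+ c (f m) (Σ< m f)))

opaque
  unfolding _⊕_

  φ : (α β : ℚ) → Dual → ℚ
  φ α β x = re x * α + im x * β

  φ-def : ∀ α β x → φ α β x ≡ re x * α + im x * β
  φ-def α β x = refl

  φ-⊕ : ∀ α β x y → φ α β (x ⊕ y) ≡ φ α β x + φ α β y
  φ-⊕ α β x y = ℚsolve 6 (λ α β a b c d → (a :+′ c) :*′ α :+′ (b :+′ d) :*′ β
    :=′ a :*′ α :+′ b :*′ β :+′ (c :*′ α :+′ d :*′ β)) refl α β (re x) (im x) (re y) (im y)

  φ-const : ∀ α β c x → φ α β (const c ⊗ x) ≡ c * φ α β x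
  φ-const α β c x = ℚsolve 5 (λ α β c a b → c :*′ a :*′ α :+′ (c :*′ b :+′ # (+ 0) :*′ a) :*′ β
    :=′ c :*′ (a :*′ α :+′ b :*′ β)) refl α β c (re x) (im x)

  φ-⊖ : ∀ α β x → φ α β (⊖ x) ≡ - φ α β x
  φ-⊖ α β x = ℚsolve 4 (λ α β a b → (:-′ a) :*′ α :+′ (:-′ b) :*′ β
    :=′ :-′ (a :*′ α :+′ b :*′ β)) refl α β (re x) (im x)

  φ-0 : ∀ α β → φ α β 0D ≡ 0ℚ
  φ-0 α β = ℚsolve 2 (λ α β → # (+ 0) :*′ α :+′ # (+ 0) :*′ β :=′ # (+ 0)) refl α β

  φ-difference : ∀ α β α′ β′ x → φ α′ β′ x - φ α β x ≡ re x * (α′ - α) + im x * (β′ - β)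
  φ-difference α β α′ β′ x = ℚsolve 6 (λ α β α′ β′ a b → a :*′ α′ :+′ b :*′ β′ :-′ (a :*′ α :+′ b :*′ β)
    :=′ a :*′ (α′ :-′ α) :+′ b :*′ (β′ :-′ β)) refl α β α′ β′ (re x) (im x)

-- As `term` is b + ε a for m ≥ 1, the weights (1, 0) give q and the weights (H^(3), H^(2)/2) give
-- p, so one computation treats both.
Y : (α β : ℕ → ℚ) → ℕ → ℕ → ℚ
Y α β ρ m = Σ< (suc m) (λ k → φ (α k) (β k) (term ρ m k))

suc² : ℕ → ℚ
suc² n = (ofℕ n + 1ℚ) * (ofℕ n + 1ℚ)

const-suc² : ∀ n → const (suc² n) ≡ (ι (+ n) ⊕ 1D) ⊗ (ι (+ n) ⊕ 1D)
const-suc² n = trans (const-⊗ (ofℕ n + 1ℚ) (ofℕ n + 1ℚ)) (cong (λ u → u ⊗ u) (const-⊕ (ofℕ n) 1ℚ))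

suc²≢0 : ∀ n → suc² n ≢ 0ℚ
suc²≢0 n = *-≢0 s≢0 s≢0
  where
  s≢0 : ofℕ n + 1ℚ ≢ 0ℚ
  s≢0 eq = ofℕ-suc≢0 n (trans (ofℕ-+ 1 n) (trans (ℚ.+-comm 1ℚ (ofℕ n)) eq))

-- Lowering the index in the `g′` sum makes both sums run over the same `g k`, evaluated by
-- consecutive functionals; the two end terms are zero by hypothesis.
Σ<-by-parts : ∀ M (ψ : ℕ → Dual → ℚ) (g g′ : ℕ → Dual) →
  (∀ k x y → ψ k (x ⊝ y) ≡ ψ k x - ψ k y) → (∀ k → ψ k 0D ≡ 0ℚ) →
  g′ 0 ≡ 0D → g M ≡ 0D → (∀ k → k ℕ.< M → g′ (suc k) ≡ g k) →
  Σ< (suc M) (λ k → ψ k (g′ k ⊝ g k)) ≡ Σ< M (λ k → ψ (suc k) (g k) - ψ k (g k))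
Σ<-by-parts M ψ g g′ ψ-⊝ ψ-0 g′-start g-end g′-suc = begin
  Σ< (suc M) (λ k → ψ k (g′ k ⊝ g k))           ≡⟨ Σ<-cong (suc M) (λ k _ → ψ-⊝ k (g′ k) (g k)) ⟩
  Σ< (suc M) (λ k → ψ k (g′ k) - ψ k (g k))     ≡⟨ Σ<-+ (suc M) (λ k → ψ k (g′ k)) (λ k → - ψ k (g k)) ⟩
  Σ< (suc M) (λ k → ψ k (g′ k)) + D             ≡⟨ cong (_+ D) (Σ<-suc M (λ k → ψ k (g′ k))) ⟩
  A + ψ 0 (g′ 0) + (- ψ M (g M) + B)            ≡⟨ cong₂ (λ u v → A + u + (- v + B)) (trans (cong (ψ 0) g′-start) (ψ-0 0)) (trans (cong (ψ M) g-end) (ψ-0 M)) ⟩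
  A + 0ℚ + (- 0ℚ + B)                           ≡⟨ cong₂ _+_ (trans (ℚ.+-identityʳ A) (Σ<-cong M (λ k k<M → cong (ψ (suc k)) (g′-suc k k<M)))) (ℚ.+-identityˡ B) ⟩
  Σ< M (λ k → ψ (suc k) (g k)) + B              ≡⟨ Σ<-+ M (λ k → ψ (suc k) (g k)) (λ k → - ψ k (g k)) ⟨
  Σ< M (λ k → ψ (suc k) (g k) - ψ k (g k))      ∎
  where
  A = Σ< M (λ k → ψ (suc k) (g′ (suc k)))
  B = Σ< M (λ k → - ψ k (g k))
  D = Σ< (suc M) (λ k → - ψ k (g k))

combination-+ : ∀ c c₂ c₁ c₀ x₂ y₂ x₁ y₁ x₀ y₀ →
  c * (c₂ * (x₂ + y₂) + c₁ * (x₁ + y₁) + c₀ * (x₀ + y₀)) ≡ c * (c₂ * x₂ + c₁ * x₁ + c₀ * x₀) + c * (c₂ * y₂ + c₁ * y₁ + c₀ * y₀)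
combination-+ = ℚsolve 10 (λ c c₂ c₁ c₀ x₂ y₂ x₁ y₁ x₀ y₀ →
  c :*′ (c₂ :*′ (x₂ :+′ y₂) :+′ c₁ :*′ (x₁ :+′ y₁) :+′ c₀ :*′ (x₀ :+′ y₀)) :=′ c :*′ (c₂ :*′ x₂ :+′ c₁ :*′ x₁ :+′ c₀ :*′ x₀) :+′ c :*′ (c₂ :*′ y₂ :+′ c₁ :*′ y₁ :+′ c₀ :*′ y₀)) refl

Σ<-linear : ∀ M c c₂ c₁ c₀ d {f₂ f₁ f₀ h : ℕ → ℚ} →
  (∀ k → c * (c₂ * f₂ k + c₁ * f₁ k + c₀ * f₀ k) ≡ d * h k) →
  c * (c₂ * Σ< M f₂ + c₁ * Σ< M f₁ + c₀ * Σ< M f₀) ≡ d * Σ< M h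
Σ<-linear zero    c c₂ c₁ c₀ d eq = ℚsolve 5 (λ c c₂ c₁ c₀ d → let o = # (+ 0) in
  c :*′ (c₂ :*′ o :+′ c₁ :*′ o :+′ c₀ :*′ o) :=′ d :*′ o) refl c c₂ c₁ c₀ d
Σ<-linear (suc M) c c₂ c₁ c₀ d {f₂} {f₁} {f₀} {h} eq = begin
  c * (c₂ * (f₂ M + Σ< M f₂) + c₁ * (f₁ M + Σ< M f₁) + c₀ * (f₀ M + Σ< M f₀))
    ≡⟨ combination-+ c c₂ c₁ c₀ (f₂ M) (Σ< M f₂) (f₁ M) (Σ< M f₁) (f₀ M) (Σ< M f₀) ⟩
  c * (c₂ * f₂ M + c₁ * f₁ M + c₀ * f₀ M) + c * (c₂ * Σ< M f₂ + c₁ * Σ< M f₁ + c₀ * Σ< M f₀)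
    ≡⟨ cong₂ _+_ (eq M) (Σ<-linear M c c₂ c₁ c₀ d eq) ⟩
  d * h M + d * Σ< M h
    ≡⟨ ℚ.*-distribˡ-+ d (h M) (Σ< M h) ⟨
  d * (h M + Σ< M h) ∎

recLHS-def : ∀ ρ y n → recLHS ρ y n ≡
  ofℕ ((n ℕ.+ 2) ℕ.^ 4) * Φ ρ n * y (n ℕ.+ 2) + β ρ n * y (n ℕ.+ 1) + ofℕ (n ℕ.^ 4) * Φ ρ (n ℕ.+ 1) * y n
recLHS-def ρ y n = refl

module ByParts (ρ n′ : ℕ) (α β′ : ℕ → ℚ) where
  open Recurrence ρ n′

  ψ : ℕ → Dual → ℚ
  ψ k = φ (α k) (β′ k)

  ψ-⊝ : ∀ k x y → ψ k (x ⊝ y) ≡ ψ k x - ψ k y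
  ψ-⊝ k x y = trans (φ-⊕ (α k) (β′ k) x (⊖ y)) (cong (λ w → ψ k x + w) (φ-⊖ (α k) (β′ k) y))

  kern-zero : ∀ m z {τ} → τ ⊗ τ ≡ 0D → kern ρ m z τ ≡ 0D
  kern-zero m z eq = trans (cong (_⊗ lin ρ m z) eq) (⊗-zeroˡ (lin ρ m z))

  Y-n : Y α β′ ρ n ≡ Σ< (suc (suc (suc n))) (λ k → ψ k (kern ρ n (node k) (s₀ k)))
  Y-n = sym (begin
    f (suc (suc n)) + (f (suc n) + Σ< (suc n) f)
      ≡⟨ cong₂ (λ u v → u + (v + Σ< (suc n) f)) (vanish (suc (suc n)) s₀-vanishes₂) (vanish (suc n) s₀-vanishes₁) ⟩
    0ℚ + (0ℚ + Σ< (suc n) f) ≡⟨ trans (ℚ.+-identityˡ (0ℚ + Σ< (suc n) f)) (ℚ.+-identityˡ (Σ< (suc n) f)) ⟩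
    Σ< (suc n) f ≡⟨ Σ<-cong (suc n) (λ k k< → cong (λ τ → ψ k (kern ρ n (node k) τ)) (s₀≡ (ℕ.≤-pred k<))) ⟩
    Y α β′ ρ n ∎)
    where
    f : ℕ → ℚ
    f k = ψ k (kern ρ n (node k) (s₀ k))
    vanish : ∀ k → s₀ k ⊗ s₀ k ≡ 0D → f k ≡ 0ℚ
    vanish k eq = trans (cong (ψ k) (kern-zero n (node k) eq)) (φ-0 (α k) (β′ k))

  Y-n+1 : Y α β′ ρ (suc n) ≡ Σ< (suc (suc (suc n))) (λ k → ψ k (kern ρ (suc n) (node k) (s₁ k)))
  Y-n+1 = sym (begin
    f (suc (suc n)) + Σ< (suc (suc n)) f
      ≡⟨ cong (_+ Σ< (suc (suc n)) f) (trans (cong (ψ (suc (suc n))) (kern-zero (suc n) (node (suc (suc n))) s₁-vanishes)) (φ-0 (α (suc (suc n))) (β′ (suc (suc n))))) ⟩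
    0ℚ + Σ< (suc (suc n)) f ≡⟨ ℚ.+-identityˡ (Σ< (suc (suc n)) f) ⟩
    Σ< (suc (suc n)) f ≡⟨ Σ<-cong (suc (suc n)) (λ k k< → cong (λ τ → ψ k (kern ρ (suc n) (node k) τ)) (s₁≡ (ℕ.≤-pred k<))) ⟩
    Y α β′ ρ (suc n) ∎)
    where
    f : ℕ → ℚ
    f k = ψ k (kern ρ (suc n) (node k) (s₁ k))

  Y-n+2 : Y α β′ ρ (suc (suc n)) ≡ Σ< (suc (suc (suc n))) (λ k → ψ k (kern ρ (suc (suc n)) (node k) (s₂ k)))
  Y-n+2 = sym (Σ<-cong (suc (suc (suc n))) (λ k k< → cong (λ τ → ψ k (kern ρ (suc (suc n)) (node k) τ)) (s₂≡ (ℕ.≤-pred k<))))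

  x₂ x₁ x₀ : ℕ → Dual
  x₂ k = kern ρ (n ℕ.+ 2) (node k) (s₂ k)
  x₁ k = kern ρ (n ℕ.+ 1) (node k) (s₁ k)
  x₀ k = kern ρ n (node k) (s₀ k)

  linear-combination : ∀ c₂ c₁ c₀ →
    (∀ k → (N ⊕ 1D) ⊗ (N ⊕ 1D) ⊗ (const c₂ ⊗ x₂ k ⊕ const c₁ ⊗ x₁ k ⊕ const c₀ ⊗ x₀ k) ≡ ι (+ 2) ⊗ (g′ k ⊝ g k)) →
    suc² n * (c₂ * Y α β′ ρ (n ℕ.+ 2) + c₁ * Y α β′ ρ (n ℕ.+ 1) + c₀ * Y α β′ ρ n) ≡
    ofℕ 2 * Σ< (suc (suc n)) (λ k → re (g k) * (α (suc k) - α k) + im (g k) * (β′ (suc k) - β′ k))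
  linear-combination c₂ c₁ c₀ tele = begin
    suc² n * (c₂ * Y α β′ ρ (n ℕ.+ 2) + c₁ * Y α β′ ρ (n ℕ.+ 1) + c₀ * Y α β′ ρ n)
      ≡⟨ cong (suc² n *_) (cong₂ _+_ (cong₂ _+_
           (cong (c₂ *_) (subst Y-eq₂ (ℕ.+-comm 2 n) Y-n+2))
           (cong (c₁ *_) (subst Y-eq₁ (ℕ.+-comm 1 n) Y-n+1)))
           (cong (c₀ *_) Y-n)) ⟩
    suc² n * (c₂ * Σ< M f₂ + c₁ * Σ< M f₁ + c₀ * Σ< M f₀)
      ≡⟨ Σ<-linear M (suc² n) c₂ c₁ c₀ (ofℕ 2) {f₂} {f₁} {f₀} {λ k → ψ k (g′ k ⊝ g k)} pointwise ⟩
    ofℕ 2 * Σ< M (λ k → ψ k (g′ k ⊝ g k))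
      ≡⟨ cong (ofℕ 2 *_) (trans (Σ<-by-parts (suc (suc n)) ψ g g′ ψ-⊝ (λ k → φ-0 (α k) (β′ k)) g′-start g-end (λ k k< → g′-suc (ℕ.≤-pred k<)))
           (Σ<-cong (suc (suc n)) (λ k _ → φ-difference (α k) (β′ k) (α (suc k)) (β′ (suc k)) (g k)))) ⟩
    ofℕ 2 * Σ< (suc (suc n)) (λ k → re (g k) * (α (suc k) - α k) + im (g k) * (β′ (suc k) - β′ k)) ∎
    where
    M = suc (suc (suc n))
    Y-eq₂ Y-eq₁ : ℕ → Set
    Y-eq₂ m = Y α β′ ρ m ≡ Σ< M (λ k → ψ k (kern ρ m (node k) (s₂ k)))
    Y-eq₁ m = Y α β′ ρ m ≡ Σ< M (λ k → ψ k (kern ρ m (node k) (s₁ k)))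
    f₂ f₁ f₀ : ℕ → ℚ
    f₂ k = ψ k (x₂ k)
    f₁ k = ψ k (x₁ k)
    f₀ k = ψ k (x₀ k)
    pointwise : ∀ k → suc² n * (c₂ * f₂ k + c₁ * f₁ k + c₀ * f₀ k) ≡ ofℕ 2 * ψ k (g′ k ⊝ g k)
    pointwise k = begin
      suc² n * (c₂ * f₂ k + c₁ * f₁ k + c₀ * f₀ k)
        ≡⟨ cong (suc² n *_) (cong₂ _+_ (cong₂ _+_ (φ-const (α k) (β′ k) c₂ (x₂ k)) (φ-const (α k) (β′ k) c₁ (x₁ k))) (φ-const (α k) (β′ k) c₀ (x₀ k))) ⟨
      suc² n * (ψ k (const c₂ ⊗ x₂ k) + ψ k (const c₁ ⊗ x₁ k) + ψ k (const c₀ ⊗ x₀ k))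
        ≡⟨ cong (suc² n *_) (trans (φ-⊕ (α k) (β′ k) (const c₂ ⊗ x₂ k ⊕ const c₁ ⊗ x₁ k) (const c₀ ⊗ x₀ k)) (cong (_+ ψ k (const c₀ ⊗ x₀ k)) (φ-⊕ (α k) (β′ k) (const c₂ ⊗ x₂ k) (const c₁ ⊗ x₁ k)))) ⟨
      suc² n * ψ k (const c₂ ⊗ x₂ k ⊕ const c₁ ⊗ x₁ k ⊕ const c₀ ⊗ x₀ k)
        ≡⟨ φ-const (α k) (β′ k) (suc² n) (const c₂ ⊗ x₂ k ⊕ const c₁ ⊗ x₁ k ⊕ const c₀ ⊗ x₀ k) ⟨
      ψ k (const (suc² n) ⊗ (const c₂ ⊗ x₂ k ⊕ const c₁ ⊗ x₁ k ⊕ const c₀ ⊗ x₀ k))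
        ≡⟨ cong (λ u → ψ k (u ⊗ (const c₂ ⊗ x₂ k ⊕ const c₁ ⊗ x₁ k ⊕ const c₀ ⊗ x₀ k))) (const-suc² n) ⟩
      ψ k ((N ⊕ 1D) ⊗ (N ⊕ 1D) ⊗ (const c₂ ⊗ x₂ k ⊕ const c₁ ⊗ x₁ k ⊕ const c₀ ⊗ x₀ k))
        ≡⟨ cong (ψ k) (tele k) ⟩
      ψ k (ι (+ 2) ⊗ (g′ k ⊝ g k)) ≡⟨ φ-const (α k) (β′ k) (ofℕ 2) (g′ k ⊝ g k) ⟩
      ofℕ 2 * ψ k (g′ k ⊝ g k) ∎

  -- Only increments of the weights survive. Constant weights thus satisfy the recurrence at once,
  -- and harmonic weights leave a sum over the polar parts of G.
  recurrence-defect : suc² n * recLHS ρ (Y α β′ ρ) n ≡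
    ofℕ 2 * Σ< (suc (suc n)) (λ k → re (g k) * (α (suc k) - α k) + im (g k) * (β′ (suc k) - β′ k))
  recurrence-defect = trans (cong (suc² n *_) (recLHS-def ρ (Y α β′ ρ) n))
    (linear-combination _ _ _ (λ k → telescope ρ n (node k) (s k)))

-- The residue relation for G

fall : ℕ → Dual → Dual
fall n z = prodD n (λ i → const (ofℕ i) ⊕ const (- 1ℚ) ⊗ z)

fall-factor : ∀ x z → const x ⊕ const (- 1ℚ) ⊗ z ≡ const x ⊝ z
fall-factor x z = trans (cong (λ v → const x ⊕ v ⊗ z) (const-⊖ 1ℚ))
  (solve 2 (λ x z → x :+ :- con (+ 1) :* z := x :- z) refl (const x) z)

fall-ε : ∀ n → ∃ λ y → fall (suc n) ε ≡ ε ⊗ y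
fall-ε n = prodD-ε (suc n) 0 (λ i → const (ofℕ i) ⊕ const (- 1ℚ) ⊗ ε) (⊖ 1D) (s≤s z≤n)
  (trans (fall-factor 0ℚ ε) (solve 1 (λ e → con (+ 0) :- e := e :* :- con (+ 1)) refl ε))

fall-node : ∀ n k → fac⁻ k ⊗ fall n (node k) ≡ fac⁻ (n ℕ.+ k)
fall-node n k = begin
  fac⁻ k ⊗ fall n (node k)
    ≡⟨ cong (fac⁻ k ⊗_) (prodD-cong n (λ i → trans (fall-factor (ofℕ i) (node k))
         (trans (node-reflect k i) (cong (λ j → ι (+ suc j) ⊝ ε) (ℕ.+-comm i k))))) ⟩
  fac⁻ k ⊗ prodD n (λ i → ι (+ suc (k ℕ.+ i)) ⊝ ε) ≡⟨ prodD-+ k n (λ i → ι (+ suc i) ⊝ ε) ⟨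
  fac⁻ (k ℕ.+ n) ≡⟨ cong fac⁻ (ℕ.+-comm k n) ⟩
  fac⁻ (n ℕ.+ k) ∎

fac⁻-reverse : ∀ k → prodD k (λ i → ι (+ suc k) ⊝ ι (+ suc i) ⊝ ε) ≡ fac⁻ k
fac⁻-reverse zero    = refl
fac⁻-reverse (suc k) = trans (prodD-suc k (λ i → ι (+ suc (suc k)) ⊝ ι (+ suc i) ⊝ ε))
  (trans (cong₂ _⊗_ first (trans (prodD-cong k rest) (fac⁻-reverse k)))
    (solve 2 (λ u v → u :* v := v :* u) refl (ι (+ suc k) ⊝ ε) (fac⁻ k)))
  where
  first : ι (+ suc (suc k)) ⊝ ι (+ 1) ⊝ ε ≡ ι (+ suc k) ⊝ ε
  first = trans (cong (λ u → u ⊝ ι (+ 1) ⊝ ε) (ι-+ (+ 1) (+ suc k)))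
    (solve 3 (λ o y e → o :+ y :- o :- e := y :- e) refl (ι (+ 1)) (ι (+ suc k)) ε)
  rest : ∀ i → ι (+ suc (suc k)) ⊝ ι (+ suc (suc i)) ⊝ ε ≡ ι (+ suc k) ⊝ ι (+ suc i) ⊝ ε
  rest i = trans (cong₂ (λ u v → u ⊝ v ⊝ ε) (ι-+ (+ 1) (+ suc k)) (ι-+ (+ 1) (+ suc i)))
    (solve 4 (λ o y w e → o :+ y :- (o :+ w) :- e := y :- w :- e) refl (ι (+ 1)) (ι (+ suc k)) (ι (+ suc i)) ε)

cofactor-node : ∀ M k → cofactor M k (node k) ≡ fac⁻ k ⊗ fac⁺ (M ℕ.∸ suc k)
cofactor-node M k = cong₂ _⊗_
  (trans (prodD-cong k below) (fac⁻-reverse k))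
  (prodD-cong (M ℕ.∸ suc k) above)
  where
  below : ∀ i → const (- ofℕ (suc i)) ⊕ const (- 1ℚ) ⊗ node k ≡ ι (+ suc k) ⊝ ι (+ suc i) ⊝ ε
  below i = trans (below-factor (ofℕ (suc i)) (node k)) (trans (cong (λ z → ⊖ (z ⊕ ι (+ suc i))) (node-form k))
    (solve 3 (λ y w e → :- (:- y :+ e :+ w) := y :- w :- e) refl (ι (+ suc k)) (ι (+ suc i)) ε))
  above : ∀ i → const (ofℕ (suc (suc k ℕ.+ i))) ⊕ const 1ℚ ⊗ node k ≡ ι (+ suc i) ⊕ ε
  above i = trans (above-factor (ofℕ (suc (suc k ℕ.+ i))) (node k))
    (trans (cong₂ _⊕_ (node-form k) (trans (cong (λ m → ι (+ m)) (sym (ℕ.+-suc (suc k) i))) (ι-+ (+ suc k) (+ suc i))))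
      (solve 3 (λ y w e → :- y :+ e :+ (y :+ w) := w :+ e) refl (ι (+ suc k)) (ι (+ suc i)) ε))

-- The cofactor at the node cancels `fac⁺ j` and one of the two copies of `fac⁻ k` in the
-- denominator of `weight`; the remaining copy cuts `fac⁻ (n ℕ.+ k)` down to (-z)_n.
cofactor-weight : ∀ n k j → fac⁻ k ⊗ fac⁺ j ⊗ weight (n ℕ.+ k) k j ≡ fall n (node k)
cofactor-weight n k j = begin
  x ⊗ y ⊗ (fac⁻ (n ℕ.+ k) ⊗ (inv x ⊗ inv x) ⊗ inv y)  ≡⟨ cong (λ f → x ⊗ y ⊗ (f ⊗ (inv x ⊗ inv x) ⊗ inv y)) (fall-node n k) ⟨
  x ⊗ y ⊗ (x ⊗ w ⊗ (inv x ⊗ inv x) ⊗ inv y)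
    ≡⟨ solve 5 (λ x y w i j → x :* y :* (x :* w :* (i :* i) :* j) := x :* i :* (x :* i) :* (y :* j) :* w) refl x y w (inv x) (inv y) ⟩
  x ⊗ inv x ⊗ (x ⊗ inv x) ⊗ (y ⊗ inv y) ⊗ w ≡⟨ cong₂ (λ u v → u ⊗ u ⊗ v ⊗ w) (⊗-inv (fac⁻≢0 k)) (⊗-inv (fac⁺≢0 j)) ⟩
  1D ⊗ 1D ⊗ 1D ⊗ w ≡⟨ solve 1 (λ w → con (+ 1) :* con (+ 1) :* con (+ 1) :* w := w) refl w ⟩
  w ∎
  where
  x = fac⁻ k
  y = fac⁺ j
  w = fall n (node k)

module _ (ρ n′ : ℕ) where
  open Recurrence ρ n′

  private
    M : ℕ
    M = suc (suc n)

    F : Dual → Dual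
    F z = fall n z ⊗ (fall n z ⊗ evalD (T ρ n) z)

    -- Two factors (-z)_n and the five coefficients of T give length 2n+5 = 2(n+2)+1, precisely what
    -- `residue-sum` admits for n+2 double poles.
    F-deg : Deg (suc (M ℕ.+ M)) F
    F-deg = deg-mono (ℕ.≤-reflexive degree)
      (deg-prod n ofℕ (λ _ → - 1ℚ) (deg-prod n ofℕ (λ _ → - 1ℚ) (T ρ n , ℕ.≤-refl , λ z → refl)))
      where
      degree : n ℕ.+ (n ℕ.+ 5) ≡ suc (M ℕ.+ M)
      degree = NS.solve 1 (λ n → n NS.:+ (n NS.:+ NS.con 5) NS.:= NS.con 1 NS.:+ (NS.con 2 NS.:+ n NS.:+ (NS.con 2 NS.:+ n))) refl n

    F-ε : F ε ≡ 0D
    F-ε = begin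
      f ⊗ (f ⊗ t)  ≡⟨ solve 2 (λ f t → f :* (f :* t) := f :* f :* t) refl f t ⟩
      f ⊗ f ⊗ t    ≡⟨ cong (_⊗ t) (ε²-vanishes (proj₁ f-ε) (proj₂ f-ε)) ⟩
      0D ⊗ t       ≡⟨ ⊗-zeroˡ t ⟩
      0D           ∎
      where
      f = fall n ε
      t = evalD (T ρ n) ε
      f-ε = fall-ε n′

    F-node : ∀ k → k ℕ.< M → F (node k) ≡ cofactor M k (node k) ⊗ cofactor M k (node k) ⊗ g k
    F-node k k<M = sym (begin
      cofactor M k (node k) ⊗ cofactor M k (node k) ⊗ (s₁ k ⊗ s₁ k ⊗ t)
        ≡⟨ cong₂ (λ c w → c ⊗ c ⊗ (w ⊗ w ⊗ t)) (cofactor-node M k) (s₁≡ (ℕ.≤-pred k<M)) ⟩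
      cf ⊗ cf ⊗ (w ⊗ w ⊗ t)
        ≡⟨ solve 3 (λ c w t → c :* c :* (w :* w :* t) := c :* w :* (c :* w :* t)) refl cf w t ⟩
      cf ⊗ w ⊗ (cf ⊗ w ⊗ t)
        ≡⟨ cong (λ u → u ⊗ (u ⊗ t)) (cofactor-weight n k j) ⟩
      F (node k) ∎)
      where
      j = suc n ℕ.∸ k
      cf = fac⁻ k ⊗ fac⁺ j
      w = weight (n ℕ.+ k) k j
      t = evalD (T ρ n) (node k)

  g-residue-sum : Σ< (suc (suc n)) (λ k → let i = 1ℚ ÷' ofℕ (suc k) in re (g k) * (ofℕ 2 * (i * i * i)) + im (g k) * (i * i)) ≡ 0ℚ
  g-residue-sum = residue-sum M F g F-deg F-ε F-node

*-cancel-zero : ∀ {x y} → x ≢ 0ℚ → x * y ≡ 0ℚ → y ≡ 0ℚ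
*-cancel-zero {x} {y} x≢0 eq = *-cancelʳ-≢0 x≢0 (trans (ℚ.*-comm y x) (trans eq (sym (ℚ.*-zeroˡ x))))

Y-const-recurrence : ∀ ρ n′ → SatisfiesRec ρ (Y (λ _ → 1ℚ) (λ _ → 0ℚ) ρ) (suc n′)
Y-const-recurrence ρ n′ = *-cancel-zero (suc²≢0 (suc n′)) (trans (ByParts.recurrence-defect ρ n′ (λ _ → 1ℚ) (λ _ → 0ℚ))
  (trans (cong (ofℕ 2 *_) (vanish (suc (suc (suc n′))))) (ℚ.*-zeroʳ (ofℕ 2))))
  where
  open Recurrence ρ n′
  vanish : ∀ m → Σ< m (λ k → re (g k) * (1ℚ - 1ℚ) + im (g k) * (0ℚ - 0ℚ)) ≡ 0ℚ
  vanish zero    = refl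
  vanish (suc m) = trans (cong₂ _+_ (cong₂ _+_ (ℚ.*-zeroʳ (re (g m))) (ℚ.*-zeroʳ (im (g m)))) (vanish m)) refl

-- The factor 2 in front of the defect turns the increments 1/(k+1)³ and 1/(2(k+1)²) into the
-- coefficients 2/(k+1)³ and 1/(k+1)² of the residue relation.
Y-harmonic-recurrence : ∀ ρ n′ (α β′ : ℕ → ℚ) →
  (∀ k → let i = 1ℚ ÷' ofℕ (suc k) in α (suc k) - α k ≡ i * i * i) →
  (∀ k → let i = 1ℚ ÷' ofℕ (suc k) in β′ (suc k) - β′ k ≡ ½ * (i * i)) →
  SatisfiesRec ρ (Y α β′ ρ) (suc n′)
Y-harmonic-recurrence ρ n′ α β′ Δα Δβ = *-cancel-zero (suc²≢0 (suc n′)) (begin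
  suc² (suc n′) * recLHS ρ (Y α β′ ρ) (suc n′)    ≡⟨ ByParts.recurrence-defect ρ n′ α β′ ⟩
  ofℕ 2 * Σ< M (λ k → re (g k) * (α (suc k) - α k) + im (g k) * (β′ (suc k) - β′ k)) ≡⟨ double M ⟩
  Σ< M t                                            ≡⟨ g-residue-sum ρ n′ ⟩
  0ℚ                                                ∎)
  where
  open Recurrence ρ n′
  M = suc (suc (suc n′))
  i : ℕ → ℚ
  i k = 1ℚ ÷' ofℕ (suc k)
  t : ℕ → ℚ
  t k = re (g k) * (ofℕ 2 * (i k * i k * i k)) + im (g k) * (i k * i k)
  halve : ∀ a b x y → ofℕ 2 * (a * x + b * (½ * y)) ≡ a * (ofℕ 2 * x) + b * y
  halve a b x y = trans (ℚsolve 5 (λ h a b x y → # (+ 2) :*′ (a :*′ x :+′ b :*′ (h :*′ y))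
      :=′ a :*′ (# (+ 2) :*′ x) :+′ (# (+ 2) :*′ h) :*′ (b :*′ y)) refl ½ a b x y)
    (cong (λ w → a * (ofℕ 2 * x) + w) (ℚ.*-identityˡ (b * y)))
  double : ∀ m → ofℕ 2 * Σ< m (λ k → re (g k) * (α (suc k) - α k) + im (g k) * (β′ (suc k) - β′ k)) ≡ Σ< m t
  double m = trans (sym (Σ<-* m (ofℕ 2) _)) (Σ<-cong m (λ k _ →
    trans (cong₂ (λ u v → ofℕ 2 * (re (g k) * u + im (g k) * v)) (Δα k) (Δβ k))
      (halve (re (g k)) (im (g k)) (i k * i k * i k) (i k * i k))))

-- The sums and harmonic numbers of the statement

loop : ∀ (f : ℕ → ℚ) (h : ℕ → ℚ) → h 0 ≡ 0ℚ → (∀ m → h (suc m) ≡ f m + h m) → ∀ m → h m ≡ Σ< m f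
loop f h h0 hs zero    = h0
loop f h h0 hs (suc m) = trans (hs m) (cong (λ w → f m + w) (loop f h h0 hs m))

-- The loop in the definition of sumFromTo has no name; once its bound is abstracted to a variable,
-- unification finds it for the placeholder.
mutual
  sumFromTo-loop : ℕ → ℕ → (ℕ → ℚ) → ℕ → ℚ
  sumFromTo-loop = _

  sumFromTo-Σ< : ∀ a b f → sumFromTo a b f ≡ Σ< (suc b ℕ.∸ a) (λ i → f (a ℕ.+ i))
  sumFromTo-Σ< a b f with suc b ℕ.∸ a
  ... | m = loop (λ i → f (a ℕ.+ i)) (sumFromTo-loop a b f) refl (λ _ → refl) m

H^-suc : ∀ r k → H^ r (suc k) ≡ (1ℚ ÷' (ofℕ (suc k) ^' r)) + H^ r k
H^-suc r k = trans (sumFromTo-Σ< 1 (suc k) h) (cong (λ w → h (suc k) + w) (sym (sumFromTo-Σ< 1 k h)))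
  where
  h : ℕ → ℚ
  h j = 1ℚ ÷' (ofℕ j ^' r)

-- The coefficients b and a

-- r (1 + ε h): h is the logarithmic derivative
lg : ℚ → ℚ → Dual
lg r h = r +ε r * h

opaque
  unfolding _⊕_

  lg-⊗ : ∀ r h r′ h′ → lg r h ⊗ lg r′ h′ ≡ lg (r * r′) (h + h′)
  lg-⊗ r h r′ h′ = cong (r * r′ +ε_) (ℚsolve 4 (λ r h r′ h′ → r :*′ (r′ :*′ h′) :+′ r :*′ h :*′ r′ :=′ r :*′ r′ :*′ (h :+′ h′)) refl r h r′ h′)

  ι⊝ε : ∀ k i → i * ofℕ k ≡ 1ℚ → ι (+ k) ⊝ ε ≡ lg (ofℕ k) (- i)
  ι⊝ε k i eq = cong₂ _+ε_ (ℚ.+-identityʳ (ofℕ k))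
    (trans (cong -_ (sym eq)) (trans (ℚ.neg-distribˡ-* i (ofℕ k)) (ℚ.*-comm (- i) (ofℕ k))))

  ι⊕ε : ∀ k i → i * ofℕ k ≡ 1ℚ → ι (+ k) ⊕ ε ≡ lg (ofℕ k) i
  ι⊕ε k i eq = cong₂ _+ε_ (ℚ.+-identityʳ (ofℕ k)) (trans (sym eq) (ℚ.*-comm i (ofℕ k)))

  node⊕const : ∀ k x y i → - ofℕ (suc k) + x ≡ - y → i * y ≡ 1ℚ → node k ⊕ const x ≡ lg (- y) (- i)
  node⊕const k x y i eq iy≡1 = cong₂ _+ε_ eq
    (trans (sym iy≡1) (ℚsolve 2 (λ i y → i :*′ y :=′ (:-′ y) :*′ (:-′ i)) refl i y))

inv-lg : ∀ r h → r ≢ 0ℚ → inv (lg r h) ≡ lg (1ℚ ÷' r) (- h)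
inv-lg r h r≢0 = cong ((1ℚ ÷' r) +ε_) (aux (1ℚ ÷' r) (÷'-*-cancel 1ℚ r≢0))
  where
  aux : ∀ i → i * r ≡ 1ℚ → - (r * h * (i * i)) ≡ i * - h
  aux i eq = trans (ℚsolve 3 (λ r h i → :-′ (r :*′ h :*′ (i :*′ i)) :=′ i :*′ r :*′ (i :*′ (:-′ h))) refl r h i)
    (trans (cong (_* (i * - h)) eq) (ℚ.*-identityˡ (i * - h)))

ofℕ≢0 : ∀ k .{{_ : ℕ.NonZero k}} → ofℕ k ≢ 0ℚ
ofℕ≢0 (suc k) = ofℕ-suc≢0 k

!≢0 : ∀ m → ofℕ (m !) ≢ 0ℚ
!≢0 m = ofℕ≢0 (m !) {{m ℕ.!≢0}}

H-suc : ∀ k → H (suc k) ≡ (1ℚ ÷' ofℕ (suc k)) + H k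
H-suc k = trans (H^-suc 1 k) (cong (λ y → (1ℚ ÷' y) + H k) (ℚ.*-identityʳ (ofℕ (suc k))))

-- The logarithmic derivative of a product of factors i - ε is minus the sum of the 1/i; this is the
-- source of the harmonic numbers in a.
fac⁻-lg : ∀ m → fac⁻ m ≡ lg (ofℕ (m !)) (- H m)
fac⁻-lg zero    = refl
fac⁻-lg (suc m) = begin
  fac⁻ m ⊗ (ι (+ suc m) ⊝ ε)                          ≡⟨ cong₂ _⊗_ (fac⁻-lg m) (ι⊝ε (suc m) i (÷'-*-cancel 1ℚ (ofℕ-suc≢0 m))) ⟩
  lg (ofℕ (m !)) (- H m) ⊗ lg (ofℕ (suc m)) (- i)     ≡⟨ lg-⊗ (ofℕ (m !)) (- H m) (ofℕ (suc m)) (- i) ⟩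
  lg (ofℕ (m !) * ofℕ (suc m)) (- H m + - i)          ≡⟨ cong₂ lg (trans (ℚ.*-comm (ofℕ (m !)) (ofℕ (suc m))) (sym (ofℕ-* (suc m) (m !))))
                                                           (trans (ℚsolve 2 (λ h i → :-′ h :+′ :-′ i :=′ :-′ (i :+′ h)) refl (H m) i) (cong -_ (sym (H-suc m)))) ⟩
  lg (ofℕ (suc m !)) (- H (suc m))                    ∎
  where i = 1ℚ ÷' ofℕ (suc m)

fac⁺-lg : ∀ m → fac⁺ m ≡ lg (ofℕ (m !)) (H m)
fac⁺-lg zero    = refl
fac⁺-lg (suc m) = begin
  fac⁺ m ⊗ (ι (+ suc m) ⊕ ε)                          ≡⟨ cong₂ _⊗_ (fac⁺-lg m) (ι⊕ε (suc m) i (÷'-*-cancel 1ℚ (ofℕ-suc≢0 m))) ⟩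
  lg (ofℕ (m !)) (H m) ⊗ lg (ofℕ (suc m)) i           ≡⟨ lg-⊗ (ofℕ (m !)) (H m) (ofℕ (suc m)) i ⟩
  lg (ofℕ (m !) * ofℕ (suc m)) (H m + i)              ≡⟨ cong₂ lg (trans (ℚ.*-comm (ofℕ (m !)) (ofℕ (suc m))) (sym (ofℕ-* (suc m) (m !))))
                                                           (trans (ℚ.+-comm (H m) i) (sym (H-suc m))) ⟩
  lg (ofℕ (suc m !)) (H (suc m))                      ∎
  where i = 1ℚ ÷' ofℕ (suc m)

ratio : ℕ → ℕ → ℕ → ℚ
ratio a k j = ofℕ (a !) * ((1ℚ ÷' ofℕ (k !)) * (1ℚ ÷' ofℕ (k !))) * (1ℚ ÷' ofℕ (j !))

slope : ℕ → ℕ → ℕ → ℚ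
slope a k j = - H a + (- - H k + - - H k) + - H j

weight-lg : ∀ a k j → weight a k j ≡ lg (ratio a k j) (slope a k j)
weight-lg a k j = begin
  fac⁻ a ⊗ (inv (fac⁻ k) ⊗ inv (fac⁻ k)) ⊗ inv (fac⁺ j)
    ≡⟨ cong₂ (λ u v → u ⊗ (v ⊗ v) ⊗ inv (fac⁺ j)) (fac⁻-lg a) (trans (cong inv (fac⁻-lg k)) (inv-lg (ofℕ (k !)) (- H k) (!≢0 k))) ⟩
  lg A (- H a) ⊗ (lg K (- - H k) ⊗ lg K (- - H k)) ⊗ inv (fac⁺ j)
    ≡⟨ cong₂ _⊗_ (trans (cong (lg A (- H a) ⊗_) (lg-⊗ K (- - H k) K (- - H k))) (lg-⊗ A (- H a) (K * K) (- - H k + - - H k)))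
         (trans (cong inv (fac⁺-lg j)) (inv-lg (ofℕ (j !)) (H j) (!≢0 j))) ⟩
  lg (A * (K * K)) (- H a + (- - H k + - - H k)) ⊗ lg J (- H j)
    ≡⟨ lg-⊗ (A * (K * K)) (- H a + (- - H k + - - H k)) J (- H j) ⟩
  lg (ratio a k j) (slope a k j) ∎
  where
  A = ofℕ (a !)
  K = 1ℚ ÷' ofℕ (k !)
  J = 1ℚ ÷' ofℕ (j !)

choose-! : ∀ {n k} → k ℕ.≤ n → (n C k) ℕ.* (k ! ℕ.* (n ℕ.∸ k) !) ≡ n !
choose-! {n} {k} k≤n = trans (cong (ℕ._* (k ! ℕ.* (n ℕ.∸ k) !)) (nCk≡n!/k![n-k]! k≤n))
  (m/n*n≡m {{k ℕ.!* (n ℕ.∸ k) !≢0}} (k![n∸k]!∣n! k≤n))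

choose-product : ∀ m k → k ℕ.≤ m → ((m ℕ.+ k) C k) ℕ.* (m C k) ℕ.* (k ! ℕ.* k ! ℕ.* (m ℕ.∸ k) !) ≡ (m ℕ.+ k) !
choose-product m k k≤m = begin
  x ℕ.* y ℕ.* (f ℕ.* f ℕ.* j)   ≡⟨ NS.solve 4 (λ x y f j → x NS.:* y NS.:* (f NS.:* f NS.:* j) NS.:= x NS.:* (f NS.:* (y NS.:* (f NS.:* j)))) refl x y f j ⟩
  x ℕ.* (f ℕ.* (y ℕ.* (f ℕ.* j))) ≡⟨ cong (λ w → x ℕ.* (f ℕ.* w)) (trans (choose-! k≤m) (cong _! (sym (ℕ.m+n∸n≡m m k)))) ⟩
  x ℕ.* (f ℕ.* (m ℕ.+ k ℕ.∸ k) !) ≡⟨ choose-! (ℕ.m≤n+m k m) ⟩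
  (m ℕ.+ k) ! ∎
  where
  x = (m ℕ.+ k) C k
  y = m C k
  f = k !
  j = (m ℕ.∸ k) !

ratio-choose : ∀ m′ k → k ℕ.≤ suc m′ →
  ratio (m′ ℕ.+ k) k (suc m′ ℕ.∸ k) * ofℕ (suc m′ ℕ.+ k) ≡ ofℕ (((suc m′ ℕ.+ k) C k) ℕ.* (suc m′ C k))
ratio-choose m′ k k≤m = cancel K J (÷'-*-cancel 1ℚ (!≢0 k)) (÷'-*-cancel 1ℚ (!≢0 j))
  where
  j = suc m′ ℕ.∸ k
  K = 1ℚ ÷' ofℕ (k !)
  J = 1ℚ ÷' ofℕ (j !)
  A = ofℕ ((m′ ℕ.+ k) !)
  y = ofℕ (suc m′ ℕ.+ k)
  cc = ofℕ (((suc m′ ℕ.+ k) C k) ℕ.* (suc m′ C k))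
  key : A * y ≡ cc * (ofℕ (k !) * ofℕ (k !) * ofℕ (j !))
  key = begin
    A * y                                                ≡⟨ ℚ.*-comm A y ⟩
    y * A                                                ≡⟨ ofℕ-* (suc m′ ℕ.+ k) ((m′ ℕ.+ k) !) ⟨
    ofℕ ((suc m′ ℕ.+ k) !)                               ≡⟨ cong ofℕ (choose-product (suc m′) k k≤m) ⟨
    ofℕ (((suc m′ ℕ.+ k) C k) ℕ.* (suc m′ C k) ℕ.* (k ! ℕ.* k ! ℕ.* j !)) ≡⟨ ofℕ-* (((suc m′ ℕ.+ k) C k) ℕ.* (suc m′ C k)) (k ! ℕ.* k ! ℕ.* j !) ⟩
    cc * ofℕ (k ! ℕ.* k ! ℕ.* j !)                       ≡⟨ cong (cc *_) (trans (ofℕ-* (k ! ℕ.* k !) (j !)) (cong (_* ofℕ (j !)) (ofℕ-* (k !) (k !)))) ⟩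
    cc * (ofℕ (k !) * ofℕ (k !) * ofℕ (j !))             ∎
  cancel : ∀ K J → K * ofℕ (k !) ≡ 1ℚ → J * ofℕ (j !) ≡ 1ℚ → A * (K * K) * J * y ≡ cc
  cancel K J kk jj = begin
    A * (K * K) * J * y    ≡⟨ ℚsolve 4 (λ a k j y → a :*′ (k :*′ k) :*′ j :*′ y :=′ a :*′ y :*′ (k :*′ k :*′ j)) refl A K J y ⟩
    A * y * (K * K * J)    ≡⟨ cong (_* (K * K * J)) key ⟩
    cc * (ofℕ (k !) * ofℕ (k !) * ofℕ (j !)) * (K * K * J)
      ≡⟨ ℚsolve 5 (λ x f g k j → x :*′ (f :*′ f :*′ g) :*′ (k :*′ k :*′ j) :=′ x :*′ (k :*′ f :*′ (k :*′ f) :*′ (j :*′ g))) refl cc (ofℕ (k !)) (ofℕ (j !)) K J ⟩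
    cc * (K * ofℕ (k !) * (K * ofℕ (k !)) * (J * ofℕ (j !))) ≡⟨ cong₂ (λ u v → cc * (u * u * v)) kk jj ⟩
    cc * 1ℚ                ≡⟨ ℚ.*-identityʳ cc ⟩
    cc                     ∎

÷'-* : ∀ x {y} → y ≢ 0ℚ → x ÷' y ≡ x * (1ℚ ÷' y)
÷'-* x {y} y≢0 = ÷'-unique y≢0 (trans (ℚ.*-assoc x (1ℚ ÷' y) y)
  (trans (cong (x *_) (÷'-*-cancel 1ℚ y≢0)) (ℚ.*-identityʳ x)))

module Coefficients (ρ m′ k : ℕ) (k≤m : k ℕ.≤ suc m′) where

  m j : ℕ
  m = suc m′
  j = m ℕ.∸ k

  y₁ y₂ i₁ i₂ w h : ℚ
  y₁ = ofℕ (m ℕ.+ k)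
  y₂ = ofℕ (k ℕ.+ ρ ℕ.* m ℕ.+ 1)
  i₁ = 1ℚ ÷' y₁
  i₂ = 1ℚ ÷' y₂
  w  = ratio (m′ ℕ.+ k) k j
  h  = slope (m′ ℕ.+ k) k j

  y₁≢0 : y₁ ≢ 0ℚ
  y₁≢0 = ofℕ-suc≢0 (m′ ℕ.+ k)

  y₂-suc : y₂ ≡ ofℕ (suc (k ℕ.+ ρ ℕ.* m))
  y₂-suc = cong ofℕ (ℕ.+-comm (k ℕ.+ ρ ℕ.* m) 1)

  y₂≢0 : y₂ ≢ 0ℚ
  y₂≢0 eq = ofℕ-suc≢0 (k ℕ.+ ρ ℕ.* m) (trans (sym y₂-suc) eq)

  first : - ofℕ (suc k) + (ofℕ 1 - ofℕ m) ≡ - y₁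
  first = trans (cong (λ u → - u + (ofℕ 1 - ofℕ m)) (ofℕ-+ 1 k))
    (trans (ℚsolve 2 (λ k m → :-′ (# (+ 1) :+′ k) :+′ (# (+ 1) :-′ m) :=′ :-′ (m :+′ k)) refl (ofℕ k) (ofℕ m))
      (cong -_ (sym (ofℕ-+ m k))))

  second : - ofℕ (suc k) + - ofℕ (ρ ℕ.* m) ≡ - y₂
  second = trans (sym (ℚ.neg-distrib-+ (ofℕ (suc k)) (ofℕ (ρ ℕ.* m))))
    (cong -_ (trans (sym (ofℕ-+ (suc k) (ρ ℕ.* m))) (sym y₂-suc)))

  term-lg : term ρ m k ≡ lg (w * w * (- y₁ * - y₂)) (h + h + (- i₁ + - i₂))
  term-lg = begin
    weight (m′ ℕ.+ k) k j ⊗ weight (m′ ℕ.+ k) k j ⊗ ((node k ⊕ const (ofℕ 1 - ofℕ m)) ⊗ (node k ⊕ const (- ofℕ (ρ ℕ.* m))))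
      ≡⟨ cong₂ _⊗_ (cong (λ u → u ⊗ u) (weight-lg (m′ ℕ.+ k) k j))
           (cong₂ _⊗_ (node⊕const k (ofℕ 1 - ofℕ m) y₁ i₁ first (÷'-*-cancel 1ℚ y₁≢0))
                      (node⊕const k (- ofℕ (ρ ℕ.* m)) y₂ i₂ second (÷'-*-cancel 1ℚ y₂≢0))) ⟩
    lg w h ⊗ lg w h ⊗ (lg (- y₁) (- i₁) ⊗ lg (- y₂) (- i₂))
      ≡⟨ cong₂ _⊗_ (lg-⊗ w h w h) (lg-⊗ (- y₁) (- i₁) (- y₂) (- i₂)) ⟩
    lg (w * w) (h + h) ⊗ lg (- y₁ * - y₂) (- i₁ + - i₂)
      ≡⟨ lg-⊗ (w * w) (h + h) (- y₁ * - y₂) (- i₁ + - i₂) ⟩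
    lg (w * w * (- y₁ * - y₂)) (h + h + (- i₁ + - i₂)) ∎

  -- The square of w, a product of two binomials over m+k, carries (m+k)² in its denominator. The
  -- linear factor z-m+1 equals -(m+k) at the pole and restores one power, which leaves the single
  -- division by m+k in b.
  b-ratio : w * w * (- y₁ * - y₂) ≡ b ρ k m
  b-ratio = sym (trans (cong₂ _*_ squares (÷'-* y₂ y₁≢0)) (regroup w y₁ y₂ i₁ (÷'-*-cancel 1ℚ y₁≢0)))
    where
    x = (m ℕ.+ k) C k
    y = m C k
    squares : ofℕ (x ℕ.^ 2 ℕ.* y ℕ.^ 2) ≡ (w * y₁) * (w * y₁)
    squares = trans (cong ofℕ (NS.solve 2 (λ x y → x NS.:^ 2 NS.:* y NS.:^ 2 NS.:= x NS.:* y NS.:* (x NS.:* y)) refl x y))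
      (trans (ofℕ-* (x ℕ.* y) (x ℕ.* y)) (cong (λ u → u * u) (sym (ratio-choose m′ k k≤m))))
    regroup : ∀ w y₁ y₂ i₁ → i₁ * y₁ ≡ 1ℚ → (w * y₁) * (w * y₁) * (y₂ * i₁) ≡ w * w * (- y₁ * - y₂)
    regroup w y₁ y₂ i₁ eq = trans (ℚsolve 4 (λ w y z i → w :*′ y :*′ (w :*′ y) :*′ (z :*′ i) :=′ (i :*′ y) :*′ (w :*′ w :*′ (:-′ y :*′ :-′ z))) refl w y₁ y₂ i₁)
      (trans (cong (_* (w * w * (- y₁ * - y₂))) eq) (ℚ.*-identityˡ (w * w * (- y₁ * - y₂))))

  -- The last fraction in a is the mean of 1/(m+k) and 1/(k+ρm+1), which up to sign are the
  -- logarithmic derivatives of the two linear factors at the pole.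
  mean : ofℕ ((ρ ℕ.+ 1) ℕ.* m ℕ.+ 2 ℕ.* k ℕ.+ 1) ÷' ofℕ (2 ℕ.* (k ℕ.+ ρ ℕ.* m ℕ.+ 1) ℕ.* (m ℕ.+ k)) ≡ ½ * (i₁ + i₂)
  mean = ÷'-unique (λ eq → *-≢0 (*-≢0 (ofℕ-suc≢0 1) y₂≢0) y₁≢0 (trans (sym denominator) eq))
    (trans (cong (½ * (i₁ + i₂) *_) denominator)
      (trans (regroup y₁ y₂ i₁ i₂ (÷'-*-cancel 1ℚ y₁≢0) (÷'-*-cancel 1ℚ y₂≢0)) (sym numerator)))
    where
    denominator : ofℕ (2 ℕ.* (k ℕ.+ ρ ℕ.* m ℕ.+ 1) ℕ.* (m ℕ.+ k)) ≡ ofℕ 2 * y₂ * y₁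
    denominator = trans (ofℕ-* (2 ℕ.* (k ℕ.+ ρ ℕ.* m ℕ.+ 1)) (m ℕ.+ k)) (cong (_* y₁) (ofℕ-* 2 (k ℕ.+ ρ ℕ.* m ℕ.+ 1)))
    numerator : ofℕ ((ρ ℕ.+ 1) ℕ.* m ℕ.+ 2 ℕ.* k ℕ.+ 1) ≡ y₁ + y₂
    numerator = trans (cong ofℕ (NS.solve 3 (λ r m k → (r NS.:+ NS.con 1) NS.:* m NS.:+ NS.con 2 NS.:* k NS.:+ NS.con 1
        NS.:= m NS.:+ k NS.:+ (k NS.:+ r NS.:* m NS.:+ NS.con 1)) refl ρ m k))
      (ofℕ-+ (m ℕ.+ k) (k ℕ.+ ρ ℕ.* m ℕ.+ 1))
    regroup : ∀ y₁ y₂ i₁ i₂ → i₁ * y₁ ≡ 1ℚ → i₂ * y₂ ≡ 1ℚ → ½ * (i₁ + i₂) * (ofℕ 2 * y₂ * y₁) ≡ y₁ + y₂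
    regroup y₁ y₂ i₁ i₂ e₁ e₂ = trans
      (ℚsolve 5 (λ h y z i j → h :*′ (i :+′ j) :*′ (# (+ 2) :*′ z :*′ y) :=′ h :*′ # (+ 2) :*′ ((j :*′ z) :*′ y :+′ (i :*′ y) :*′ z)) refl ½ y₁ y₂ i₁ i₂)
      (trans (cong₂ (λ u v → ½ * ofℕ 2 * (u * y₁ + v * y₂)) e₂ e₁)
        (trans (ℚ.*-identityˡ (1ℚ * y₁ + 1ℚ * y₂)) (cong₂ _+_ (ℚ.*-identityˡ y₁) (ℚ.*-identityˡ y₂))))

  a-slope : b ρ k m * (h + h + (- i₁ + - i₂)) ≡ a ρ k m
  a-slope = sym (trans (cong (λ x → ofℕ 2 * b ρ k m * (ofℕ 2 * H k - H (m′ ℕ.+ k) - H j - x)) mean)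
    (regroup (b ρ k m) (H k) (H (m′ ℕ.+ k)) (H j) i₁ i₂))
    where
    regroup : ∀ b hk ha hj i₁ i₂ → ofℕ 2 * b * (ofℕ 2 * hk - ha - hj - ½ * (i₁ + i₂))
      ≡ b * ((- ha + (- - hk + - - hk) + - hj) + (- ha + (- - hk + - - hk) + - hj) + (- i₁ + - i₂))
    regroup b hk ha hj i₁ i₂ = trans
      (ℚsolve 7 (λ h b k a j i l → # (+ 2) :*′ b :*′ (# (+ 2) :*′ k :-′ a :-′ j :-′ h :*′ (i :+′ l))
         :=′ b :*′ (# (+ 2) :*′ (# (+ 2) :*′ k :-′ a :-′ j) :-′ (# (+ 2) :*′ h) :*′ (i :+′ l))) refl ½ b hk ha hj i₁ i₂)
      (ℚsolve 6 (λ b k a j i l → b :*′ (# (+ 2) :*′ (# (+ 2) :*′ k :-′ a :-′ j) :-′ # (+ 1) :*′ (i :+′ l))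
         :=′ b :*′ ((:-′ a :+′ (:-′ :-′ k :+′ :-′ :-′ k) :+′ :-′ j) :+′ (:-′ a :+′ (:-′ :-′ k :+′ :-′ :-′ k) :+′ :-′ j) :+′ (:-′ i :+′ :-′ l))) refl b hk ha hj i₁ i₂)

  term-coefficients : term ρ m k ≡ b ρ k m +ε a ρ k m
  term-coefficients = trans term-lg (cong₂ _+ε_ b-ratio (trans (cong (_* (h + h + (- i₁ + - i₂))) b-ratio) a-slope))

open Coefficients using (term-coefficients)

-- The recurrences for q and p

q-Y : ∀ ρ m′ → Y (λ _ → 1ℚ) (λ _ → 0ℚ) ρ (suc m′) ≡ q ρ (suc m′)
q-Y ρ m′ = trans (Σ<-cong (suc (suc m′)) (λ k k< → trans (φ-def 1ℚ 0ℚ (term ρ (suc m′) k))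
    (trans (cong (λ t → re t * 1ℚ + im t * 0ℚ) (term-coefficients ρ m′ k (ℕ.≤-pred k<)))
      (ℚsolve 2 (λ u v → u :*′ # (+ 1) :+′ v :*′ # (+ 0) :=′ u) refl (b ρ k (suc m′)) (a ρ k (suc m′))))))
  (sym (sumFromTo-Σ< 0 (suc m′) (λ k → b ρ k (suc m′))))

p-Y : ∀ ρ m′ → Y (H^ 3) (λ k → ½ * H^ 2 k) ρ (suc m′) ≡ p ρ (suc m′)
p-Y ρ m′ = begin
  Σ< (suc m) (λ k → φ (H^ 3 k) (½ * H^ 2 k) (term ρ m k))
    ≡⟨ Σ<-cong (suc m) (λ k k< → trans (φ-def (H^ 3 k) (½ * H^ 2 k) (term ρ m k))
         (trans (cong (λ t → re t * H^ 3 k + im t * (½ * H^ 2 k)) (term-coefficients ρ m′ k (ℕ.≤-pred k<)))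
           (cong (λ x → b ρ k m * H^ 3 k + x) (ℚsolve 3 (λ a h x → a :*′ (h :*′ x) :=′ h :*′ a :*′ x) refl (a ρ k m) ½ (H^ 2 k))))) ⟩
  Σ< (suc m) f               ≡⟨ Σ<-suc m f ⟩
  Σ< m (λ k → f (suc k)) + f 0 ≡⟨ cong (λ x → Σ< m (λ k → f (suc k)) + x) f0 ⟩
  Σ< m (λ k → f (suc k)) + 0ℚ  ≡⟨ ℚ.+-identityʳ (Σ< m (λ k → f (suc k))) ⟩
  Σ< m (λ k → f (suc k))     ≡⟨ sumFromTo-Σ< 1 m f ⟨
  p ρ m                      ∎
  where
  m = suc m′
  f : ℕ → ℚ
  f k = b ρ k m * H^ 3 k + ½ * a ρ k m * H^ 2 k
  f0 : f 0 ≡ 0ℚ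
  f0 = ℚsolve 2 (λ x y → x :*′ # (+ 0) :+′ y :*′ # (+ 0) :=′ # (+ 0)) refl (b ρ 0 m) (½ * a ρ 0 m)

-- The coefficients of `term` are identified for m ≥ 1 only; that suffices, since the recurrence at
-- a positive index looks at positive indices alone.
SatisfiesRec-cong : ∀ ρ n {y z : ℕ → ℚ} → (∀ m → y (suc m) ≡ z (suc m)) → SatisfiesRec ρ y (suc n) → SatisfiesRec ρ z (suc n)
SatisfiesRec-cong ρ n {y} {z} eq rec = trans (trans (recLHS-def ρ z (suc n))
    (trans (cong₂ _+_ (cong₂ _+_ (cong (ofℕ ((suc n ℕ.+ 2) ℕ.^ 4) * Φ ρ (suc n) *_) (sym (eq (n ℕ.+ 2))))
                                 (cong (β ρ (suc n) *_) (sym (eq (n ℕ.+ 1)))))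
                      (cong (ofℕ (suc n ℕ.^ 4) * Φ ρ (suc n ℕ.+ 1) *_) (sym (eq n))))
      (sym (recLHS-def ρ y (suc n)))))
  rec

÷'-square : ∀ {y} → y ≢ 0ℚ → let i = 1ℚ ÷' y in 1ℚ ÷' (y ^' 2) ≡ i * i
÷'-square {y} y≢0 = ÷'-unique {1ℚ} {y ^' 2} {i * i} (*-≢0 y≢0 (*-≢0 y≢0 (λ ())))
  (trans (ℚsolve 2 (λ i y → i :*′ i :*′ (y :*′ (y :*′ # (+ 1))) :=′ i :*′ y :*′ (i :*′ y)) refl i y)
    (cong (λ u → u * u) (÷'-*-cancel 1ℚ y≢0)))
  where i = 1ℚ ÷' y

÷'-cube : ∀ {y} → y ≢ 0ℚ → let i = 1ℚ ÷' y in 1ℚ ÷' (y ^' 3) ≡ i * i * i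
÷'-cube {y} y≢0 = ÷'-unique {1ℚ} {y ^' 3} {i * i * i} (*-≢0 y≢0 (*-≢0 y≢0 (*-≢0 y≢0 (λ ()))))
  (trans (ℚsolve 2 (λ i y → i :*′ i :*′ i :*′ (y :*′ (y :*′ (y :*′ # (+ 1)))) :=′ i :*′ y :*′ (i :*′ y) :*′ (i :*′ y)) refl i y)
    (cong (λ u → u * u * u) (÷'-*-cancel 1ℚ y≢0)))
  where i = 1ℚ ÷' y

q-recurrence : ∀ ρ n′ → SatisfiesRec ρ (q ρ) (suc n′)
q-recurrence ρ n′ = SatisfiesRec-cong ρ n′ {Y (λ _ → 1ℚ) (λ _ → 0ℚ) ρ} {q ρ} (q-Y ρ) (Y-const-recurrence ρ n′)

p-recurrence : ∀ ρ n′ → SatisfiesRec ρ (p ρ) (suc n′)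
p-recurrence ρ n′ = SatisfiesRec-cong ρ n′ {Y (H^ 3) (λ k → ½ * H^ 2 k) ρ} {p ρ} (p-Y ρ) (Y-harmonic-recurrence ρ n′ (H^ 3) (λ k → ½ * H^ 2 k) cubes squares)
  where
  difference : ∀ r k {x} → 1ℚ ÷' (ofℕ (suc k) ^' r) ≡ x → H^ r (suc k) - H^ r k ≡ x
  difference r k eq = trans (cong (_- H^ r k) (trans (H^-suc r k) (cong (_+ H^ r k) eq)))
    (ℚsolve 2 (λ x h → x :+′ h :-′ h :=′ x) refl _ (H^ r k))
  cubes : ∀ k → let i = 1ℚ ÷' ofℕ (suc k) in H^ 3 (suc k) - H^ 3 k ≡ i * i * i
  cubes k = difference 3 k (÷'-cube (ofℕ-suc≢0 k))
  squares : ∀ k → let i = 1ℚ ÷' ofℕ (suc k) in ½ * H^ 2 (suc k) - ½ * H^ 2 k ≡ ½ * (i * i)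
  squares k = trans (ℚsolve 3 (λ h x y → h :*′ x :-′ h :*′ y :=′ h :*′ (x :-′ y)) refl ½ (H^ 2 (suc k)) (H^ 2 k))
    (cong (½ *_) (difference 2 k (÷'-square (ofℕ-suc≢0 k))))

-- Derivatives as ε-parts

im-evalD-∷ : ∀ y f x → im (evalD (y ∷ f) (x +ε 1ℚ)) ≡ evalP f x + x * im (evalD f (x +ε 1ℚ))
im-evalD-∷ y f x = begin
  im (const y ⊕ z ⊗ evalD f z)               ≡⟨ im-⊕ (const y) (z ⊗ evalD f z) ⟩
  0ℚ + im (z ⊗ evalD f z)                    ≡⟨ cong (λ w → 0ℚ + w) (im-⊗ z (evalD f z)) ⟩
  0ℚ + (x * im (evalD f z) + 1ℚ * re (evalD f z))
    ≡⟨ ℚsolve 3 (λ x a b → # (+ 0) :+′ (x :*′ a :+′ # (+ 1) :*′ b) :=′ b :+′ x :*′ a) refl x (im (evalD f z)) (re (evalD f z)) ⟩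
  re (evalD f z) + x * im (evalD f z)        ≡⟨ cong (λ w → w + x * im (evalD f z)) (re-evalD f z) ⟩
  evalP f x + x * im (evalD f z)             ∎
  where z = x +ε 1ℚ

-- Started at i, the loop multiplies the coefficient of x^j by i+j. It thus differentiates x^i f and
-- divides by x^(i-1), which gives i f + x f′.
derivation-loop : ∀ (h : ℕ → Poly → Poly) → (∀ i → h i [] ≡ []) → (∀ i y g → h i (y ∷ g) ≡ (ofℕ i * y) ∷ h (suc i) g) →
  ∀ x f i → evalP (h i f) x ≡ ofℕ i * evalP f x + x * im (evalD f (x +ε 1ℚ))
derivation-loop h h[] h∷ x [] i = trans (cong (λ f → evalP f x) (h[] i))
  (ℚsolve 2 (λ i x → # (+ 0) :=′ i :*′ # (+ 0) :+′ x :*′ # (+ 0)) refl (ofℕ i) x)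
derivation-loop h h[] h∷ x (y ∷ g) i = begin
  evalP (h i (y ∷ g)) x                                      ≡⟨ cong (λ f → evalP f x) (h∷ i y g) ⟩
  ofℕ i * y + x * evalP (h (suc i) g) x                      ≡⟨ cong (λ w → ofℕ i * y + x * w) (derivation-loop h h[] h∷ x g (suc i)) ⟩
  ofℕ i * y + x * (ofℕ (suc i) * e + x * d)                  ≡⟨ cong (λ w → ofℕ i * y + x * (w * e + x * d)) (ofℕ-+ 1 i) ⟩
  ofℕ i * y + x * ((1ℚ + ofℕ i) * e + x * d)
    ≡⟨ ℚsolve 5 (λ i y x e d → i :*′ y :+′ x :*′ ((# (+ 1) :+′ i) :*′ e :+′ x :*′ d) :=′ i :*′ (y :+′ x :*′ e) :+′ x :*′ (e :+′ x :*′ d)) refl (ofℕ i) y x e d ⟩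
  ofℕ i * (y + x * e) + x * (e + x * d)                      ≡⟨ cong (λ w → ofℕ i * (y + x * e) + x * w) (im-evalD-∷ y g x) ⟨
  ofℕ i * (y + x * e) + x * im (evalD (y ∷ g) (x +ε 1ℚ))     ∎
  where
  e = evalP g x
  d = im (evalD g (x +ε 1ℚ))

mutual
  -- Recovered by unification, as `sumFromTo-loop` is: abstracting `c ∷ g` and 2 leaves the local
  -- function applied to distinct variables.
  derivP-loop : ℚ → Poly → ℕ → Poly → Poly
  derivP-loop = _

  derivP-∷∷ : ∀ y c g → derivP (y ∷ c ∷ g) ≡ (ofℕ 1 * c) ∷ derivP-loop y (c ∷ g) 2 g
  derivP-∷∷ y c g with c ∷ g | 2
  ... | f | i = refl

im-evalD : ∀ f x → im (evalD f (x +ε 1ℚ)) ≡ evalP (derivP f) x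
im-evalD []           x = refl
im-evalD (y ∷ [])     x = trans (im-evalD-∷ y [] x) (ℚsolve 1 (λ x → # (+ 0) :+′ x :*′ # (+ 0) :=′ # (+ 0)) refl x)
im-evalD (y ∷ c ∷ g)  x = sym (begin
  evalP (derivP (y ∷ c ∷ g)) x   ≡⟨ cong (λ f → evalP f x) (derivP-∷∷ y c g) ⟩
  ofℕ 1 * c + x * evalP (derivP-loop y (c ∷ g) 2 g) x
    ≡⟨ cong (λ w → ofℕ 1 * c + x * w) (derivation-loop (derivP-loop y (c ∷ g)) (λ _ → refl) (λ _ _ _ → refl) x g 2) ⟩
  ofℕ 1 * c + x * (ofℕ 2 * e + x * d)
    ≡⟨ ℚsolve 4 (λ c x e d → # (+ 1) :*′ c :+′ x :*′ (# (+ 2) :*′ e :+′ x :*′ d) :=′ c :+′ x :*′ e :+′ x :*′ (e :+′ x :*′ d)) refl c x e d ⟩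
  c + x * e + x * (e + x * d)                        ≡⟨ cong (λ w → c + x * e + x * w) (im-evalD-∷ c g x) ⟨
  c + x * e + x * im (evalD (c ∷ g) (x +ε 1ℚ))       ≡⟨ im-evalD-∷ y (c ∷ g) x ⟨
  im (evalD (y ∷ c ∷ g) (x +ε 1ℚ))                   ∎)
  where
  e = evalP g x
  d = im (evalD g (x +ε 1ℚ))

evalP-+P : ∀ f g x → evalP (f +P g) x ≡ evalP f x + evalP g x
evalP-+P f g x = trans (sym (re-evalD (f +P g) (const x))) (trans (cong re (evalD-+P f g (const x)))
  (trans (re-⊕ (evalD f (const x)) (evalD g (const x))) (cong₂ _+_ (re-evalD f (const x)) (re-evalD g (const x)))))

evalP-*P : ∀ f g x → evalP (f *P g) x ≡ evalP f x * evalP g x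
evalP-*P f g x = trans (sym (re-evalD (f *P g) (const x))) (trans (cong re (evalD-*P f g (const x)))
  (trans (re-⊗ (evalD f (const x)) (evalD g (const x))) (cong₂ _*_ (re-evalD f (const x)) (re-evalD g (const x)))))

evalP-scaleP : ∀ c f x → evalP (scaleP c f) x ≡ c * evalP f x
evalP-scaleP c f x = trans (sym (re-evalD (scaleP c f) (const x))) (trans (cong re (evalD-scaleP c f (const x)))
  (trans (re-⊗ (const c) (evalD f (const x))) (cong (c *_) (re-evalD f (const x)))))

quotient-rule : ∀ (N D : Dual) → re D ≢ 0ℚ →
  (im N * re D + - 1ℚ * (re N * im D)) ÷' (re D * re D) ≡ im (N ⊗ inv D)
quotient-rule N D D≢0 = trans (÷'-unique (*-≢0 D≢0 D≢0) (aux (re N) (im N) (re D) (im D) (1ℚ ÷' re D) (÷'-*-cancel 1ℚ D≢0)))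
  (sym (im-⊗ N (inv D)))
  where
  aux : ∀ n n′ d d′ i → i * d ≡ 1ℚ → (n * (- (d′ * (i * i))) + n′ * i) * (d * d) ≡ n′ * d + - 1ℚ * (n * d′)
  aux n n′ d d′ i eq = trans
    (ℚsolve 5 (λ n n′ d d′ i → (n :*′ (:-′ (d′ :*′ (i :*′ i))) :+′ n′ :*′ i) :*′ (d :*′ d)
       :=′ (i :*′ d) :*′ (n′ :*′ d) :+′ (i :*′ d) :*′ (i :*′ d) :*′ ((:-′ # (+ 1)) :*′ (n :*′ d′))) refl n n′ d d′ i)
    (trans (cong (λ u → u * (n′ * d) + u * u * (- 1ℚ * (n * d′))) eq)
      (cong₂ _+_ (ℚ.*-identityˡ (n′ * d)) (ℚ.*-identityˡ (- 1ℚ * (n * d′)))))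

evalR-derivR : ∀ N D x → evalP D x ≢ 0ℚ →
  evalR (derivR (N // D)) x ≡ im (evalD N (x +ε 1ℚ) ⊗ inv (evalD D (x +ε 1ℚ)))
evalR-derivR N D x D≢0 = trans (cong₂ _÷'_ numerator denominator)
  (quotient-rule N̂ D̂ (λ eq → D≢0 (trans (sym (re-evalD D z)) eq)))
  where
  z = x +ε 1ℚ
  N̂ = evalD N z
  D̂ = evalD D z
  numerator : evalP ((derivP N *P D) +P negP (N *P derivP D)) x ≡ im N̂ * re D̂ + - 1ℚ * (re N̂ * im D̂)
  numerator = trans (evalP-+P (derivP N *P D) (negP (N *P derivP D)) x) (cong₂ _+_
    (trans (evalP-*P (derivP N) D x) (cong₂ _*_ (sym (im-evalD N x)) (sym (re-evalD D z))))
    (trans (evalP-scaleP (- 1ℚ) (N *P derivP D) x) (cong (- 1ℚ *_)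
      (trans (evalP-*P N (derivP D) x) (cong₂ _*_ (sym (re-evalD N z)) (sym (im-evalD D x)))))))
  denominator : evalP (D *P D) x ≡ re D̂ * re D̂
  denominator = trans (evalP-*P D D x) (cong₂ _*_ (sym (re-evalD D z)) (sym (re-evalD D z)))

-- Telescoping at z = M + ε

pt : ℕ → Dual
pt M = ofℕ M +ε 1ℚ

opaque
  unfolding _⊕_

  pt-suc : ∀ M → pt M ⊕ 1D ≡ pt (suc M)
  pt-suc M = cong (_+ε 1ℚ) (trans (ℚ.+-comm (ofℕ M) 1ℚ) (sym (ofℕ-+ 1 M)))

  pt-⊕ι : ∀ M i → pt M ⊕ ι (+ suc i) ≡ ofℕ (suc (M ℕ.+ i)) +ε 1ℚ
  pt-⊕ι M i = cong (_+ε 1ℚ) (trans (sym (ofℕ-+ M (suc i))) (cong ofℕ (ℕ.+-suc M i)))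

  im-const⊗ : ∀ c x → im (const c ⊗ x) ≡ c * im x
  im-const⊗ c x = ℚsolve 3 (λ c a b → c :*′ b :+′ # (+ 0) :*′ a :=′ c :*′ b) refl c (re x) (im x)

pt≢0 : ∀ M i → re (pt M ⊕ ι (+ suc i)) ≢ 0ℚ
pt≢0 M i eq = ofℕ-suc≢0 (M ℕ.+ i) (trans (sym (cong re (pt-⊕ι M i))) eq)

rising≢0 : ∀ m M → re (rising m (pt M)) ≢ 0ℚ
rising≢0 m M = prodD-≢0 m (pt≢0 M)

inv-⊗ : ∀ {x y} → re x ≢ 0ℚ → re y ≢ 0ℚ → inv (x ⊗ y) ≡ inv x ⊗ inv y
inv-⊗ {x} {y} x≢0 y≢0 = ⊗-cancelˡ (re-⊗-≢0 x≢0 y≢0) (trans (⊗-inv (re-⊗-≢0 x≢0 y≢0)) (sym (begin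
  x ⊗ y ⊗ (inv x ⊗ inv y)      ≡⟨ solve 4 (λ x y i j → x :* y :* (i :* j) := x :* i :* (y :* j)) refl x y (inv x) (inv y) ⟩
  x ⊗ inv x ⊗ (y ⊗ inv y)      ≡⟨ cong₂ _⊗_ (⊗-inv x≢0) (⊗-inv y≢0) ⟩
  1D ⊗ 1D                      ≡⟨ solve 0 (con (+ 1) :* con (+ 1) := con (+ 1)) refl ⟩
  1D                           ∎)))

-- F_{m,1} at M + ε; no factor of the denominator vanishes at M ≥ 0, so the quotient exists here.
R̂ : ℕ → ℕ → ℕ → Dual
R̂ ρ m M = kern ρ m (pt M) (fall (m ℕ.∸ 1) (pt M) ⊗ inv (rising (suc m) (pt M)))

evalD-monic : ∀ x z → evalD (x ∷ 1ℚ ∷ []) z ≡ z ⊕ const x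
evalD-monic x z = solve 2 (λ x z → x :+ z :* (con (+ 1) :+ z :* con (+ 0)) := z :+ x) refl (const x) z

evalD-negPoch : ∀ m z → evalD (negPoch m) z ≡ fall (m ℕ.∸ 1) z
evalD-negPoch m z = trans (evalD-prodP (m ℕ.∸ 1) (λ i → ofℕ i ∷ (- 1ℚ) ∷ []) z)
  (prodD-cong (m ℕ.∸ 1) (λ i → solve 3 (λ x y z → x :+ z :* (y :+ z :* con (+ 0)) := x :+ y :* z) refl (const (ofℕ i)) (const (- 1ℚ)) z))

evalD-posPoch : ∀ m z → evalD (posPoch m) z ≡ rising (suc m) z
evalD-posPoch m z = trans (evalD-prodP (suc m) (λ i → ofℕ (suc i) ∷ 1ℚ ∷ []) z)
  (prodD-cong (suc m) (λ i → evalD-monic (ofℕ (suc i)) z))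

evalR-F2 : ∀ ρ m M → evalR (F2 ρ m) (ofℕ M) ≡ im (R̂ ρ m M)
evalR-F2 ρ m M = trans (evalR-derivR num den (ofℕ M) den≢0) (cong im (begin
  evalD num z ⊗ inv (evalD den z)  ≡⟨ cong₂ (λ u v → u ⊗ inv v) num-eval den-eval ⟩
  f ⊗ f ⊗ l₁ ⊗ l₂ ⊗ inv (r ⊗ r)     ≡⟨ cong (f ⊗ f ⊗ l₁ ⊗ l₂ ⊗_) (inv-⊗ r≢0 r≢0) ⟩
  f ⊗ f ⊗ l₁ ⊗ l₂ ⊗ (inv r ⊗ inv r) ≡⟨ solve 4 (λ f a b i → f :* f :* a :* b :* (i :* i) := f :* i :* (f :* i) :* (a :* b)) refl f l₁ l₂ (inv r) ⟩
  R̂ ρ m M ∎))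
  where
  z = pt M
  f = fall (m ℕ.∸ 1) z
  r = rising (suc m) z
  r≢0 = rising≢0 (suc m) M
  l₁ = z ⊕ const (ofℕ 1 - ofℕ m)
  l₂ = z ⊕ const (- ofℕ (ρ ℕ.* m))
  p₁ p₂ num den : Poly
  p₁ = (ofℕ 1 - ofℕ m) ∷ 1ℚ ∷ []
  p₂ = (- ofℕ (ρ ℕ.* m)) ∷ 1ℚ ∷ []
  num = negPoch m *P negPoch m *P p₁ *P p₂
  den = posPoch m *P posPoch m
  num-eval : evalD num z ≡ f ⊗ f ⊗ l₁ ⊗ l₂
  num-eval = trans (evalD-*P (negPoch m *P negPoch m *P p₁) p₂ z) (cong₂ _⊗_
    (trans (evalD-*P (negPoch m *P negPoch m) p₁ z) (cong₂ _⊗_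
      (trans (evalD-*P (negPoch m) (negPoch m) z) (cong (λ u → u ⊗ u) (evalD-negPoch m z)))
      (evalD-monic (ofℕ 1 - ofℕ m) z)))
    (evalD-monic (- ofℕ (ρ ℕ.* m)) z))
  den-eval : evalD den z ≡ r ⊗ r
  den-eval = trans (evalD-*P (posPoch m) (posPoch m) z) (cong (λ u → u ⊗ u) (evalD-posPoch m z))
  den≢0 : evalP den (ofℕ M) ≢ 0ℚ
  den≢0 eq = re-⊗-≢0 r≢0 r≢0 (trans (sym (cong re den-eval)) (trans (re-evalD den z) eq))

inv-rising-suc : ∀ m M → inv (rising (suc m) (pt M)) ⊗ (pt M ⊕ ι (+ suc m)) ≡ inv (rising m (pt M))
inv-rising-suc m M = inv-cancel (rising≢0 m M) (pt≢0 M m)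

module Antidifference (ρ n′ : ℕ) where

  n : ℕ
  n = suc n′

  N : Dual
  N = ι (+ n)

  γ G : ℕ → Dual
  γ M = fall n (pt M) ⊗ inv (rising (suc (suc n)) (pt M))
  G M = γ M ⊗ γ M ⊗ evalD (T ρ n) (pt M)

  s : ℕ → Dual
  s M = fall n′ (pt M) ⊗ inv (rising (suc (suc (suc n))) (pt M))

  ι-shift : ∀ c z → z ⊕ N ⊕ ι (+ c) ≡ z ⊕ ι (+ (c ℕ.+ n))
  ι-shift c z = trans (solve 3 (λ z n c → z :+ n :+ c := z :+ (c :+ n)) refl z N (ι (+ c))) (cong (z ⊕_) (sym (ι-+ (+ c) (+ n))))

  N-1 : ∀ z → N ⊝ 1D ⊝ z ≡ const (ofℕ n′) ⊕ const (- 1ℚ) ⊗ z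
  N-1 z = trans (cong (λ u → u ⊝ 1D ⊝ z) (ι-+ (+ 1) (+ n′)))
    (trans (solve 2 (λ n z → con (+ 1) :+ n :- con (+ 1) :- z := n :- z) refl (ι (+ n′)) z) (sym (fall-factor (ofℕ n′) z)))

  s₁≡γ : ∀ M → s M ⊗ ((N ⊝ 1D ⊝ pt M) ⊗ (pt M ⊕ N ⊕ ι (+ 3))) ≡ γ M
  s₁≡γ M = begin
    s M ⊗ ((N ⊝ 1D ⊝ z) ⊗ (z ⊕ N ⊕ ι (+ 3)))
      ≡⟨ cong₂ (λ u v → s M ⊗ (u ⊗ v)) (N-1 z) (ι-shift 3 z) ⟩
    f ⊗ i ⊗ (u ⊗ v)  ≡⟨ solve 4 (λ f i u v → f :* i :* (u :* v) := f :* u :* (i :* v)) refl f i u v ⟩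
    f ⊗ u ⊗ (i ⊗ v)  ≡⟨ cong (f ⊗ u ⊗_) (inv-rising-suc (suc (suc n)) M) ⟩
    γ M              ∎
    where
    z = pt M
    f = fall n′ z
    i = inv (rising (suc (suc (suc n))) z)
    u = const (ofℕ n′) ⊕ const (- 1ℚ) ⊗ z
    v = z ⊕ ι (+ suc (suc (suc n)))

  s₀≡ : ∀ M → s M ⊗ ((pt M ⊕ N ⊕ ι (+ 2)) ⊗ (pt M ⊕ N ⊕ ι (+ 3))) ≡ fall n′ (pt M) ⊗ inv (rising (suc n) (pt M))
  s₀≡ M = begin
    s M ⊗ ((z ⊕ N ⊕ ι (+ 2)) ⊗ (z ⊕ N ⊕ ι (+ 3)))
      ≡⟨ cong₂ (λ u v → s M ⊗ (u ⊗ v)) (ι-shift 2 z) (ι-shift 3 z) ⟩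
    f ⊗ i ⊗ (u ⊗ v)  ≡⟨ solve 4 (λ f i u v → f :* i :* (u :* v) := f :* (i :* v :* u)) refl f i u v ⟩
    f ⊗ (i ⊗ v ⊗ u)  ≡⟨ cong (f ⊗_) (trans (cong (_⊗ u) (inv-rising-suc (suc (suc n)) M)) (inv-rising-suc (suc n) M)) ⟩
    f ⊗ inv (rising (suc n) z) ∎
    where
    z = pt M
    f = fall n′ z
    i = inv (rising (suc (suc (suc n))) z)
    u = z ⊕ ι (+ suc (suc n))
    v = z ⊕ ι (+ suc (suc (suc n)))

  s₂≡ : ∀ M → s M ⊗ ((N ⊝ 1D ⊝ pt M) ⊗ (N ⊝ pt M)) ≡ fall (suc n) (pt M) ⊗ inv (rising (suc (suc (suc n))) (pt M))
  s₂≡ M = trans (cong₂ (λ u v → s M ⊗ (u ⊗ v)) (N-1 z) (sym (fall-factor (ofℕ n) z)))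
    (solve 4 (λ f i u v → f :* i :* (u :* v) := f :* u :* v :* i) refl (fall n′ z) (inv (rising (suc (suc (suc n))) z))
      (const (ofℕ n′) ⊕ const (- 1ℚ) ⊗ z) (const (ofℕ n) ⊕ const (- 1ℚ) ⊗ z))
    where z = pt M

  -- From (-z-1)_n = -(z+1)(-z)_{n-1} and (z+1)_{n+3} = (z+1)(z+2)_{n+2}. The sign disappears in G,
  -- where γ is squared.
  γ-suc : ∀ M → γ (suc M) ≡ ⊖ (s M ⊗ ((pt M ⊕ 1D) ⊗ (pt M ⊕ 1D)))
  γ-suc M = begin
    fall n (pt (suc M)) ⊗ inv (rising (suc (suc n)) (pt (suc M)))
      ≡⟨ cong₂ _⊗_ fall-shift rising-shift ⟩
    ⊖ y ⊗ f ⊗ (i ⊗ y)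
      ≡⟨ solve 3 (λ y f i → :- y :* f :* (i :* y) := :- (f :* i :* (y :* y))) refl y f i ⟩
    ⊖ (f ⊗ i ⊗ (y ⊗ y)) ∎
    where
    z = pt M
    y = z ⊕ 1D
    f = fall n′ z
    i = inv (rising (suc (suc (suc n))) z)
    r = rising (suc (suc n)) (pt (suc M))
    fall-shift : fall n (pt (suc M)) ≡ ⊖ y ⊗ f
    fall-shift = trans (cong (fall n) (sym (pt-suc M))) (trans (prodD-suc n′ (λ i → const (ofℕ i) ⊕ const (- 1ℚ) ⊗ y))
      (cong₂ _⊗_ (trans (fall-factor 0ℚ y) (solve 1 (λ y → con (+ 0) :- y := :- y) refl y))
        (prodD-cong n′ (λ i → trans (fall-factor (ofℕ (suc i)) y)
          (trans (cong (_⊝ y) (ι-+ (+ 1) (+ i))) (trans (solve 2 (λ i z → con (+ 1) :+ i :- (z :+ con (+ 1)) := i :- z) refl (ι (+ i)) z)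
            (sym (fall-factor (ofℕ i) z))))))))
    rising-split : rising (suc (suc (suc n))) z ≡ r ⊗ y
    rising-split = trans (prodD-suc (suc (suc n)) (λ i → z ⊕ ι (+ suc i)))
      (trans (cong (y ⊗_) (prodD-cong (suc (suc n)) (λ i → trans (cong (z ⊕_) (ι-+ (+ 1) (+ suc i)))
          (trans (solve 2 (λ z i → z :+ (con (+ 1) :+ i) := z :+ con (+ 1) :+ i) refl z (ι (+ suc i))) (cong (_⊕ ι (+ suc i)) (pt-suc M))))))
        (solve 2 (λ y r → y :* r := r :* y) refl y r))
    rising-shift : inv r ≡ i ⊗ y
    rising-shift = sym (trans (cong (λ u → inv u ⊗ y) rising-split) (inv-cancel (rising≢0 (suc (suc n)) (suc M)) (pt≢0 M 0)))

  G-suc : ∀ M → G (suc M) ≡ (s M ⊗ ((pt M ⊕ 1D) ⊗ (pt M ⊕ 1D))) ⊗ (s M ⊗ ((pt M ⊕ 1D) ⊗ (pt M ⊕ 1D))) ⊗ evalD (T ρ n) (pt M ⊕ 1D)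
  G-suc M = trans (cong₂ (λ u z → u ⊗ u ⊗ evalD (T ρ n) z) (γ-suc M) (sym (pt-suc M)))
    (solve 2 (λ u t → :- u :* :- u :* t := u :* u :* t) refl (s M ⊗ ((pt M ⊕ 1D) ⊗ (pt M ⊕ 1D))) (evalD (T ρ n) (pt M ⊕ 1D)))

  G-zero : G 0 ≡ 0D
  G-zero = trans (cong (_⊗ t) (ε²-vanishes (proj₁ f-ε ⊗ i) (trans (cong (_⊗ i) (proj₂ f-ε))
      (solve 3 (λ e x i → e :* x :* i := e :* (x :* i)) refl ε (proj₁ f-ε) i)))) (⊗-zeroˡ t)
    where
    t = evalD (T ρ n) ε
    i = inv (rising (suc (suc n)) ε)
    f-ε = fall-ε n′

  G-difference : ∀ M → (N ⊕ 1D) ⊗ (N ⊕ 1D) ⊗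
      ( const (ofℕ ((n ℕ.+ 2) ℕ.^ 4) * Φ ρ n) ⊗ R̂ ρ (n ℕ.+ 2) M
      ⊕ const (β ρ n) ⊗ R̂ ρ (n ℕ.+ 1) M
      ⊕ const (ofℕ (n ℕ.^ 4) * Φ ρ (n ℕ.+ 1)) ⊗ R̂ ρ n M)
    ≡ ι (+ 2) ⊗ (G (suc M) ⊝ G M)
  G-difference M = trans (rewriting (subst R̂₂ (ℕ.+-comm 2 n) (cong (kern ρ (suc (suc n)) (pt M)) (sym (s₂≡ M))))
      (subst R̂₁ (ℕ.+-comm 1 n) (cong (kern ρ (suc n) (pt M)) (sym (s₁≡γ M)))) (cong (kern ρ n (pt M)) (sym (s₀≡ M))))
    (trans (telescope ρ n (pt M) (s M))
      (cong₂ (λ u v → ι (+ 2) ⊗ (u ⊝ v)) (sym (G-suc M)) (cong (λ u → u ⊗ u ⊗ evalD (T ρ n) (pt M)) (s₁≡γ M))))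
    where
    R̂₂ R̂₁ : ℕ → Set
    R̂₂ m = R̂ ρ m M ≡ kern ρ m (pt M) (s M ⊗ ((N ⊝ 1D ⊝ pt M) ⊗ (N ⊝ pt M)))
    R̂₁ m = R̂ ρ m M ≡ kern ρ m (pt M) (s M ⊗ ((N ⊝ 1D ⊝ pt M) ⊗ (pt M ⊕ N ⊕ ι (+ 3))))
    rewriting : ∀ {K c₂ c₁ c₀ x₂ x₁ x₀ y₂ y₁ y₀} → x₂ ≡ y₂ → x₁ ≡ y₁ → x₀ ≡ y₀ →
      K ⊗ (c₂ ⊗ x₂ ⊕ c₁ ⊗ x₁ ⊕ c₀ ⊗ x₀) ≡ K ⊗ (c₂ ⊗ y₂ ⊕ c₁ ⊗ y₁ ⊕ c₀ ⊗ y₀)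
    rewriting refl refl refl = refl

module PartialSums (ρ n′ : ℕ) where
  open Antidifference ρ n′

  -- Formulated for arbitrary coefficients and sequences, which keeps `Φ` and `β` out of the
  -- induction. The value G(ε) = 0 makes the constant of summation vanish.
  telescoped : ∀ c₂ c₁ c₀ (x₂ x₁ x₀ : ℕ → Dual) (S₂ S₁ S₀ : ℕ → ℚ) →
    (∀ M → (N ⊕ 1D) ⊗ (N ⊕ 1D) ⊗ (const c₂ ⊗ x₂ M ⊕ const c₁ ⊗ x₁ M ⊕ const c₀ ⊗ x₀ M) ≡ ι (+ 2) ⊗ (G (suc M) ⊝ G M)) →
    S₂ 0 ≡ 0ℚ → S₁ 0 ≡ 0ℚ → S₀ 0 ≡ 0ℚ →
    (∀ M → S₂ (suc M) ≡ S₂ M + im (x₂ M)) → (∀ M → S₁ (suc M) ≡ S₁ M + im (x₁ M)) → (∀ M → S₀ (suc M) ≡ S₀ M + im (x₀ M)) →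
    ∀ M → suc² n * (c₂ * S₂ M + c₁ * S₁ M + c₀ * S₀ M) ≡ ofℕ 2 * im (G M)
  telescoped c₂ c₁ c₀ x₂ x₁ x₀ S₂ S₁ S₀ tele z₂ z₁ z₀ e₂ e₁ e₀ zero = begin
    suc² n * (c₂ * S₂ 0 + c₁ * S₁ 0 + c₀ * S₀ 0)
      ≡⟨ cong (suc² n *_) (cong₂ _+_ (cong₂ _+_ (cong (c₂ *_) z₂) (cong (c₁ *_) z₁)) (cong (c₀ *_) z₀)) ⟩
    suc² n * (c₂ * 0ℚ + c₁ * 0ℚ + c₀ * 0ℚ)
      ≡⟨ ℚsolve 4 (λ k a b c → k :*′ (a :*′ # (+ 0) :+′ b :*′ # (+ 0) :+′ c :*′ # (+ 0)) :=′ # (+ 2) :*′ # (+ 0)) refl (suc² n) c₂ c₁ c₀ ⟩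
    ofℕ 2 * 0ℚ         ≡⟨ cong (λ x → ofℕ 2 * im x) G-zero ⟨
    ofℕ 2 * im (G 0)   ∎
  telescoped c₂ c₁ c₀ x₂ x₁ x₀ S₂ S₁ S₀ tele z₂ z₁ z₀ e₂ e₁ e₀ (suc M) = begin
    suc² n * (c₂ * S₂ (suc M) + c₁ * S₁ (suc M) + c₀ * S₀ (suc M))
      ≡⟨ cong (suc² n *_) (cong₂ _+_ (cong₂ _+_ (cong (c₂ *_) (e₂ M)) (cong (c₁ *_) (e₁ M))) (cong (c₀ *_) (e₀ M))) ⟩
    suc² n * (c₂ * (S₂ M + im (x₂ M)) + c₁ * (S₁ M + im (x₁ M)) + c₀ * (S₀ M + im (x₀ M)))
      ≡⟨ combination-+ (suc² n) c₂ c₁ c₀ (S₂ M) (im (x₂ M)) (S₁ M) (im (x₁ M)) (S₀ M) (im (x₀ M)) ⟩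
    suc² n * (c₂ * S₂ M + c₁ * S₁ M + c₀ * S₀ M) + suc² n * (c₂ * im (x₂ M) + c₁ * im (x₁ M) + c₀ * im (x₀ M))
      ≡⟨ cong₂ _+_ (telescoped c₂ c₁ c₀ x₂ x₁ x₀ S₂ S₁ S₀ tele z₂ z₁ z₀ e₂ e₁ e₀ M) step ⟩
    ofℕ 2 * im (G M) + ofℕ 2 * (im (G (suc M)) + - im (G M))
      ≡⟨ ℚsolve 2 (λ a b → # (+ 2) :*′ a :+′ # (+ 2) :*′ (b :+′ :-′ a) :=′ # (+ 2) :*′ b) refl (im (G M)) (im (G (suc M))) ⟩
    ofℕ 2 * im (G (suc M)) ∎
    where
    step : suc² n * (c₂ * im (x₂ M) + c₁ * im (x₁ M) + c₀ * im (x₀ M)) ≡ ofℕ 2 * (im (G (suc M)) + - im (G M))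
    step = begin
      suc² n * (c₂ * im (x₂ M) + c₁ * im (x₁ M) + c₀ * im (x₀ M))
        ≡⟨ cong (suc² n *_) (cong₂ _+_ (cong₂ _+_ (im-const⊗ c₂ (x₂ M)) (im-const⊗ c₁ (x₁ M))) (im-const⊗ c₀ (x₀ M))) ⟨
      suc² n * (im (const c₂ ⊗ x₂ M) + im (const c₁ ⊗ x₁ M) + im (const c₀ ⊗ x₀ M))
        ≡⟨ cong (suc² n *_) (trans (im-⊕ _ _) (cong (_+ im (const c₀ ⊗ x₀ M)) (im-⊕ _ _))) ⟨
      suc² n * im (const c₂ ⊗ x₂ M ⊕ const c₁ ⊗ x₁ M ⊕ const c₀ ⊗ x₀ M)
        ≡⟨ im-const⊗ (suc² n) _ ⟨
      im (const (suc² n) ⊗ (const c₂ ⊗ x₂ M ⊕ const c₁ ⊗ x₁ M ⊕ const c₀ ⊗ x₀ M))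
        ≡⟨ cong (λ k → im (k ⊗ (const c₂ ⊗ x₂ M ⊕ const c₁ ⊗ x₁ M ⊕ const c₀ ⊗ x₀ M))) (const-suc² n) ⟩
      im ((N ⊕ 1D) ⊗ (N ⊕ 1D) ⊗ (const c₂ ⊗ x₂ M ⊕ const c₁ ⊗ x₁ M ⊕ const c₀ ⊗ x₀ M)) ≡⟨ cong im (tele M) ⟩
      im (ι (+ 2) ⊗ (G (suc M) ⊝ G M)) ≡⟨ im-const⊗ (ofℕ 2) (G (suc M) ⊝ G M) ⟩
      ofℕ 2 * im (G (suc M) ⊝ G M)
        ≡⟨ cong (ofℕ 2 *_) (trans (im-⊕ (G (suc M)) (⊖ G M)) (cong (λ w → im (G (suc M)) + w) (im-⊖ (G M)))) ⟩
      ofℕ 2 * (im (G (suc M)) + - im (G M)) ∎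

  S-suc : ∀ m M → S ρ m (suc M) ≡ S ρ m M + im (R̂ ρ m M)
  S-suc m M = cong (λ w → S ρ m M + w) (evalR-F2 ρ m M)

  negate-half : ∀ k c₂ c₁ c₀ a b c {x} → k * (c₂ * a + c₁ * b + c₀ * c) ≡ ofℕ 2 * x →
    k * (c₂ * - (½ * a) + c₁ * - (½ * b) + c₀ * - (½ * c)) ≡ - x
  negate-half k c₂ c₁ c₀ a b c {x} eq = begin
    k * (c₂ * - (½ * a) + c₁ * - (½ * b) + c₀ * - (½ * c))
      ≡⟨ ℚsolve 8 (λ h k c₂ c₁ c₀ a b c → k :*′ (c₂ :*′ :-′ (h :*′ a) :+′ c₁ :*′ :-′ (h :*′ b) :+′ c₀ :*′ :-′ (h :*′ c))
           :=′ :-′ (h :*′ (k :*′ (c₂ :*′ a :+′ c₁ :*′ b :+′ c₀ :*′ c)))) refl ½ k c₂ c₁ c₀ a b c ⟩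
    - (½ * (k * (c₂ * a + c₁ * b + c₀ * c))) ≡⟨ cong (λ w → - (½ * w)) eq ⟩
    - (½ * (ofℕ 2 * x))                      ≡⟨ cong -_ (trans (sym (ℚ.*-assoc ½ (ofℕ 2) x)) (ℚ.*-identityˡ x)) ⟩
    - x ∎

  rec-rPartial : ∀ M → suc² n * recLHS ρ (λ m → rPartial ρ m M) n ≡ - im (G M)
  rec-rPartial M = trans (cong (suc² n *_) (recLHS-def ρ (λ m → rPartial ρ m M) n))
    (negate-half (suc² n) c₂ c₁ c₀ (S ρ (n ℕ.+ 2) M) (S ρ (n ℕ.+ 1) M) (S ρ n M)
      (telescoped c₂ c₁ c₀ (R̂ ρ (n ℕ.+ 2)) (R̂ ρ (n ℕ.+ 1)) (R̂ ρ n) (S ρ (n ℕ.+ 2)) (S ρ (n ℕ.+ 1)) (S ρ n) G-difference refl refl refl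
        (S-suc (n ℕ.+ 2)) (S-suc (n ℕ.+ 1)) (S-suc n) M))
    where
    c₂ c₁ c₀ : ℚ
    c₂ = ofℕ ((n ℕ.+ 2) ℕ.^ 4) * Φ ρ n
    c₁ = β ρ n
    c₀ = ofℕ (n ℕ.^ 4) * Φ ρ (n ℕ.+ 1)

-- Order on ℚ

0≤ofℕ : ∀ n → 0ℚ ℚ.≤ ofℕ n
0≤ofℕ n = ℚ.nonNegative⁻¹ (ofℕ n) {{ℚ.normalize-nonNeg n 1}}

ofℕ-mono : ∀ {m n} → m ℕ.≤ n → ofℕ m ℚ.≤ ofℕ n
ofℕ-mono {m} {n} m≤n = ℚ.≤-trans (ℚ.≤-reflexive (sym (ℚ.+-identityʳ (ofℕ m))))
  (ℚ.≤-trans (ℚ.+-monoʳ-≤ (ofℕ m) (0≤ofℕ (n ℕ.∸ m)))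
    (ℚ.≤-reflexive (trans (sym (ofℕ-+ m (n ℕ.∸ m))) (cong ofℕ (ℕ.m+[n∸m]≡n m≤n)))))

*-mono-≤ : ∀ {a b c d} → 0ℚ ℚ.≤ a → 0ℚ ℚ.≤ c → a ℚ.≤ b → c ℚ.≤ d → a * c ℚ.≤ b * d
*-mono-≤ {a} {b} {c} {d} 0≤a 0≤c a≤b c≤d = ℚ.≤-trans
  (ℚ.*-monoʳ-≤-nonNeg c {{ℚ.nonNegative 0≤c}} a≤b)
  (ℚ.*-monoˡ-≤-nonNeg b {{ℚ.nonNegative (ℚ.≤-trans 0≤a a≤b)}} c≤d)

*-nonNeg : ∀ {a c} → 0ℚ ℚ.≤ a → 0ℚ ℚ.≤ c → 0ℚ ℚ.≤ a * c
*-nonNeg {a} {c} 0≤a 0≤c = ℚ.≤-trans (ℚ.≤-reflexive (sym (ℚ.*-zeroˡ c))) (ℚ.*-monoʳ-≤-nonNeg c {{ℚ.nonNegative 0≤c}} 0≤a)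

p≤p+q : ∀ {p q} → 0ℚ ℚ.≤ q → p ℚ.≤ p + q
p≤p+q {p} 0≤q = ℚ.≤-trans (ℚ.≤-reflexive (sym (ℚ.+-identityʳ p))) (ℚ.+-monoʳ-≤ p 0≤q)

-- Asymptotic bounds

-- The scale is M+1 rather than M, so that it is invertible and at least 1 from M = 0 on and the
-- estimates hold without exceptions.
t τ : ℕ → ℚ
t M = ofℕ (suc M)
τ M = 1ℚ ÷' t M

t-pos : ∀ M → ℚ.Positive (t M)
t-pos M = ℚ.normalize-pos (suc M) 1

0≤t : ∀ M → 0ℚ ℚ.≤ t M
0≤t M = 0≤ofℕ (suc M)

1≤t : ∀ M → 1ℚ ℚ.≤ t M
1≤t M = ofℕ-mono {1} {suc M} (s≤s z≤n)

τt≡1 : ∀ M → τ M * t M ≡ 1ℚ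
τt≡1 M = ÷'-*-cancel 1ℚ (ofℕ-suc≢0 M)

≤-by-t : ∀ M {x y} → x * t M ℚ.≤ y * t M → x ℚ.≤ y
≤-by-t M = ℚ.*-cancelʳ-≤-pos (t M) {{t-pos M}}

0≤τ : ∀ M → 0ℚ ℚ.≤ τ M
0≤τ M = ≤-by-t M (ℚ.≤-trans (ℚ.≤-reflexive (ℚ.*-zeroˡ (t M))) (ℚ.≤-trans (0≤ofℕ 1) (ℚ.≤-reflexive (sym (τt≡1 M)))))

τ-antimono : ∀ {M M′} → M ℕ.≤ M′ → τ M′ ℚ.≤ τ M
τ-antimono {M} {M′} M≤M′ = ≤-by-t M (ℚ.≤-trans
  (ℚ.*-monoˡ-≤-nonNeg (τ M′) {{ℚ.nonNegative (0≤τ M′)}} (ofℕ-mono (s≤s M≤M′)))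
  (ℚ.≤-reflexive (trans (τt≡1 M′) (sym (τt≡1 M)))))

from-t : ∀ M {x y} → x * t M ℚ.≤ y → x ℚ.≤ y * τ M
from-t M {x} {y} h = ≤-by-t M (ℚ.≤-trans h (ℚ.≤-reflexive (sym
  (trans (ℚ.*-assoc y (τ M) (t M)) (trans (cong (y *_) (τt≡1 M)) (ℚ.*-identityʳ y))))))

archimedes : ∀ x → ∃ λ N → x ℚ.≤ ofℕ N
archimedes x@(mkℚ n d-1 _) = ℤ.∣ n ∣ , ℚ.toℚᵘ-cancel-≤ (ℚᵘ.≤-respʳ-≃ (ℚᵘ.≃-sym (ℚ.toℚᵘ-fromℚᵘ (mkℚᵘ (+ ℤ.∣ n ∣) 0))) (*≤* (bound n)))
  where
  bound : ∀ n → n ℤ.* + 1 ℤ.≤ + ℤ.∣ n ∣ ℤ.* + suc d-1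
  bound (+ k) = ℤ.≤-trans (ℤ.≤-reflexive (ℤ.*-identityʳ (+ k)))
    (ℤ.≤-trans (ℤ.+≤+ (ℕ.m≤m*n k (suc d-1))) (ℤ.≤-reflexive (ℤ.pos-* k (suc d-1))))
  bound -[1+ k ] = ℤ.≤-trans (ℤ.≤-reflexive (ℤ.*-identityʳ -[1+ k ])) ℤ.-≤+

eventually-small : ∀ A δ → 0ℚ ℚ.< δ → ∃ λ N → A * τ N ℚ.≤ δ
eventually-small A δ 0<δ = N , ℚ.≤-trans
    (ℚ.*-monoʳ-≤-nonNeg (τ N) {{ℚ.nonNegative (0≤τ N)}} A≤)
    (ℚ.≤-reflexive (trans (ℚsolve 3 (λ t d i → t :*′ d :*′ i :=′ i :*′ t :*′ d) refl (t N) δ (τ N))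
      (trans (cong (_* δ) (τt≡1 N)) (ℚ.*-identityˡ δ))))
  where
  δ≢0 : δ ≢ 0ℚ
  δ≢0 eq = ℚ.<-irrefl (sym eq) 0<δ
  -- Any N ≥ A/δ works, since then A ≤ (N+1)δ; the sign of A is irrelevant.
  x = A ÷' δ
  N = proj₁ (archimedes x)
  A≤ : A ℚ.≤ t N * δ
  A≤ = ℚ.≤-trans (ℚ.≤-reflexive (sym (÷'-*-cancel A δ≢0)))
    (ℚ.*-monoʳ-≤-nonNeg δ {{ℚ.nonNegative (ℚ.<⇒≤ 0<δ)}} (ℚ.≤-trans (proj₂ (archimedes x)) (ofℕ-mono (ℕ.n≤1+n N))))

-- re X = O(l) and im X = O(l/M): differentiating a rational function gains a factor 1/M,
-- so the class is closed under products.
record O (l : ℕ → ℚ) (X : ℕ → Dual) : Set where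
  constructor mkO
  field
    constant : ℚ
    estimate : ∀ M → ∣ re (X M) ∣ ℚ.≤ constant * l M × ∣ im (X M) ∣ * t M ℚ.≤ constant * l M

open O

O-cong : ∀ {l l′ X Y} → (∀ M → l M ≡ l′ M) → (∀ M → X M ≡ Y M) → O l X → O l′ Y
O-cong l≡ X≡ (mkO K bound) = mkO K λ M →
    subst₂ (λ x λ′ → ∣ re x ∣ ℚ.≤ K * λ′) (X≡ M) (l≡ M) (proj₁ (bound M))
  , subst₂ (λ x λ′ → ∣ im x ∣ * t M ℚ.≤ K * λ′) (X≡ M) (l≡ M) (proj₂ (bound M))

O-⊕ : ∀ {l X Y} → O l X → O l Y → O l (λ M → X M ⊕ Y M)
O-⊕ {l} {X} {Y} (mkO K x) (mkO K′ y) = mkO (K + K′) λ M →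
    ℚ.≤-trans (ℚ.≤-reflexive (cong ∣_∣ (re-⊕ (X M) (Y M)))) (ℚ.≤-trans (ℚ.∣p+q∣≤∣p∣+∣q∣ (re (X M)) (re (Y M)))
      (ℚ.≤-trans (ℚ.+-mono-≤ (proj₁ (x M)) (proj₁ (y M))) (distrib M)))
  , ℚ.≤-trans (ℚ.*-monoʳ-≤-nonNeg (t M) {{ℚ.nonNegative (0≤t M)}}
        (ℚ.≤-trans (ℚ.≤-reflexive (cong ∣_∣ (im-⊕ (X M) (Y M)))) (ℚ.∣p+q∣≤∣p∣+∣q∣ (im (X M)) (im (Y M)))))
      (ℚ.≤-trans (ℚ.≤-reflexive (ℚ.*-distribʳ-+ (t M) ∣ im (X M) ∣ ∣ im (Y M) ∣))
        (ℚ.≤-trans (ℚ.+-mono-≤ (proj₂ (x M)) (proj₂ (y M))) (distrib M)))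
  where
  distrib : ∀ M → K * l M + K′ * l M ℚ.≤ (K + K′) * l M
  distrib M = ℚ.≤-reflexive (sym (ℚ.*-distribʳ-+ (l M) K K′))

-- Each of the two summands in the ε-part of a product contains exactly one ε-part and so gains the
-- factor 1/t once. Their number accounts for the constant 2KK′, which also covers the real part
-- because KK′ll′ is non-negative.
O-⊗ : ∀ {l l′ X Y} → O l X → O l′ Y → O (λ M → l M * l′ M) (λ M → X M ⊗ Y M)
O-⊗ {l} {l′} {X} {Y} (mkO K x) (mkO K′ y) = mkO (K * K′ + K * K′) λ M →
  let P  = K * l M * (K′ * l′ M)
      a  = ∣ re (X M) ∣ ; a′ = ∣ im (X M) ∣ ; b = ∣ re (Y M) ∣ ; b′ = ∣ im (Y M) ∣
      0≤a = ℚ.0≤∣p∣ (re (X M)) ; 0≤b = ℚ.0≤∣p∣ (re (Y M))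
      0≤a′t = *-nonNeg (ℚ.0≤∣p∣ (im (X M))) (0≤t M)
      0≤b′t = *-nonNeg (ℚ.0≤∣p∣ (im (Y M))) (0≤t M)
      ab≤P = *-mono-≤ 0≤a 0≤b (proj₁ (x M)) (proj₁ (y M))
      P+P≡ = ℚsolve 4 (λ c c′ l l′ → c :*′ l :*′ (c′ :*′ l′) :+′ c :*′ l :*′ (c′ :*′ l′)
               :=′ (c :*′ c′ :+′ c :*′ c′) :*′ (l :*′ l′)) refl K K′ (l M) (l′ M)
  in
    ℚ.≤-trans (ℚ.≤-reflexive (trans (cong ∣_∣ (re-⊗ (X M) (Y M))) (ℚ.∣p*q∣≡∣p∣*∣q∣ (re (X M)) (re (Y M)))))
      (ℚ.≤-trans ab≤P (ℚ.≤-trans (p≤p+q {P} {P} (ℚ.≤-trans (*-nonNeg 0≤a 0≤b) ab≤P)) (ℚ.≤-reflexive P+P≡)))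
  , ℚ.≤-trans (ℚ.*-monoʳ-≤-nonNeg (t M) {{ℚ.nonNegative (0≤t M)}}
        (ℚ.≤-trans (ℚ.≤-reflexive (cong ∣_∣ (im-⊗ (X M) (Y M))))
          (ℚ.≤-trans (ℚ.∣p+q∣≤∣p∣+∣q∣ (re (X M) * im (Y M)) (im (X M) * re (Y M)))
            (ℚ.≤-reflexive (cong₂ _+_ (ℚ.∣p*q∣≡∣p∣*∣q∣ (re (X M)) (im (Y M))) (ℚ.∣p*q∣≡∣p∣*∣q∣ (im (X M)) (re (Y M))))))))
      (ℚ.≤-trans (ℚ.≤-reflexive (ℚsolve 5 (λ a a′ b b′ t → (a :*′ b′ :+′ a′ :*′ b) :*′ t :=′ a :*′ (b′ :*′ t) :+′ (a′ :*′ t) :*′ b) refl a a′ b b′ (t M)))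
        (ℚ.≤-trans (ℚ.+-mono-≤ (*-mono-≤ 0≤a 0≤b′t (proj₁ (x M)) (proj₂ (y M))) (*-mono-≤ 0≤a′t 0≤b (proj₂ (x M)) (proj₁ (y M))))
          (ℚ.≤-reflexive P+P≡)))

O-const : ∀ {l} c → (∀ M → 1ℚ ℚ.≤ l M) → O l (λ _ → const c)
O-const {l} c 1≤l = mkO ∣ c ∣ λ M →
    ℚ.≤-trans (ℚ.≤-reflexive (sym (ℚ.*-identityʳ ∣ c ∣))) (scale M (1≤l M))
  , ℚ.≤-trans (ℚ.≤-reflexive (trans (ℚ.*-zeroˡ (t M)) (sym (ℚ.*-zeroʳ ∣ c ∣)))) (scale M (ℚ.≤-trans (0≤ofℕ 1) (1≤l M)))
  where
  scale : ∀ M {x} → x ℚ.≤ l M → ∣ c ∣ * x ℚ.≤ ∣ c ∣ * l M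
  scale M = ℚ.*-monoˡ-≤-nonNeg ∣ c ∣ {{ℚ.∣-∣-nonNeg c}}

opaque
  unfolding _⊕_
  pt-⊕const : ∀ M c → pt M ⊕ const c ≡ ofℕ M + c +ε 1ℚ
  pt-⊕const M c = refl

O-pt : ∀ c → O t (λ M → pt M ⊕ const c)
O-pt c = mkO (1ℚ + ∣ c ∣) λ M → subst (λ x → ∣ re x ∣ ℚ.≤ (1ℚ + ∣ c ∣) * t M × ∣ im x ∣ * t M ℚ.≤ (1ℚ + ∣ c ∣) * t M) (sym (pt-⊕const M c))
  ( ℚ.≤-trans (ℚ.∣p+q∣≤∣p∣+∣q∣ (ofℕ M) c)
      (ℚ.≤-trans (ℚ.+-mono-≤
          (ℚ.≤-trans (ℚ.≤-reflexive (ℚ.0≤p⇒∣p∣≡p (0≤ofℕ M))) (ℚ.≤-trans (ofℕ-mono (ℕ.n≤1+n M)) (ℚ.≤-reflexive (sym (ℚ.*-identityˡ (t M))))))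
          (ℚ.≤-trans (ℚ.≤-reflexive (sym (ℚ.*-identityʳ ∣ c ∣))) (ℚ.*-monoˡ-≤-nonNeg ∣ c ∣ {{ℚ.∣-∣-nonNeg c}} (1≤t M))))
        (ℚ.≤-reflexive (sym (ℚ.*-distribʳ-+ (t M) 1ℚ ∣ c ∣))))
  , ℚ.*-monoʳ-≤-nonNeg (t M) {{ℚ.nonNegative (0≤t M)}} (p≤p+q {1ℚ} (ℚ.0≤∣p∣ c)))

O-inv : ∀ i → O τ (λ M → inv (pt M ⊕ ι (+ suc i)))
O-inv i = mkO 1ℚ λ M → let u = τ (M ℕ.+ i) ; u≤τ = τ-antimono (ℕ.m≤m+n M i) ; 0≤u = 0≤τ (M ℕ.+ i) in
  subst (λ x → ∣ re (inv x) ∣ ℚ.≤ 1ℚ * τ M × ∣ im (inv x) ∣ * t M ℚ.≤ 1ℚ * τ M) (sym (pt-⊕ι M i))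
  ( ℚ.≤-trans (ℚ.≤-reflexive (ℚ.0≤p⇒∣p∣≡p 0≤u)) (ℚ.≤-trans u≤τ (ℚ.≤-reflexive (sym (ℚ.*-identityˡ (τ M)))))
  , ℚ.≤-trans (ℚ.≤-reflexive (cong (_* t M) (trans (ℚ.∣-p∣≡∣p∣ (1ℚ * (u * u)))
        (trans (cong ∣_∣ (ℚ.*-identityˡ (u * u))) (ℚ.0≤p⇒∣p∣≡p (*-nonNeg 0≤u 0≤u))))))
      (ℚ.≤-trans (ℚ.*-monoʳ-≤-nonNeg (t M) {{ℚ.nonNegative (0≤t M)}} (*-mono-≤ 0≤u 0≤u u≤τ u≤τ))
        (ℚ.≤-reflexive (trans (ℚsolve 2 (λ u t → u :*′ u :*′ t :=′ (u :*′ t) :*′ u) refl (τ M) (t M)) (cong (_* τ M) (τt≡1 M))))))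

-- Numerator and denominator are paired factor by factor: each (i-z)/(z+i+1) is bounded, and its
-- derivative is O(1/M).
O-fall-rising : ∀ n → O (λ _ → 1ℚ) (λ M → fall n (pt M) ⊗ inv (rising n (pt M)))
O-fall-rising zero    = O-cong (λ _ → refl) (λ M → sym (⊗-inv {1D} (λ ()))) (O-const 1ℚ (λ _ → ℚ.≤-refl))
O-fall-rising (suc n) = O-cong lengths terms (O-⊗ (O-fall-rising n) (O-⊗ (O-⊗ (O-const {λ _ → 1ℚ} (- 1ℚ) (λ _ → ℚ.≤-refl)) (O-pt (- ofℕ n))) (O-inv n)))
  where
  lengths : ∀ M → 1ℚ * (1ℚ * t M * τ M) ≡ 1ℚ
  lengths M = trans (ℚsolve 2 (λ t u → # (+ 1) :*′ (# (+ 1) :*′ t :*′ u) :=′ u :*′ t) refl (t M) (τ M)) (τt≡1 M)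
  terms : ∀ M → fall n (pt M) ⊗ inv (rising n (pt M)) ⊗ (const (- 1ℚ) ⊗ (pt M ⊕ const (- ofℕ n)) ⊗ inv (pt M ⊕ ι (+ suc n)))
    ≡ fall (suc n) (pt M) ⊗ inv (rising (suc n) (pt M))
  terms M = begin
    f ⊗ i ⊗ (const (- 1ℚ) ⊗ (z ⊕ const (- ofℕ n)) ⊗ j)
      ≡⟨ cong₂ (λ u v → f ⊗ i ⊗ (u ⊗ (z ⊕ v) ⊗ j)) (const-⊖ 1ℚ) (const-⊖ (ofℕ n)) ⟩
    f ⊗ i ⊗ (⊖ 1D ⊗ (z ⊕ ⊖ ι (+ n)) ⊗ j)
      ≡⟨ solve 5 (λ f i z n j → f :* i :* (:- con (+ 1) :* (z :+ :- n) :* j) := f :* (n :- z) :* (i :* j)) refl f i z (ι (+ n)) j ⟩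
    f ⊗ (ι (+ n) ⊝ z) ⊗ (i ⊗ j)
      ≡⟨ cong₂ (λ u v → f ⊗ u ⊗ v) (sym (fall-factor (ofℕ n) z)) (sym (inv-⊗ (rising≢0 n M) (pt≢0 M n))) ⟩
    fall (suc n) z ⊗ inv (rising (suc n) z) ∎
    where
    z = pt M
    f = fall n z
    i = inv (rising n z)
    j = inv (z ⊕ ι (+ suc n))

O-fall-rising₂ : ∀ n → O (λ M → τ M * τ M) (λ M → fall n (pt M) ⊗ inv (rising (suc (suc n)) (pt M)))
O-fall-rising₂ n = O-cong (λ M → ℚsolve 1 (λ u → # (+ 1) :*′ u :*′ u :=′ u :*′ u) refl (τ M)) terms
  (O-⊗ (O-⊗ (O-fall-rising n) (O-inv n)) (O-inv (suc n)))
  where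
  terms : ∀ M → fall n (pt M) ⊗ inv (rising n (pt M)) ⊗ inv (pt M ⊕ ι (+ suc n)) ⊗ inv (pt M ⊕ ι (+ suc (suc n)))
    ≡ fall n (pt M) ⊗ inv (rising (suc (suc n)) (pt M))
  terms M = trans (solve 4 (λ f i j k → f :* i :* j :* k := f :* (i :* j :* k)) refl (fall n (pt M)) _ _ _)
    (cong (fall n (pt M) ⊗_) (sym (trans (inv-⊗ (rising≢0 (suc n) M) (pt≢0 M (suc n)))
      (cong (_⊗ inv (pt M ⊕ ι (+ suc (suc n)))) (inv-⊗ (rising≢0 n M) (pt≢0 M n))))))

1≤t^ : ∀ k M → 1ℚ ℚ.≤ t M ^' k
1≤t^ zero    M = ℚ.≤-refl
1≤t^ (suc k) M = *-mono-≤ (0≤ofℕ 1) (0≤ofℕ 1) (1≤t M) (1≤t^ k M)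

O-evalD : ∀ c f → O (λ M → t M ^' length f) (λ M → evalD (c ∷ f) (pt M))
O-evalD c []      = O-cong (λ _ → refl) (λ M → solve 2 (λ c z → c := c :+ z :* con (+ 0)) refl (const c) (pt M)) (O-const c (λ _ → ℚ.≤-refl))
O-evalD c (d ∷ f) = O-⊕ (O-const c (1≤t^ (suc (length f))))
  (O-cong (λ _ → refl) (λ M → cong (_⊗ evalD (d ∷ f) (pt M)) (⊕-identityʳ (pt M))) (O-⊗ (O-pt 0ℚ) (O-evalD d f)))

-- The two excess factors in each denominator give τ⁴, which exactly balances the degree 4 of T.
-- Hence G is bounded and its ε-part is O(1/M).
O-G : ∀ ρ n′ → O (λ _ → 1ℚ) (Antidifference.G ρ n′)
O-G ρ n′ = O-cong lengths (λ _ → refl)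
  (O-⊗ (O-⊗ (O-fall-rising₂ (suc n′)) (O-fall-rising₂ (suc n′))) (O-evalD (κ t₀) (κ t₁ ∷ κ t₂ ∷ κ t₃ ∷ κ t₄ ∷ [])))
  where
  κ : List (List ℤ) → ℚ
  κ u = coeffT u ρ (suc n′)
  lengths : ∀ M → τ M * τ M * (τ M * τ M) * (t M ^' 4) ≡ 1ℚ
  lengths M = trans (ℚsolve 2 (λ u t → u :*′ u :*′ (u :*′ u) :*′ (t :*′ (t :*′ (t :*′ (t :*′ # (+ 1)))))
      :=′ u :*′ t :*′ (u :*′ t) :*′ (u :*′ t :*′ (u :*′ t))) refl (τ M) (t M))
    (cong (λ x → x * x * (x * x)) (τt≡1 M))

-- Of the four factors τ the two linear factors of the numerator consume two, so F_{m,1} is O(1/M²).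
O-R̂ : ∀ ρ m′ → O (λ M → τ M * τ M) (R̂ ρ (suc m′))
O-R̂ ρ m′ = O-cong lengths (λ _ → refl)
  (O-⊗ (O-⊗ (O-fall-rising₂ m′) (O-fall-rising₂ m′)) (O-⊗ (O-pt (ofℕ 1 - ofℕ (suc m′))) (O-pt (- ofℕ (ρ ℕ.* suc m′)))))
  where
  lengths : ∀ M → τ M * τ M * (τ M * τ M) * (t M * t M) ≡ τ M * τ M
  lengths M = trans (ℚsolve 2 (λ u t → u :*′ u :*′ (u :*′ u) :*′ (t :*′ t) :=′ u :*′ t :*′ (u :*′ t) :*′ (u :*′ u)) refl (τ M) (t M))
    (trans (cong (λ x → x * x * (τ M * τ M)) (τt≡1 M)) (ℚ.*-identityˡ (τ M * τ M)))

-- Convergence of the partial sums and the limit recurrence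

τ-difference : ∀ M → τ M - τ (suc M) ≡ τ M * τ (suc M)
τ-difference M = trans (sym (cong₂ _-_ (trans (cong (τ M *_) (τt≡1 (suc M))) (ℚ.*-identityʳ (τ M)))
    (trans (cong (τ (suc M) *_) (τt≡1 M)) (ℚ.*-identityʳ (τ (suc M))))))
  (trans (cong (λ y → τ M * (τ (suc M) * y) - τ (suc M) * (τ M * t M)) (ofℕ-+ 1 (suc M)))
    (ℚsolve 3 (λ u v t → u :*′ (v :*′ (# (+ 1) :+′ t)) :-′ v :*′ (u :*′ t) :=′ u :*′ v) refl (τ M) (τ (suc M)) (t M)))

-- From 1/(M+1) ≤ 2/(M+2): the bound 1/(M+1)² is replaced by a telescoping majorant, so tails can be
-- summed explicitly.
τ²≤ : ∀ M → τ M * τ M ℚ.≤ ofℕ 2 * (τ M - τ (suc M))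
τ²≤ M = ℚ.≤-trans (ℚ.*-monoˡ-≤-nonNeg (τ M) {{ℚ.nonNegative (0≤τ M)}} τ≤2τ′)
  (ℚ.≤-reflexive (trans (ℚsolve 2 (λ u v → u :*′ (# (+ 2) :*′ v) :=′ # (+ 2) :*′ (u :*′ v)) refl (τ M) (τ (suc M)))
    (cong (ofℕ 2 *_) (sym (τ-difference M)))))
  where
  τ≤2τ′ : τ M ℚ.≤ ofℕ 2 * τ (suc M)
  τ≤2τ′ = ≤-by-t (suc M) (ℚ.≤-trans
    (ℚ.≤-reflexive (trans (cong (τ M *_) (ofℕ-+ 1 (suc M)))
      (trans (ℚsolve 2 (λ u t → u :*′ (# (+ 1) :+′ t) :=′ u :+′ u :*′ t) refl (τ M) (t M)) (cong (λ x → τ M + x) (τt≡1 M)))))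
    (ℚ.≤-trans (ℚ.+-monoˡ-≤ 1ℚ (τ-antimono {0} {M} z≤n))
      (ℚ.≤-reflexive (sym (trans (ℚ.*-assoc (ofℕ 2) (τ (suc M)) (t (suc M))) (cong (ofℕ 2 *_) (τt≡1 (suc M))))))))

module Convergence (s d : ℕ → ℚ) (K : ℚ) (s-suc : ∀ M → s (suc M) ≡ s M + d M) (d≤ : ∀ M → ∣ d M ∣ ℚ.≤ K * (τ M * τ M)) where

  0≤K : 0ℚ ℚ.≤ K
  0≤K = ℚ.≤-trans (ℚ.0≤∣p∣ (d 0)) (ℚ.≤-trans (d≤ 0) (ℚ.≤-reflexive (ℚ.*-identityʳ K)))

  tail-bound : ∀ N k → ∣ s (k ℕ.+ N) - s N ∣ ℚ.≤ K * (ofℕ 2 * (τ N - τ (k ℕ.+ N)))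
  tail-bound N zero    = ℚ.≤-reflexive (trans (cong ∣_∣ (ℚ.+-inverseʳ (s N)))
    (sym (trans (cong (λ x → K * (ofℕ 2 * x)) (ℚ.+-inverseʳ (τ N))) (ℚ.*-zeroʳ K))))
  tail-bound N (suc k) = ℚ.≤-trans
    (ℚ.≤-reflexive (cong ∣_∣ (trans (cong (_- s N) (s-suc (k ℕ.+ N)))
      (ℚsolve 3 (λ a d b → a :+′ d :-′ b :=′ a :-′ b :+′ d) refl (s (k ℕ.+ N)) (d (k ℕ.+ N)) (s N)))))
    (ℚ.≤-trans (ℚ.∣p+q∣≤∣p∣+∣q∣ (s (k ℕ.+ N) - s N) (d (k ℕ.+ N)))
      (ℚ.≤-trans (ℚ.+-mono-≤ (tail-bound N k)
          (ℚ.≤-trans (d≤ (k ℕ.+ N)) (ℚ.*-monoˡ-≤-nonNeg K {{ℚ.nonNegative 0≤K}} (τ²≤ (k ℕ.+ N)))))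
        (ℚ.≤-reflexive (ℚsolve 4 (λ c a b e → c :*′ (# (+ 2) :*′ (a :-′ b)) :+′ c :*′ (# (+ 2) :*′ (b :-′ e)) :=′ c :*′ (# (+ 2) :*′ (a :-′ e)))
          refl K (τ N) (τ (k ℕ.+ N)) (τ (suc k ℕ.+ N))))))

  tail-≤ : ∀ N M → N ℕ.≤ M → ∣ s M - s N ∣ ℚ.≤ K * (ofℕ 2 * τ N)
  tail-≤ N M N≤M = ℚ.≤-trans (subst (λ m → ∣ s m - s N ∣ ℚ.≤ K * (ofℕ 2 * (τ N - τ m))) (ℕ.m∸n+n≡m N≤M) (tail-bound N (M ℕ.∸ N)))
    (ℚ.*-monoˡ-≤-nonNeg K {{ℚ.nonNegative 0≤K}} (ℚ.*-monoˡ-≤-nonNeg (ofℕ 2)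
      (ℚ.≤-trans (ℚ.+-monoʳ-≤ (τ N) (ℚ.neg-antimono-≤ (0≤τ M))) (ℚ.≤-reflexive (ℚ.+-identityʳ (τ N))))))

  cauchy : IsCauchy s
  cauchy δ 0<δ = N , λ M M′ N≤M N≤M′ → ℚ.≤-trans
      (ℚ.≤-reflexive (cong ∣_∣ (ℚsolve 3 (λ a b c → a :-′ b :=′ a :-′ c :-′ (b :-′ c)) refl (s M) (s M′) (s N))))
      (ℚ.≤-trans (ℚ.∣p-q∣≤∣p∣+∣q∣ (s M - s N) (s M′ - s N))
        (ℚ.≤-trans (ℚ.+-mono-≤ (tail-≤ N M N≤M) (tail-≤ N M′ N≤M′))
          (ℚ.≤-trans (ℚ.≤-reflexive (ℚsolve 2 (λ c u → c :*′ (# (+ 2) :*′ u) :+′ c :*′ (# (+ 2) :*′ u) :=′ # (+ 4) :*′ c :*′ u) refl K (τ N)))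
            (proj₂ small))))
    where
    -- Both M and M′ are compared with N, and each comparison costs at most 2Kτ(N).
    small = eventually-small (ofℕ 4 * K) δ 0<δ
    N = proj₁ small

rPartial-cauchy : ∀ ρ m′ → IsCauchy (rPartial ρ (suc m′))
rPartial-cauchy ρ m′ = Convergence.cauchy (rPartial ρ (suc m′)) (λ M → - (½ * im (R̂ ρ (suc m′) M))) (½ * K) step bound
  where
  K = constant (O-R̂ ρ m′)
  step : ∀ M → rPartial ρ (suc m′) (suc M) ≡ rPartial ρ (suc m′) M + - (½ * im (R̂ ρ (suc m′) M))
  step M = trans (cong (λ x → - (½ * x)) (PartialSums.S-suc ρ m′ (suc m′) M))
    (ℚsolve 3 (λ h a b → :-′ (h :*′ (a :+′ b)) :=′ :-′ (h :*′ a) :+′ :-′ (h :*′ b)) refl ½ (S ρ (suc m′) M) (im (R̂ ρ (suc m′) M)))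
  bound : ∀ M → ∣ - (½ * im (R̂ ρ (suc m′) M)) ∣ ℚ.≤ ½ * K * (τ M * τ M)
  bound M = ℚ.≤-trans (ℚ.≤-reflexive (trans (ℚ.∣-p∣≡∣p∣ (½ * x)) (ℚ.∣p*q∣≡∣p∣*∣q∣ ½ x)))
    (ℚ.≤-trans (ℚ.*-monoˡ-≤-nonNeg ½ (ℚ.≤-trans
        -- The class `O` even gives O(1/M³) for the ε-part; the additional factor t ≥ 1 is dropped,
        -- as 1/M² suffices for convergence.
        (ℚ.≤-trans (ℚ.≤-reflexive (sym (ℚ.*-identityʳ ∣ x ∣))) (ℚ.*-monoˡ-≤-nonNeg ∣ x ∣ {{ℚ.∣-∣-nonNeg x}} (1≤t M)))
        (proj₂ (estimate (O-R̂ ρ m′) M))))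
      (ℚ.≤-reflexive (sym (ℚ.*-assoc ½ K (τ M * τ M)))))
    where x = im (R̂ ρ (suc m′) M)

1≤suc² : ∀ n → 1ℚ ℚ.≤ suc² n
1≤suc² n = *-mono-≤ (0≤ofℕ 1) (0≤ofℕ 1) 1≤ 1≤
  where
  1≤ : 1ℚ ℚ.≤ ofℕ n + 1ℚ
  1≤ = ℚ.≤-trans (p≤p+q {1ℚ} (0≤ofℕ n)) (ℚ.≤-reflexive (ℚ.+-comm 1ℚ (ofℕ n)))

rPartial-recurrence : ∀ ρ n′ → TendsToZero (λ M → recLHS ρ (λ m → rPartial ρ m M) (suc n′))
rPartial-recurrence ρ n′ δ 0<δ = N , λ M N≤M → ℚ.≤-trans (bound M)
    (ℚ.≤-trans (ℚ.*-monoˡ-≤-nonNeg K {{ℚ.nonNegative 0≤K}} (τ-antimono N≤M)) (proj₂ small))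
  where
  open Antidifference ρ n′ using (G)
  K = constant (O-G ρ n′)
  G≤ : ∀ M → ∣ im (G M) ∣ * t M ℚ.≤ K
  G≤ M = ℚ.≤-trans (proj₂ (estimate (O-G ρ n′) M)) (ℚ.≤-reflexive (ℚ.*-identityʳ K))
  0≤K : 0ℚ ℚ.≤ K
  0≤K = ℚ.≤-trans (*-nonNeg (ℚ.0≤∣p∣ (im (G 0))) (0≤t 0)) (G≤ 0)
  small = eventually-small K δ 0<δ
  N = proj₁ small
  -- The factor (n+1)² on the left is at least 1, so removing it only strengthens the bound.
  absorb : ∀ x {y} → suc² (suc n′) * x ≡ - y → ∣ x ∣ ℚ.≤ ∣ y ∣
  absorb x {y} eq = ℚ.≤-trans (ℚ.≤-reflexive (sym (ℚ.*-identityˡ ∣ x ∣)))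
    (ℚ.≤-trans (ℚ.*-monoʳ-≤-nonNeg ∣ x ∣ {{ℚ.∣-∣-nonNeg x}} (1≤suc² (suc n′)))
      (ℚ.≤-reflexive (trans (cong (_* ∣ x ∣) (sym (ℚ.0≤p⇒∣p∣≡p (ℚ.≤-trans (0≤ofℕ 1) (1≤suc² (suc n′))))))
        (trans (sym (ℚ.∣p*q∣≡∣p∣*∣q∣ (suc² (suc n′)) x)) (trans (cong ∣_∣ eq) (ℚ.∣-p∣≡∣p∣ y))))))
  bound : ∀ M → ∣ recLHS ρ (λ m → rPartial ρ m M) (suc n′) ∣ ℚ.≤ K * τ M
  bound M = ℚ.≤-trans (absorb (recLHS ρ (λ m → rPartial ρ m M) (suc n′)) (PartialSums.rec-rPartial ρ n′ M)) (from-t M (G≤ M))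

theorem2 : (ρ : ℕ) → 1 ≤ ρ → (n : ℕ) → 1 ≤ n →
    SatisfiesRec ρ (q ρ) n
    × SatisfiesRec ρ (p ρ) n
    × ((m : ℕ) → 1 ≤ m → IsCauchy (rPartial ρ m))
    × TendsToZero (λ M → recLHS ρ (λ m → rPartial ρ m M) n)
theorem2 ρ _ (suc n′) _ =
  q-recurrence ρ n′ , p-recurrence ρ n′ , (λ { (suc m′) _ → rPartial-cauchy ρ m′ }) , rPartial-recurrence ρ n′
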